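{- For $n\in\{0,1,2,\dots\}$ let \[ e_n=-\frac{1}{(2n)!!}\sum_{k=0}^{n}\binom nk2^k\sum_{\ell=0}^{k}S(k,\ell)\frac{(2\ell-3)!!}{2^{\ell}},\qquad d_n=\frac{(-1)^n}{n!}\sum_{k=0}^{n}(-1)^kS(n,k)(2k-3)!!. \] Then, with the principal branch of the square root, \[ \sqrt{e^x(2-e^x)}=\sum_{n=0}^{\infty}e_nx^n,\qquad |x|<\ln2. \] Moreover, for $n\in\mathbb{N}$ define the $n\times n$ matrices $E^{(n)}=(E_{ij})$ and $F^{(n)}=(F_{ij})$, $1\le i,j\le n$, by $E_{ij}=e_{i-j+1}$ and $F_{ij}=(i-j+2)\,d_{i-j+2}$ for $j\le i+1$, and $E_{ij}=F_{ij}=0$ for $j\ge i+2$. (Thus $e_0=1$, $e_1=0$, $e_2=e_3=-\frac12$, and $d_1=1$, $2d_2=0$, $3d_3=4d_4=\frac12$.) Then for every $n\in\mathbb{N}$, \[ d_{n+1}=\frac{(-1)^n}{n+1}\det E^{(n)}\qquad\text{and}\qquad e_n=(-1)^n\det F^{(n)}. \]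
   Context: $S(n,k)$ are the Stirling numbers of the second kind, given by $\frac{(e^x-1)^k}{k!}=\sum_{n\ge k}S(n,k)\frac{x^n}{n!}$. Double factorials: $(2j)!!=2^jj!$ with $0!!=1$, $(2j-1)!!=1\cdot3\cdots(2j-1)$ for $j\ge1$, and $[-(2j+1)]!!=(-1)^j/(2j-1)!!$ for $j\ge0$, so $(-1)!!=1$ and $(-3)!!=-1$. -}

module Defs where

import Algebra.Definitions.RawMonoid
import Algebra.Properties.Monoid.Mult
open import Data.Bool.Base using (if_then_else_)
open import Data.Fin.Base using (Fin; zero; suc; toℕ; punchIn)
import Data.Integer.Base as ℤ
import Data.Integer.Properties as ℤ
open import Data.Integer.Base using (+_; -[1+_]; -1ℤ; 1ℤ)
open import Data.Nat.Base as ℕ using (ℕ; zero; suc; _∸_; _≤ᵇ_; _!)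
open import Data.Nat.Combinatorics using (_C_)
import Data.Nat.Coprimality as Coprime
import Data.Nat.Properties as ℕ
open import Data.Product.Base using (_×_; _,_; proj₁; proj₂; ∃-syntax)
open import Data.Rational.Base as ℚ using (ℚ; mkℚ; 0ℚ; 1ℚ; ½; _/_; *≤*; *<*)
import Data.Rational.Properties as ℚ
open import Data.Rational.Unnormalised.Base as ℚᵘ using (mkℚᵘ; *≡*)
import Data.Rational.Unnormalised.Properties as ℚᵘ
open import Data.Rational.Solver using (module +-*-Solver)
open import Data.Integer.Solver using () renaming (module +-*-Solver to ℤ-Solver)
open import Data.Sum.Base using (_⊎_; inj₁; inj₂)
open import Relation.Binary.PropositionalEquality
open import Relation.Nullary using (¬_; yes; no; contradiction)

fromℕ : ℕ → ℚ
fromℕ n = + n / 1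

-- Σ≤ n f = f 0 + f 1 + ⋯ + f n
Σ≤ : ℕ → (ℕ → ℚ) → ℚ
Σ≤ zero    f = f 0
Σ≤ (suc n) f = Σ≤ n f ℚ.+ f (suc n)

1/ℕ : (n : ℕ) .{{_ : ℕ.NonZero n}} → ℚ
1/ℕ n = 1ℤ / n

1/_! : ℕ → ℚ
1/ n ! = 1/ℕ (n !) {{n ℕ.!≢0}}

1/2^_ : ℕ → ℚ
1/2^ n = 1/ℕ (2 ℕ.^ n) {{ℕ.m^n≢0 2 n}}

-1^_ : ℕ → ℚ
-1^ n = (-1ℤ ℤ.^ n) / 1

FPS : Set
FPS = ℕ → ℚ

oneˢ : FPS
oneˢ zero    = 1ℚ
oneˢ (suc _) = 0ℚ

_*ˢ_ : FPS → FPS → FPS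
(f *ˢ g) n = Σ≤ n (λ k → f k ℚ.* g (n ∸ k))

_^ˢ_ : FPS → ℕ → FPS
f ^ˢ zero  = oneˢ
f ^ˢ suc k = f *ˢ (f ^ˢ k)

exp-1ˢ : FPS
exp-1ˢ zero    = 0ℚ
exp-1ˢ (suc n) = 1/ (suc n) !

-- (eˣ - 1)ᵏ / k! = Σₙ S(n,k) xⁿ / n!, read as an identity of formal
-- power series.  S is therefore ℚ-valued; it vanishes for n < k.
S : ℕ → ℕ → ℚ
S n k = fromℕ (n !) ℚ.* (1/ k ! ℚ.* (exp-1ˢ ^ˢ k) n)

-- evenDF j is (2j)!!; oddProduct j is (2j - 1)!! for j ≥ 0, where the empty
-- product gives (-1)!! = 1.
evenDF : ℕ → ℕ
evenDF j = 2 ℕ.^ j ℕ.* j !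

oddProduct : ℕ → ℕ
oddProduct zero    = 1
oddProduct (suc j) = oddProduct j ℕ.* suc (2 ℕ.* j)

private
  oddProduct-nonZero : ∀ {j} → ℕ.NonZero (oddProduct j)
  oddProduct-nonZero {zero}  = _
  oddProduct-nonZero {suc j} =
    ℕ.m*n≢0 (oddProduct j) (suc (2 ℕ.* j)) {{oddProduct-nonZero {j}}}

1/evenDF : ℕ → ℚ
1/evenDF j = 1/ℕ (evenDF j)
  {{ℕ.m*n≢0 (2 ℕ.^ j) (j !) {{ℕ.m^n≢0 2 j}} {{j ℕ.!≢0}}}}

-- oddDF i = (2i - 1)!! for every integer i: at i = -j with j ≥ 1 this is
-- [-(2j + 1)]!! = (-1)ʲ / (2j - 1)!!.
oddDF : ℤ.ℤ → ℚ
oddDF (+ j)    = fromℕ (oddProduct j)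
oddDF -[1+ j ] = -1^ (suc j) ℚ.* 1/ℕ (oddProduct (suc j)) {{oddProduct-nonZero {suc j}}}

[2_-3]!! : ℕ → ℚ
[2 l -3]!! = oddDF (+ l ℤ.- 1ℤ)

e : ℕ → ℚ
e n = ℚ.- (1/evenDF n ℚ.* Σ≤ n λ k →
        fromℕ (n C k) ℚ.* fromℕ (2 ℕ.^ k) ℚ.* Σ≤ k λ l →
          S k l ℚ.* ([2 l -3]!! ℚ.* 1/2^ l))

d : ℕ → ℚ
d n = (-1^ n ℚ.* 1/ n !) ℚ.* Σ≤ n λ k →
        (-1^ k) ℚ.* S n k ℚ.* [2 k -3]!!

open Algebra.Definitions.RawMonoid ℚ.+-0-rawMonoid public
  using (sum) renaming (_×_ to _·_)

Matrix : ℕ → Set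
Matrix n = Fin n → Fin n → ℚ

-- Laplace expansion along the first row.
det : ∀ {n} → Matrix n → ℚ
det {zero}  A = 1ℚ
det {suc n} A = sum λ j →
  (-1^ toℕ j) ℚ.* A zero j ℚ.* det (λ i k → A (suc i) (punchIn j k))

-- Rows and columns are counted from 0, which leaves i - j unchanged.
-- The truncated subtractions are only reached when j ≤ i + 1.
E : ∀ n → Matrix n
E n i j = if toℕ j ≤ᵇ suc (toℕ i) then e (suc (toℕ i) ∸ toℕ j) else 0ℚ

F : ∀ n → Matrix n
F n i j = if toℕ j ≤ᵇ suc (toℕ i) then fromℕ m ℚ.* d m else 0ℚ
  where m = suc (suc (toℕ i)) ∸ toℕ j

Cauchy : (ℕ → ℚ) → Set
Cauchy a = ∀ ε → 0ℚ ℚ.< ε →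
  ∃[ N ] ∀ m n → N ℕ.≤ m → N ℕ.≤ n → ℚ.∣ a m ℚ.- a n ∣ ℚ.< ε

record ℝ : Set where
  constructor mkℝ
  field
    seq    : ℕ → ℚ
    cauchy : Cauchy seq

open ℝ public

infix 4 _≈_ _<_ _≤_

_≈_ : ℝ → ℝ → Set
a ≈ b = ∀ ε → 0ℚ ℚ.< ε →
  ∃[ N ] ∀ n → N ℕ.≤ n → ℚ.∣ seq a n ℚ.- seq b n ∣ ℚ.< ε

_<_ : ℝ → ℝ → Set
a < b = ∃[ δ ] 0ℚ ℚ.< δ ×
  ∃[ N ] (∀ n → N ℕ.≤ n → seq a n ℚ.+ δ ℚ.< seq b n)

_≤_ : ℝ → ℝ → Set
a ≤ b = ¬ (b < a)

private
  open +-*-Solver using (solve; _:=_; _:+_; _:*_; :-_; _:-_; con)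

  const-cauchy : ∀ q → Cauchy (λ _ → q)
  const-cauchy q ε 0<ε = 0 , λ _ _ _ _ →
    subst (λ t → ℚ.∣ t ∣ ℚ.< ε) (sym (ℚ.+-inverseʳ q)) 0<ε

  halves : ∀ ε → ε ℚ.* ½ ℚ.+ ε ℚ.* ½ ≡ ε
  halves ε = trans (sym (ℚ.*-distribˡ-+ ε ½ ½)) (ℚ.*-identityʳ ε)

  *-pos : ∀ {p q} → 0ℚ ℚ.< p → 0ℚ ℚ.< q → 0ℚ ℚ.< p ℚ.* q
  *-pos {p} {q} 0<p 0<q = subst (ℚ._< p ℚ.* q) (ℚ.*-zeroʳ p)
    (ℚ.*-monoʳ-<-pos p {{ℚ.positive 0<p}} 0<q)

  *-mono-≤ : ∀ {p q r s} → 0ℚ ℚ.≤ p → 0ℚ ℚ.≤ s →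
             p ℚ.≤ q → r ℚ.≤ s → p ℚ.* r ℚ.≤ q ℚ.* s
  *-mono-≤ {p} {q} {r} {s} 0≤p 0≤s p≤q r≤s = ℚ.≤-trans
    (ℚ.*-monoˡ-≤-nonNeg p {{ℚ.nonNegative 0≤p}} r≤s)
    (ℚ.*-monoʳ-≤-nonNeg s {{ℚ.nonNegative 0≤s}} p≤q)

  +-cauchy : ∀ {a b} → Cauchy a → Cauchy b → Cauchy (λ n → a n ℚ.+ b n)
  +-cauchy {a} {b} ca cb ε 0<ε
    with ca (ε ℚ.* ½) (*-pos 0<ε (ℚ.positive⁻¹ ½))
       | cb (ε ℚ.* ½) (*-pos 0<ε (ℚ.positive⁻¹ ½))
  ... | N , p | M , q = N ℕ.⊔ M , λ m n N≤m N≤n → begin-strict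
      ℚ.∣ (a m ℚ.+ b m) ℚ.- (a n ℚ.+ b n) ∣
        ≡⟨ cong ℚ.∣_∣ (solve 4 (λ u v w x →
             (u :+ v) :- (w :+ x) := (u :- w) :+ (v :- x)) refl (a m) (b m) (a n) (b n)) ⟩
      ℚ.∣ (a m ℚ.- a n) ℚ.+ (b m ℚ.- b n) ∣
        ≤⟨ ℚ.∣p+q∣≤∣p∣+∣q∣ (a m ℚ.- a n) (b m ℚ.- b n) ⟩
      ℚ.∣ a m ℚ.- a n ∣ ℚ.+ ℚ.∣ b m ℚ.- b n ∣
        <⟨ ℚ.+-mono-< (p m n (ℕ.m⊔n≤o⇒m≤o N M N≤m) (ℕ.m⊔n≤o⇒m≤o N M N≤n))
                      (q m n (ℕ.m⊔n≤o⇒n≤o N M N≤m) (ℕ.m⊔n≤o⇒n≤o N M N≤n)) ⟩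
      ε ℚ.* ½ ℚ.+ ε ℚ.* ½  ≡⟨ halves ε ⟩
      ε  ∎
    where open ℚ.≤-Reasoning

  neg-cauchy : ∀ {a} → Cauchy a → Cauchy (λ n → ℚ.- a n)
  neg-cauchy {a} ca ε 0<ε with ca ε 0<ε
  ... | N , p = N , λ m n N≤m N≤n → subst (ℚ._< ε)
    (trans (sym (ℚ.∣-p∣≡∣p∣ (a m ℚ.- a n)))
           (cong ℚ.∣_∣ (ℚ.neg-distrib-+ (a m) (ℚ.- a n))))
    (p m n N≤m N≤n)

  bounded : ∀ {a} → Cauchy a →
            ∃[ B ] 0ℚ ℚ.< B × ∃[ N ] (∀ n → N ℕ.≤ n → ℚ.∣ a n ∣ ℚ.≤ B)
  bounded {a} ca with ca 1ℚ (ℚ.positive⁻¹ 1ℚ)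
  ... | N , p = 1ℚ ℚ.+ ℚ.∣ a N ∣ , 0<B , N , λ n N≤n → begin
      ℚ.∣ a n ∣
        ≡⟨ cong ℚ.∣_∣ (solve 2 (λ u v → u := (u :- v) :+ v) refl (a n) (a N)) ⟩
      ℚ.∣ (a n ℚ.- a N) ℚ.+ a N ∣
        ≤⟨ ℚ.∣p+q∣≤∣p∣+∣q∣ (a n ℚ.- a N) (a N) ⟩
      ℚ.∣ a n ℚ.- a N ∣ ℚ.+ ℚ.∣ a N ∣
        ≤⟨ ℚ.+-monoˡ-≤ ℚ.∣ a N ∣ (ℚ.<⇒≤ (p n N N≤n ℕ.≤-refl)) ⟩
      1ℚ ℚ.+ ℚ.∣ a N ∣ ∎
    where
    open ℚ.≤-Reasoning
    0<B : 0ℚ ℚ.< 1ℚ ℚ.+ ℚ.∣ a N ∣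
    0<B = ℚ.+-mono-<-≤ (ℚ.positive⁻¹ 1ℚ) (ℚ.0≤∣p∣ (a N))

  quotient : ∀ ε B → 0ℚ ℚ.< ε → 0ℚ ℚ.< B → ∃[ η ] 0ℚ ℚ.< η × B ℚ.* η ≡ ε
  quotient ε B 0<ε 0<B = ε ℚ.* 1/B , *-pos 0<ε 0<1/B , eq
    where
    instance
      B-pos : ℚ.Positive B
      B-pos = ℚ.positive 0<B
      B≢0 : ℚ.NonZero B
      B≢0 = ℚ.pos⇒nonZero B
    1/B = ℚ.1/ B
    0<1/B = ℚ.positive⁻¹ 1/B {{ℚ.1/pos⇒pos B}}
    eq : B ℚ.* (ε ℚ.* 1/B) ≡ ε
    eq = trans (solve 3 (λ u v w → u :* (v :* w) := v :* (u :* w)) refl B ε 1/B)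
               (trans (cong (ε ℚ.*_) (ℚ.*-inverseʳ B)) (ℚ.*-identityʳ ε))

  *-diff : ∀ u v w x → u ℚ.* v ℚ.- w ℚ.* x ≡ u ℚ.* (v ℚ.- x) ℚ.+ x ℚ.* (u ℚ.- w)
  *-diff = solve 4 (λ u v w x →
    u :* v :- w :* x := u :* (v :- x) :+ x :* (u :- w)) refl

  *-close : ∀ {u v w x A B η θ} → 0ℚ ℚ.< A → 0ℚ ℚ.< B →
    ℚ.∣ u ∣ ℚ.≤ A → ℚ.∣ x ∣ ℚ.≤ B → ℚ.∣ v ℚ.- x ∣ ℚ.< η → ℚ.∣ u ℚ.- w ∣ ℚ.< θ →
    ℚ.∣ u ℚ.* v ℚ.- w ℚ.* x ∣ ℚ.< A ℚ.* η ℚ.+ B ℚ.* θ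
  *-close {u} {v} {w} {x} {A} {B} {η} {θ} 0<A 0<B u≤A x≤B vx uw = begin-strict
    ℚ.∣ u ℚ.* v ℚ.- w ℚ.* x ∣
      ≡⟨ cong ℚ.∣_∣ (*-diff u v w x) ⟩
    ℚ.∣ u ℚ.* (v ℚ.- x) ℚ.+ x ℚ.* (u ℚ.- w) ∣
      ≤⟨ ℚ.∣p+q∣≤∣p∣+∣q∣ (u ℚ.* (v ℚ.- x)) (x ℚ.* (u ℚ.- w)) ⟩
    ℚ.∣ u ℚ.* (v ℚ.- x) ∣ ℚ.+ ℚ.∣ x ℚ.* (u ℚ.- w) ∣
      ≡⟨ cong₂ ℚ._+_ (ℚ.∣p*q∣≡∣p∣*∣q∣ u (v ℚ.- x)) (ℚ.∣p*q∣≡∣p∣*∣q∣ x (u ℚ.- w)) ⟩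
    ℚ.∣ u ∣ ℚ.* ℚ.∣ v ℚ.- x ∣ ℚ.+ ℚ.∣ x ∣ ℚ.* ℚ.∣ u ℚ.- w ∣
      ≤⟨ ℚ.+-mono-≤
           (ℚ.*-monoʳ-≤-nonNeg ℚ.∣ v ℚ.- x ∣ {{ℚ.∣-∣-nonNeg (v ℚ.- x)}} u≤A)
           (ℚ.*-monoʳ-≤-nonNeg ℚ.∣ u ℚ.- w ∣ {{ℚ.∣-∣-nonNeg (u ℚ.- w)}} x≤B) ⟩
    A ℚ.* ℚ.∣ v ℚ.- x ∣ ℚ.+ B ℚ.* ℚ.∣ u ℚ.- w ∣
      <⟨ ℚ.+-mono-< (ℚ.*-monoʳ-<-pos A {{ℚ.positive 0<A}} vx)
                    (ℚ.*-monoʳ-<-pos B {{ℚ.positive 0<B}} uw) ⟩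
    A ℚ.* η ℚ.+ B ℚ.* θ  ∎
    where open ℚ.≤-Reasoning

  *-cauchy : ∀ {a b} → Cauchy a → Cauchy b → Cauchy (λ n → a n ℚ.* b n)
  *-cauchy {a} {b} ca cb ε 0<ε = N₁₂ ℕ.⊔ N₃₄ , λ m n N≤m N≤n →
      subst (ℚ.∣ a m ℚ.* b m ℚ.- a n ℚ.* b n ∣ ℚ.<_)
        (trans (cong₂ ℚ._+_ (proj₂ (proj₂ η)) (proj₂ (proj₂ θ))) (halves ε))
        (*-close {u = a m} {v = b m} {w = a n} {x = b n} (proj₁ (proj₂ A)) (proj₁ (proj₂ B))
          (proj₂ (proj₂ (proj₂ A)) m (ℕ.m⊔n≤o⇒m≤o N₁ N₂ (ℕ.m⊔n≤o⇒m≤o N₁₂ N₃₄ N≤m)))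
          (proj₂ (proj₂ (proj₂ B)) n (ℕ.m⊔n≤o⇒n≤o N₁ N₂ (ℕ.m⊔n≤o⇒m≤o N₁₂ N₃₄ N≤n)))
          (proj₂ cb′ m n (ℕ.m⊔n≤o⇒m≤o N₃ N₄ (ℕ.m⊔n≤o⇒n≤o N₁₂ N₃₄ N≤m))
                         (ℕ.m⊔n≤o⇒m≤o N₃ N₄ (ℕ.m⊔n≤o⇒n≤o N₁₂ N₃₄ N≤n)))
          (proj₂ ca′ m n (ℕ.m⊔n≤o⇒n≤o N₃ N₄ (ℕ.m⊔n≤o⇒n≤o N₁₂ N₃₄ N≤m))
                         (ℕ.m⊔n≤o⇒n≤o N₃ N₄ (ℕ.m⊔n≤o⇒n≤o N₁₂ N₃₄ N≤n))))
    where
    A = bounded {a} ca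
    B = bounded {b} cb
    0<ε/2 = *-pos 0<ε (ℚ.positive⁻¹ ½)
    η = quotient (ε ℚ.* ½) (proj₁ A) 0<ε/2 (proj₁ (proj₂ A))
    θ = quotient (ε ℚ.* ½) (proj₁ B) 0<ε/2 (proj₁ (proj₂ B))
    cb′ = cb (proj₁ η) (proj₁ (proj₂ η))
    ca′ = ca (proj₁ θ) (proj₁ (proj₂ θ))
    N₁ = proj₁ (proj₂ (proj₂ A))
    N₂ = proj₁ (proj₂ (proj₂ B))
    N₃ = proj₁ cb′
    N₄ = proj₁ ca′
    N₁₂ = N₁ ℕ.⊔ N₂
    N₃₄ = N₃ ℕ.⊔ N₄

fromℚ : ℚ → ℝ
fromℚ q = mkℝ (λ _ → q) (const-cauchy q)

infixl 6 _+_ _-_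
infixl 7 _*_
infix  8 -_

_+_ : ℝ → ℝ → ℝ
a + b = mkℝ (λ n → seq a n ℚ.+ seq b n) (+-cauchy {seq a} {seq b} (cauchy a) (cauchy b))

-_ : ℝ → ℝ
- a = mkℝ (λ n → ℚ.- seq a n) (neg-cauchy {seq a} (cauchy a))

_-_ : ℝ → ℝ → ℝ
a - b = a + - b

_*_ : ℝ → ℝ → ℝ
a * b = mkℝ (λ n → seq a n ℚ.* seq b n) (*-cauchy {seq a} {seq b} (cauchy a) (cauchy b))

-- 1/ (n + 1)
mesh : ℕ → ℚ
mesh n = mkℚ (+ 1) n (Coprime.1-coprimeTo (suc n))

-- The largest multiple k · δ with k ≤ K and (k · δ)² ≤ q (and 0ℚ if q < 0).
search : ℚ → ℚ → ℕ → ℚ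
search q δ zero    = 0ℚ
search q δ (suc k) with (suc k · δ) ℚ.* (suc k · δ) ℚ.≤? q
... | yes _ = suc k · δ
... | no  _ = search q δ k

-- For q ≥ 0 this is at most √q and less than mesh n below it, by the three
-- lemmas that follow; the search range suffices because q < ∣ ↥ q ∣ + 1.
approxSqrt : ℚ → ℕ → ℚ
approxSqrt q n = search q (mesh n) (suc ℤ.∣ ℚ.↥ q ∣ ℕ.* suc n)

private
  open Algebra.Properties.Monoid.Mult ℚ.+-0-monoid using (×-assocˡ)
  open ℤ-Solver using () renaming
    (solve to ℤ-solve; _:=_ to _ℤ-=_; _:+_ to _ℤ-+_; _:*_ to _ℤ-*_; con to ℤ-con)

  ·-nonNeg : ∀ k {δ} → 0ℚ ℚ.≤ δ → 0ℚ ℚ.≤ k · δ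
  ·-nonNeg zero    0≤δ = ℚ.≤-refl
  ·-nonNeg (suc k) 0≤δ = ℚ.+-mono-≤ 0≤δ (·-nonNeg k 0≤δ)

  mesh-pos : ∀ n → 0ℚ ℚ.< mesh n
  mesh-pos n = ℚ.positive⁻¹ (mesh n)

  ·-mesh : ∀ k n → ℚ.toℚᵘ (k · mesh n) ℚᵘ.≃ mkℚᵘ (+ k) n
  ·-mesh zero    n = *≡* refl
  ·-mesh (suc k) n = ℚᵘ.≃-trans (ℚ.toℚᵘ-homo-+ (mesh n) (k · mesh n))
    (ℚᵘ.≃-trans (ℚᵘ.+-congʳ (mkℚᵘ (+ 1) n) (·-mesh k n))
      (*≡* (ℤ-solve 2 (λ K N →
        (ℤ-con (+ 1) ℤ-* N ℤ-+ K ℤ-* N) ℤ-* N ℤ-= (ℤ-con (+ 1) ℤ-+ K) ℤ-* (N ℤ-* N))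
        refl (+ k) (+ suc n))))

  suc·mesh : ∀ n → suc n · mesh n ≡ 1ℚ
  suc·mesh n = ℚ.toℚᵘ-injective (ℚᵘ.≃-trans (·-mesh (suc n) n)
    (*≡* (ℤ.*-comm (+ suc n) (+ 1))))

  <-·1 : ∀ q → q ℚ.< suc ℤ.∣ ℚ.↥ q ∣ · 1ℚ
  <-·1 q@(mkℚ p r _) = ℚ.toℚᵘ-cancel-< (ℚᵘ.<-respʳ-≃
    (ℚᵘ.≃-sym {ℚ.toℚᵘ (suc ℤ.∣ p ∣ · 1ℚ)} (·-mesh (suc ℤ.∣ p ∣) 0))
    (ℚᵘ.*<* (subst (ℤ._< + suc ℤ.∣ p ∣ ℤ.* + suc r) (sym (ℤ.*-identityʳ p))
      (ℤ.<-≤-trans (lt p) le))))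
    where
    lt : ∀ p → p ℤ.< + suc ℤ.∣ p ∣
    lt (+ n)    = ℤ.+<+ ℕ.≤-refl
    lt -[1+ n ] = ℤ.-<+
    le : + suc ℤ.∣ p ∣ ℤ.≤ + suc ℤ.∣ p ∣ ℤ.* + suc r
    le = subst (+ suc ℤ.∣ p ∣ ℤ.≤_) (ℤ.pos-* (suc ℤ.∣ p ∣) (suc r))
      (ℤ.+≤+ (ℕ.m≤m*n (suc ℤ.∣ p ∣) (suc r)))

  range : ∀ q n → let b = suc (suc ℤ.∣ ℚ.↥ q ∣ ℕ.* suc n) · mesh n in
          q ℚ.< b ℚ.* b
  range q n = begin-strict
    q        <⟨ <-·1 q ⟩
    c        ≤⟨ c≤b ⟩
    b        ≡⟨ ℚ.*-identityˡ b ⟨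
    1ℚ ℚ.* b ≤⟨ ℚ.*-monoʳ-≤-nonNeg b {{ℚ.nonNegative 0≤b}} (ℚ.≤-trans 1≤c c≤b) ⟩
    b ℚ.* b  ∎
    where
    open ℚ.≤-Reasoning
    M = suc ℤ.∣ ℚ.↥ q ∣
    b = suc (M ℕ.* suc n) · mesh n
    c = M · 1ℚ
    0≤b : 0ℚ ℚ.≤ b
    0≤b = ·-nonNeg (suc (M ℕ.* suc n)) (ℚ.<⇒≤ (mesh-pos n))
    1≤c : 1ℚ ℚ.≤ c
    1≤c = ℚ.+-mono-≤ (ℚ.≤-refl {1ℚ}) (·-nonNeg ℤ.∣ ℚ.↥ q ∣ (ℚ.<⇒≤ (ℚ.positive⁻¹ 1ℚ)))
    c≡ : c ≡ (M ℕ.* suc n) · mesh n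
    c≡ = trans (cong (M ·_) (sym (suc·mesh n))) (×-assocˡ (mesh n) M (suc n))
    c≤b : c ℚ.≤ b
    c≤b = subst (ℚ._≤ b) (trans (ℚ.+-identityˡ _) (sym c≡))
      (ℚ.+-monoˡ-≤ ((M ℕ.* suc n) · mesh n) (ℚ.<⇒≤ (mesh-pos n)))

  search-nonNeg : ∀ q {δ} k → 0ℚ ℚ.≤ δ → 0ℚ ℚ.≤ search q δ k
  search-nonNeg q zero 0≤δ = ℚ.≤-refl
  search-nonNeg q {δ} (suc k) 0≤δ with (suc k · δ) ℚ.* (suc k · δ) ℚ.≤? q
  ... | yes _ = ·-nonNeg (suc k) 0≤δ
  ... | no  _ = search-nonNeg q k 0≤δ

  search-lower : ∀ q δ k → 0ℚ ℚ.≤ q → search q δ k ℚ.* search q δ k ℚ.≤ q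
  search-lower q δ zero 0≤q = 0≤q
  search-lower q δ (suc k) 0≤q with (suc k · δ) ℚ.* (suc k · δ) ℚ.≤? q
  ... | yes h = h
  ... | no  _ = search-lower q δ k 0≤q

  search-upper : ∀ q δ k → q ℚ.< (suc k · δ) ℚ.* (suc k · δ) →
    q ℚ.< (search q δ k ℚ.+ δ) ℚ.* (search q δ k ℚ.+ δ)
  search-upper q δ zero    h = subst (λ t → q ℚ.< t ℚ.* t) (ℚ.+-comm δ 0ℚ) h
  search-upper q δ (suc k) h with (suc k · δ) ℚ.* (suc k · δ) ℚ.≤? q
  ... | yes _ = subst (λ t → q ℚ.< t ℚ.* t) (ℚ.+-comm δ (suc k · δ)) h
  ... | no ¬p = search-upper q δ k (ℚ.≰⇒> ¬p)

approxSqrt-nonNeg : ∀ q n → 0ℚ ℚ.≤ approxSqrt q n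
approxSqrt-nonNeg q n = search-nonNeg q (suc ℤ.∣ ℚ.↥ q ∣ ℕ.* suc n) (ℚ.<⇒≤ (mesh-pos n))

approxSqrt-lower : ∀ q n → 0ℚ ℚ.≤ q → approxSqrt q n ℚ.* approxSqrt q n ℚ.≤ q
approxSqrt-lower q n = search-lower q (mesh n) (suc ℤ.∣ ℚ.↥ q ∣ ℕ.* suc n)

approxSqrt-upper : ∀ q n →
  q ℚ.< (approxSqrt q n ℚ.+ mesh n) ℚ.* (approxSqrt q n ℚ.+ mesh n)
approxSqrt-upper q n = search-upper q (mesh n) (suc ℤ.∣ ℚ.↥ q ∣ ℕ.* suc n) (range q n)

mesh-small : ∀ ε → 0ℚ ℚ.< ε → ∃[ N ] ∀ n → N ℕ.≤ n → mesh n ℚ.≤ ε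
mesh-small (mkℚ (+ suc p) r _) _ = r , λ n r≤n → *≤* (ℤ.+≤+ (begin
  1 ℕ.* suc r      ≡⟨ ℕ.*-identityˡ (suc r) ⟩
  suc r            ≤⟨ ℕ.s≤s r≤n ⟩
  suc n            ≤⟨ ℕ.m≤n*m (suc n) (suc p) ⟩
  suc p ℕ.* suc n  ∎))
  where open ℕ.≤-Reasoning
mesh-small (mkℚ (+ zero) r c)   h = contradiction h λ { (*<* (ℤ.+<+ ())) }
mesh-small (mkℚ -[1+ _ ] _ _)   h = contradiction h λ { (*<* ()) }

private
  ⊔0-nonNeg : ∀ p → 0ℚ ℚ.≤ p ℚ.⊔ 0ℚ
  ⊔0-nonNeg p = ℚ.p≤q⊔p p 0ℚ

  -- √p - √q < 2δ as soon as p - q < δ², up to the accuracy of the search.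
  close : ∀ {p q s t δ μ} → 0ℚ ℚ.< δ → 0ℚ ℚ.≤ t → 0ℚ ℚ.≤ μ → μ ℚ.≤ δ →
    s ℚ.* s ℚ.≤ p → q ℚ.< (t ℚ.+ μ) ℚ.* (t ℚ.+ μ) → p ℚ.- q ℚ.< δ ℚ.* δ →
    s ℚ.- t ℚ.< δ ℚ.+ δ
  close {p} {q} {s} {t} {δ} {μ} 0<δ 0≤t 0≤μ μ≤δ s²≤p q<t² p-q<δ² =
    ℚ.≰⇒> λ 2δ≤s-t → ℚ.<-irrefl refl (begin-strict
      p                                             ≡⟨ solve 2 (λ p q → p := q :+ (p :- q)) refl p q ⟩
      q ℚ.+ (p ℚ.- q)                               <⟨ ℚ.+-mono-< q<t² p-q<δ² ⟩
      (t ℚ.+ μ) ℚ.* (t ℚ.+ μ) ℚ.+ δ ℚ.* δ           ≤⟨ ℚ.+-monoˡ-≤ (δ ℚ.* δ)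
                                                       (sq (ℚ.+-mono-≤ 0≤t 0≤μ) (ℚ.+-monoʳ-≤ t μ≤δ)) ⟩
      x                                             ≡⟨ ℚ.+-identityʳ x ⟨
      x ℚ.+ 0ℚ                                      ≤⟨ ℚ.+-monoʳ-≤ x 0≤y ⟩
      x ℚ.+ y                                       ≡⟨ solve 2 (λ t δ →
        ((t :+ δ) :* (t :+ δ) :+ δ :* δ) :+ ((t :* δ :+ t :* δ) :+ (δ :* δ :+ δ :* δ))
          := (t :+ (δ :+ δ)) :* (t :+ (δ :+ δ))) refl t δ ⟩
      (t ℚ.+ (δ ℚ.+ δ)) ℚ.* (t ℚ.+ (δ ℚ.+ δ))       ≤⟨ sq 0≤t+2δ (begin
        t ℚ.+ (δ ℚ.+ δ)  ≤⟨ ℚ.+-monoʳ-≤ t 2δ≤s-t ⟩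
        t ℚ.+ (s ℚ.- t)  ≡⟨ solve 2 (λ s t → t :+ (s :- t) := s) refl s t ⟩
        s ∎) ⟩
      s ℚ.* s                                       ≤⟨ s²≤p ⟩
      p                                             ∎)
    where
    open ℚ.≤-Reasoning
    0≤δ = ℚ.<⇒≤ 0<δ
    sq : ∀ {a b} → 0ℚ ℚ.≤ a → a ℚ.≤ b → a ℚ.* a ℚ.≤ b ℚ.* b
    sq 0≤a a≤b = *-mono-≤ 0≤a (ℚ.≤-trans 0≤a a≤b) a≤b a≤b
    x = (t ℚ.+ δ) ℚ.* (t ℚ.+ δ) ℚ.+ δ ℚ.* δ
    y = (t ℚ.* δ ℚ.+ t ℚ.* δ) ℚ.+ (δ ℚ.* δ ℚ.+ δ ℚ.* δ)
    0≤* : ∀ {a b} → 0ℚ ℚ.≤ a → 0ℚ ℚ.≤ b → 0ℚ ℚ.≤ a ℚ.* b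
    0≤* 0≤a 0≤b = *-mono-≤ ℚ.≤-refl 0≤b 0≤a 0≤b
    0≤y : 0ℚ ℚ.≤ y
    0≤y = ℚ.+-mono-≤ (ℚ.+-mono-≤ (0≤* 0≤t 0≤δ) (0≤* 0≤t 0≤δ))
                     (ℚ.+-mono-≤ (0≤* 0≤δ 0≤δ) (0≤* 0≤δ 0≤δ))
    0≤t+2δ : 0ℚ ℚ.≤ t ℚ.+ (δ ℚ.+ δ)
    0≤t+2δ = ℚ.+-mono-≤ 0≤t (ℚ.+-mono-≤ 0≤δ 0≤δ)

  p≤∣p∣ : ∀ p → p ℚ.≤ ℚ.∣ p ∣
  p≤∣p∣ p with ℚ.≤-total 0ℚ p
  ... | inj₁ 0≤p = ℚ.≤-reflexive (sym (ℚ.0≤p⇒∣p∣≡p 0≤p))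
  ... | inj₂ p≤0 = ℚ.≤-trans p≤0 (ℚ.0≤∣p∣ p)

  ⊔0-diff : ∀ p q {η} → 0ℚ ℚ.< η → p ℚ.- q ℚ.< η → (p ℚ.⊔ 0ℚ) ℚ.- (q ℚ.⊔ 0ℚ) ℚ.< η
  ⊔0-diff p q {η} 0<η p-q<η with ℚ.⊔-sel p 0ℚ
  ... | inj₁ ≡p rewrite ≡p = ℚ.≤-<-trans
    (ℚ.+-monoʳ-≤ p (ℚ.neg-antimono-≤ (ℚ.p≤p⊔q q 0ℚ))) p-q<η
  ... | inj₂ ≡0 rewrite ≡0 = ℚ.≤-<-trans
    (ℚ.+-monoʳ-≤ 0ℚ (ℚ.neg-antimono-≤ (⊔0-nonNeg q))) 0<η

  ∣-∣-< : ∀ {p ε} → p ℚ.< ε → ℚ.- p ℚ.< ε → ℚ.∣ p ∣ ℚ.< ε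
  ∣-∣-< {p} {ε} p<ε -p<ε with ℚ.∣p∣≡p∨∣p∣≡-p p
  ... | inj₁ eq = subst (ℚ._< ε) (sym eq) p<ε
  ... | inj₂ eq = subst (ℚ._< ε) (sym eq) -p<ε

  sqrtSeq : (ℕ → ℚ) → ℕ → ℚ
  sqrtSeq a n = approxSqrt (a n ℚ.⊔ 0ℚ) n

  sqrt-cauchy : ∀ {a} → Cauchy a → Cauchy (sqrtSeq a)
  sqrt-cauchy {a} ca ε 0<ε
    with *-pos 0<ε (ℚ.positive⁻¹ ½)
  ... | 0<δ with ca (δ ℚ.* δ) (*-pos 0<δ 0<δ) | mesh-small δ 0<δ
    where δ = ε ℚ.* ½
  ... | N , p | M , small = N ℕ.⊔ M , λ m n N≤m N≤n →
    ∣-∣-< (half m n N≤m N≤n)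
      (subst (ℚ._< ε)
        (solve 2 (λ u v → v :- u := :- (u :- v)) refl (sqrtSeq a m) (sqrtSeq a n))
        (half n m N≤n N≤m))
    where
    half : ∀ m n → N ℕ.⊔ M ℕ.≤ m → N ℕ.⊔ M ℕ.≤ n → sqrtSeq a m ℚ.- sqrtSeq a n ℚ.< ε
    half m n N≤m N≤n = subst (sqrtSeq a m ℚ.- sqrtSeq a n ℚ.<_) (halves ε)
      (close {p = a m ℚ.⊔ 0ℚ} {q = a n ℚ.⊔ 0ℚ} {s = sqrtSeq a m} {t = sqrtSeq a n}
        0<δ (approxSqrt-nonNeg (a n ℚ.⊔ 0ℚ) n) (ℚ.<⇒≤ (mesh-pos n))
        (small n (ℕ.m⊔n≤o⇒n≤o N M N≤n))
        (approxSqrt-lower (a m ℚ.⊔ 0ℚ) m (⊔0-nonNeg (a m)))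
        (approxSqrt-upper (a n ℚ.⊔ 0ℚ) n)
        (⊔0-diff (a m) (a n) (*-pos 0<δ 0<δ) (ℚ.≤-<-trans (p≤∣p∣ (a m ℚ.- a n))
          (p m n (ℕ.m⊔n≤o⇒m≤o N M N≤m) (ℕ.m⊔n≤o⇒m≤o N M N≤n)))))

-- √ a is the square root of max (a , 0).
√ : ℝ → ℝ
√ a = mkℝ (sqrtSeq (seq a)) (sqrt-cauchy {seq a} (cauchy a))

record ℂ : Set where
  constructor _+i_
  field
    re im : ℝ

open ℂ public

infix  4 _≈ᶜ_
infix  5 _+i_
infixl 6 _+ᶜ_ _-ᶜ_
infixl 7 _*ᶜ_
infixr 8 _^ᶜ_

_≈ᶜ_ : ℂ → ℂ → Set
z ≈ᶜ w = re z ≈ re w × im z ≈ im w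

fromℝ : ℝ → ℂ
fromℝ a = a +i fromℚ 0ℚ

ratᶜ : ℚ → ℂ
ratᶜ q = fromℝ (fromℚ q)

_+ᶜ_ _-ᶜ_ _*ᶜ_ : ℂ → ℂ → ℂ
(a +i b) +ᶜ (c +i d) = (a + c) +i (b + d)
(a +i b) -ᶜ (c +i d) = (a - c) +i (b - d)
(a +i b) *ᶜ (c +i d) = (a * c - b * d) +i (a * d + b * c)

_^ᶜ_ : ℂ → ℕ → ℂ
z ^ᶜ zero  = ratᶜ 1ℚ
z ^ᶜ suc n = z *ᶜ z ^ᶜ n

∣_∣ : ℂ → ℝ
∣ z ∣ = √ (re z * re z + im z * im z)

partialSum : (ℕ → ℂ) → ℕ → ℂ
partialSum a zero    = a 0
partialSum a (suc n) = partialSum a n +ᶜ a (suc n)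

HasSum : (ℕ → ℂ) → ℂ → Set
HasSum a s = ∀ ε → 0ℚ ℚ.< ε →
  ∃[ N ] ∀ n → N ℕ.≤ n → ∣ partialSum a n -ᶜ s ∣ < fromℚ ε

PowerSeries : (ℕ → ℚ) → ℂ → ℂ → Set
PowerSeries c z s = HasSum (λ n → ratᶜ (c n) *ᶜ z ^ᶜ n) s

-- w = eᶻ.  A relation, since no limit operator is introduced; a sum, when it
-- exists, is unique up to ≈ᶜ.
IsExp : ℂ → ℂ → Set
IsExp z w = PowerSeries 1/_! z w

-- a = ln 2, the real solution of eᵃ = 2.
IsLn2 : ℝ → Set
IsLn2 a = IsExp (fromℝ a) (ratᶜ (fromℕ 2))

-- w is the principal square root of z: the root whose argument lies in
-- (-π/2, π/2], or 0.
IsPrincipalSqrt : ℂ → ℂ → Set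
IsPrincipalSqrt z w = w *ᶜ w ≈ᶜ z ×
  (fromℚ 0ℚ < re w ⊎ (re w ≈ fromℚ 0ℚ × fromℚ 0ℚ ≤ im w))

{-# OPTIONS --safe #-}

-- Let √(1 - 2hy) = Σ σₖ yᵏ, that is (k + 1) σₖ₊₁ = h (2k - 1) σₖ.  For any u without
-- constant term, B = Σ σₖ uᵏ solves (1 - 2hu) B′ = -h u′ B, and uniqueness for
-- (1 - 2hu) y′ = -2h u′ y gives B² = 1 - 2hu.  With u = eˣ - 1, taking h = ½ shows
-- e(x) = e^(x/2) √(2 - eˣ), hence e² = 2eˣ - e²ˣ, and taking h = -1 shows
-- d(x) = -√(2e⁻ˣ - 1), hence d′ e = 1.  Up to sign, the determinants of the Hessenberg
-- Toeplitz matrices of a series are the coefficients of its reciprocal.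
--
-- For the convergence put g = 1 - e.  Then 2g = g² + (eˣ - 1)², so g has non-negative
-- coefficients, and g(R) ≤ ρ whenever e^R - 1 ≤ ρ < 1.  On |x| < R the series of e
-- therefore converges absolutely, squares to eˣ (2 - eˣ), and has real part at least
-- 1 - ρ > 0, which selects the principal root.

module Submission where

import Algebra.Properties.CommutativeSemiring.Exp
import Algebra.Properties.Semiring.Exp
import Algebra.Solver.Ring
import Defs
import Relation.Binary.Reasoning.Setoid
import Data.Nat.Base as ℕ
import Data.Nat.Properties as ℕ
import Data.Rational.Base as ℚ
import Data.Rational.Properties as ℚ
import Data.Rational.Unnormalised.Base as ℚᵘ
import Data.Rational.Unnormalised.Properties as ℚᵘ
import Data.Integer.Properties as ℤ

-- The algebraic half works with single coefficients: Σ σₖ uᵏ is not a polynomial in `u`, so its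
-- differential equation is read off, one coefficient at a time, from polynomial truncations.
--
-- The analytic half is shaped by the encoding of the reals as Cauchy sequences of rationals with
-- termwise operations. At a fixed stage m, everything is evaluated at one Gaussian rational xₘ, the
-- m-th approximation of x, so every estimate is an inequality between rationals. The sums eˣ and w
-- have to be constructed; they are diagonals, the n-th partial sum at xₙ, and uniformity in the
-- stage makes them converge.
--
-- The number ln 2 is known only as a real whose exponential series sums to 2. A rational L that
-- eventually lies below it inherits Σ Lᵏ/k! ≤ 2 for all partial sums, because all terms are
-- non-negative. Convexity then gives e^R - 1 ≤ R/L for R < L, which is where a bound ρ strictly
-- below 1 comes from.

module Prelude where

  open import Defs public
    hiding (_+_; _*_; _-_; -_; _<_; _≤_; _≈_; ∣_∣)
  open import Data.Nat.Base as ℕ public using (ℕ; zero; suc; _∸_; _!)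
  open import Data.Rational.Base as ℚ public
    using (ℚ; 0ℚ; 1ℚ; ½; -½; _+_; _*_; _-_; -_; _≤_; _<_; ∣_∣)
  open import Data.Product.Base public using (_×_; _,_; proj₁; proj₂; ∃-syntax)
  open import Data.Rational.Solver public using (module +-*-Solver)
  open import Relation.Binary.PropositionalEquality public

-- Finite sums of rationals.

module FiniteSums where

  open Prelude
  open import Function.Base using (_∘_)
  open +-*-Solver using (solve; _:=_; _:+_)

  Σ-cong : ∀ n {f g : ℕ → ℚ} → (∀ k → k ℕ.≤ n → f k ≡ g k) → Σ≤ n f ≡ Σ≤ n g
  Σ-cong zero    f≗g = f≗g 0 ℕ.z≤n
  Σ-cong (suc n) f≗g =
    cong₂ _+_ (Σ-cong n λ k k≤n → f≗g k (ℕ.m≤n⇒m≤1+n k≤n)) (f≗g (suc n) ℕ.≤-refl)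

  Σ-zero : ∀ n {f : ℕ → ℚ} → (∀ k → k ℕ.≤ n → f k ≡ 0ℚ) → Σ≤ n f ≡ 0ℚ
  Σ-zero zero    f≗0 = f≗0 0 ℕ.z≤n
  Σ-zero (suc n) f≗0 =
    cong₂ _+_ (Σ-zero n λ k k≤n → f≗0 k (ℕ.m≤n⇒m≤1+n k≤n)) (f≗0 (suc n) ℕ.≤-refl)

  Σ-+ : ∀ n f g → Σ≤ n (λ k → f k + g k) ≡ Σ≤ n f + Σ≤ n g
  Σ-+ zero    f g = refl
  Σ-+ (suc n) f g = trans (cong (_+ (f (suc n) + g (suc n))) (Σ-+ n f g))
    (solve 4 (λ a b c d → (a :+ b) :+ (c :+ d) := (a :+ c) :+ (b :+ d)) refl
      (Σ≤ n f) (Σ≤ n g) (f (suc n)) (g (suc n)))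

  Σ-*ˡ : ∀ n c f → Σ≤ n (λ k → c * f k) ≡ c * Σ≤ n f
  Σ-*ˡ zero    c f = refl
  Σ-*ˡ (suc n) c f = trans (cong (_+ c * f (suc n)) (Σ-*ˡ n c f))
    (sym (ℚ.*-distribˡ-+ c (Σ≤ n f) (f (suc n))))

  Σ-*ʳ : ∀ n c f → Σ≤ n (λ k → f k * c) ≡ Σ≤ n f * c
  Σ-*ʳ zero    c f = refl
  Σ-*ʳ (suc n) c f = trans (cong (_+ f (suc n) * c) (Σ-*ʳ n c f))
    (sym (ℚ.*-distribʳ-+ c (Σ≤ n f) (f (suc n))))

  Σ-neg : ∀ n f → Σ≤ n (λ k → - f k) ≡ - Σ≤ n f
  Σ-neg zero    f = refl
  Σ-neg (suc n) f = trans (cong (_- f (suc n)) (Σ-neg n f))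
    (sym (ℚ.neg-distrib-+ (Σ≤ n f) (f (suc n))))

  Σ-first : ∀ n f → Σ≤ (suc n) f ≡ f 0 + Σ≤ n (f ∘ suc)
  Σ-first zero    f = refl
  Σ-first (suc n) f = trans (cong (_+ f (suc (suc n))) (Σ-first n f))
    (ℚ.+-assoc (f 0) (Σ≤ n (f ∘ suc)) (f (suc (suc n))))

  Σ-reverse : ∀ n f → Σ≤ n f ≡ Σ≤ n (λ k → f (n ∸ k))
  Σ-reverse zero    f = refl
  Σ-reverse (suc n) f = begin
    Σ≤ n f + f (suc n)                     ≡⟨ cong (_+ f (suc n)) (Σ-reverse n f) ⟩
    Σ≤ n (λ k → f (n ∸ k)) + f (suc n)     ≡⟨ ℚ.+-comm _ (f (suc n)) ⟩
    f (suc n) + Σ≤ n (λ k → f (n ∸ k))     ≡⟨ Σ-first n (λ k → f (suc n ∸ k)) ⟨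
    Σ≤ (suc n) (λ k → f (suc n ∸ k))       ∎
    where open ≡-Reasoning

  Σ-mono : ∀ n {f g : ℕ → ℚ} → (∀ k → k ℕ.≤ n → f k ≤ g k) → Σ≤ n f ≤ Σ≤ n g
  Σ-mono zero    f≤g = f≤g 0 ℕ.z≤n
  Σ-mono (suc n) f≤g =
    ℚ.+-mono-≤ (Σ-mono n λ k k≤n → f≤g k (ℕ.m≤n⇒m≤1+n k≤n)) (f≤g (suc n) ℕ.≤-refl)

  Σ-nonNeg : ∀ n {f : ℕ → ℚ} → (∀ k → k ℕ.≤ n → 0ℚ ≤ f k) → 0ℚ ≤ Σ≤ n f
  Σ-nonNeg n {f} 0≤f = subst (_≤ Σ≤ n f) (Σ-zero n λ _ _ → refl) (Σ-mono n 0≤f)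

  Σ-∣∣ : ∀ n f → ∣ Σ≤ n f ∣ ≤ Σ≤ n (λ k → ∣ f k ∣)
  Σ-∣∣ zero    f = ℚ.≤-refl
  Σ-∣∣ (suc n) f = ℚ.≤-trans (ℚ.∣p+q∣≤∣p∣+∣q∣ (Σ≤ n f) (f (suc n)))
    (ℚ.+-monoˡ-≤ ∣ f (suc n) ∣ (Σ-∣∣ n f))

  Σ-monoˡ : ∀ {m n} (f : ℕ → ℚ) → (∀ k → 0ℚ ≤ f k) → m ℕ.≤ n → Σ≤ m f ≤ Σ≤ n f
  Σ-monoˡ f 0≤f m≤n = go (ℕ.≤⇒≤′ m≤n)
    where
    go : ∀ {m n} → m ℕ.≤′ n → Σ≤ m f ≤ Σ≤ n f
    go ℕ.≤′-refl           = ℚ.≤-refl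
    go {n = suc n} (ℕ.≤′-step m≤n) = ℚ.≤-trans (go m≤n)
      (subst (_≤ Σ≤ (suc n) f) (ℚ.+-identityʳ (Σ≤ n f)) (ℚ.+-monoʳ-≤ (Σ≤ n f) (0≤f (suc n))))

  Σ-truncate : ∀ {m n} (f : ℕ → ℚ) → m ℕ.≤ n → (∀ k → m ℕ.< k → f k ≡ 0ℚ) → Σ≤ n f ≡ Σ≤ m f
  Σ-truncate {m} f m≤n f≡0 = go (ℕ.≤⇒≤′ m≤n)
    where
    go : ∀ {n} → m ℕ.≤′ n → Σ≤ n f ≡ Σ≤ m f
    go ℕ.≤′-refl                   = refl
    go {suc n} (ℕ.≤′-step m≤n) = trans
      (cong₂ _+_ (go m≤n) (f≡0 (suc n) (ℕ.s≤s (ℕ.≤′⇒≤ m≤n)))) (ℚ.+-identityʳ (Σ≤ m f))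

-- Factorials, double factorials and signs as rationals.

module RationalConstants where

  open Prelude
  open import Data.Integer.Base as ℤ using (ℤ; +_)
  open import Data.Nat.Coprimality using (1-coprimeTo) renaming (sym to coprime-sym)
  open import Data.Nat.Combinatorics using (_C_; nCk≡n!/k![n-k]!; [n∸k]!k!∣n!)
  open import Data.Nat.Divisibility using (_∣_)
  open import Data.Nat.DivMod using (m/n*n≡m)
  open import Data.Nat.Solver using () renaming (module +-*-Solver to ℕ-Solver)
  open ℕ-Solver using () renaming (solve to ℕ-solve; _:=_ to _:=ℕ_; _:*_ to _:*ℕ_)
  open import Data.Rational.Base as ℚ using (mkℚ; _/_)
  open +-*-Solver using (solve; _:=_; _:*_; :-_)

  fromℤ : ℤ → ℚ
  fromℤ i = i / 1

  private
    -- The gcd normalisation inside `_/_` is stuck on a variable numerator; in constructor form the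
    -- rational `_+_` and `_*_` compute.
    fromℤ≡mkℚ : ∀ i → fromℤ i ≡ mkℚ i 0 (coprime-sym (1-coprimeTo ℤ.∣ i ∣))
    fromℤ≡mkℚ i = ℚ.↥p/↧p≡p (mkℚ i 0 (coprime-sym (1-coprimeTo ℤ.∣ i ∣)))

  fromℤ-+ : ∀ i j → fromℤ (i ℤ.+ j) ≡ fromℤ i + fromℤ j
  fromℤ-+ i j = sym (trans (cong₂ _+_ (fromℤ≡mkℚ i) (fromℤ≡mkℚ j))
    (cong fromℤ (cong₂ ℤ._+_ (ℤ.*-identityʳ i) (ℤ.*-identityʳ j))))

  fromℤ-* : ∀ i j → fromℤ (i ℤ.* j) ≡ fromℤ i * fromℤ j
  fromℤ-* i j = sym (cong₂ _*_ (fromℤ≡mkℚ i) (fromℤ≡mkℚ j))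

  fromℕ-+ : ∀ m n → fromℕ (m ℕ.+ n) ≡ fromℕ m + fromℕ n
  fromℕ-+ m n = fromℤ-+ (+ m) (+ n)

  fromℕ-* : ∀ m n → fromℕ (m ℕ.* n) ≡ fromℕ m * fromℕ n
  fromℕ-* m n = trans (cong fromℤ (ℤ.pos-* m n)) (fromℤ-* (+ m) (+ n))

  fromℕ-suc : ∀ n → fromℕ (suc n) ≡ 1ℚ + fromℕ n
  fromℕ-suc = fromℕ-+ 1

  -- The passage through unnormalised rationals avoids the gcd: there the identity is a
  -- cross-multiplication of integers.
  fromℕ-1/ℕ : ∀ n .{{_ : ℕ.NonZero n}} → fromℕ n * 1/ℕ n ≡ 1ℚ
  fromℕ-1/ℕ (suc n) = ℚ.toℚᵘ-injective (ℚᵘ.≃-trans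
    (ℚ.toℚᵘ-homo-* (fromℕ (suc n)) (1/ℕ (suc n)))
    (ℚᵘ.≃-trans
      (ℚᵘ.*-cong (ℚ.toℚᵘ-fromℚᵘ (ℚᵘ.mkℚᵘ (+ suc n) 0)) (ℚ.toℚᵘ-fromℚᵘ (ℚᵘ.mkℚᵘ (+ 1) n)))
      (ℚᵘ.*≡* (trans (ℤ.*-identityʳ _) (trans (ℤ.*-comm (+ suc n) (+ 1))
        (cong (λ k → + 1 ℤ.* + k) (sym (ℕ.*-identityˡ (suc n)))))))))

  fromℕ-cancelˡ : ∀ n .{{_ : ℕ.NonZero n}} {p q} → fromℕ n * p ≡ fromℕ n * q → p ≡ q
  fromℕ-cancelˡ n {p} {q} eq = trans (unscale p) (trans (cong (1/ℕ n *_) eq) (sym (unscale q)))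
    where
    unscale : ∀ p → p ≡ 1/ℕ n * (fromℕ n * p)
    unscale p = sym (trans (solve 3 (λ a b p → a :* (b :* p) := (b :* a) :* p) refl (1/ℕ n) (fromℕ n) p)
      (trans (cong (_* p) (fromℕ-1/ℕ n)) (ℚ.*-identityˡ p)))

  fromℕ-1/! : ∀ n → fromℕ (n !) * 1/ n ! ≡ 1ℚ
  fromℕ-1/! n = fromℕ-1/ℕ (n !) {{n ℕ.!≢0}}

  suc-1/! : ∀ n → fromℕ (suc n) * 1/ suc n ! ≡ 1/ n !
  suc-1/! n = fromℕ-cancelˡ (n !) {{n ℕ.!≢0}} (begin
    fromℕ (n !) * (fromℕ (suc n) * 1/ suc n !)
      ≡⟨ solve 3 (λ a b c → a :* (b :* c) := (b :* a) :* c) refl (fromℕ (n !)) (fromℕ (suc n)) (1/ suc n !) ⟩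
    fromℕ (suc n) * fromℕ (n !) * 1/ suc n !   ≡⟨ cong (_* 1/ suc n !) (fromℕ-* (suc n) (n !)) ⟨
    fromℕ (suc n !) * 1/ suc n !               ≡⟨ fromℕ-1/! (suc n) ⟩
    1ℚ                                         ≡⟨ fromℕ-1/! n ⟨
    fromℕ (n !) * 1/ n !                       ∎)
    where open ≡-Reasoning

  -1^-suc : ∀ n → -1^ suc n ≡ - (-1^ n)
  -1^-suc n = trans (fromℤ-* ℤ.-1ℤ (ℤ.-1ℤ ℤ.^ n))
    (trans (sym (ℚ.neg-distribˡ-* 1ℚ (-1^ n))) (cong -_ (ℚ.*-identityˡ (-1^ n))))

  -1^-+ : ∀ m n → -1^ (m ℕ.+ n) ≡ (-1^ m) * (-1^ n)
  -1^-+ m n = trans (cong fromℤ (ℤ.^-distribˡ-+-* ℤ.-1ℤ m n)) (fromℤ-* (ℤ.-1ℤ ℤ.^ m) (ℤ.-1ℤ ℤ.^ n))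

  -1^-square : ∀ n → (-1^ n) * (-1^ n) ≡ 1ℚ
  -1^-square zero    = refl
  -1^-square (suc n) = trans (cong₂ _*_ (-1^-suc n) (-1^-suc n))
    (trans (solve 1 (λ s → :- s :* :- s := s :* s) refl (-1^ n)) (-1^-square n))

  1/ℕ-* : ∀ m n .{{_ : ℕ.NonZero m}} .{{_ : ℕ.NonZero n}} .{{_ : ℕ.NonZero (m ℕ.* n)}} →
          1/ℕ (m ℕ.* n) ≡ 1/ℕ m * 1/ℕ n
  1/ℕ-* m n = fromℕ-cancelˡ (m ℕ.* n) (begin
    fromℕ (m ℕ.* n) * 1/ℕ (m ℕ.* n)            ≡⟨ fromℕ-1/ℕ (m ℕ.* n) ⟩
    1ℚ * 1ℚ                                    ≡⟨ cong₂ _*_ (fromℕ-1/ℕ m) (fromℕ-1/ℕ n) ⟨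
    (fromℕ m * 1/ℕ m) * (fromℕ n * 1/ℕ n)      ≡⟨ solve 4 (λ a b c d → (a :* b) :* (c :* d) := (a :* c) :* (b :* d)) refl
                                                    (fromℕ m) (1/ℕ m) (fromℕ n) (1/ℕ n) ⟩
    (fromℕ m * fromℕ n) * (1/ℕ m * 1/ℕ n)      ≡⟨ cong (_* (1/ℕ m * 1/ℕ n)) (fromℕ-* m n) ⟨
    fromℕ (m ℕ.* n) * (1/ℕ m * 1/ℕ n)          ∎)
    where open ≡-Reasoning

  1/2^-suc : ∀ n → 1/2^ suc n ≡ ½ * 1/2^ n
  1/2^-suc n = 1/ℕ-* 2 (2 ℕ.^ n) {{_}} {{ℕ.m^n≢0 2 n}} {{ℕ.m^n≢0 2 (suc n)}}

  1/evenDF-split : ∀ n → 1/evenDF n ≡ 1/2^ n * 1/ n !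
  1/evenDF-split n = 1/ℕ-* (2 ℕ.^ n) (n !) {{ℕ.m^n≢0 2 n}} {{n ℕ.!≢0}}
    {{ℕ.m*n≢0 (2 ℕ.^ n) (n !) {{ℕ.m^n≢0 2 n}} {{n ℕ.!≢0}}}}

  fromℕ-evenDF : ∀ n → fromℕ (evenDF n) * 1/evenDF n ≡ 1ℚ
  fromℕ-evenDF n = fromℕ-1/ℕ (evenDF n) {{ℕ.m*n≢0 (2 ℕ.^ n) (n !) {{ℕ.m^n≢0 2 n}} {{n ℕ.!≢0}}}}

  nCk-factorials : ∀ {n k} → k ℕ.≤ n → (n C k) ℕ.* (k ! ℕ.* (n ∸ k) !) ≡ n !
  nCk-factorials {n} {k} k≤n = trans (cong (ℕ._* (k ! ℕ.* (n ∸ k) !)) (nCk≡n!/k![n-k]! k≤n))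
    (m/n*n≡m {{k ℕ.!* (n ∸ k) !≢0}} (subst (_∣ n !) (ℕ.*-comm ((n ∸ k) !) (k !)) ([n∸k]!k!∣n! k≤n)))

  evenDF-binomial : ∀ {n k} → k ℕ.≤ n → evenDF n ≡ (n C k) ℕ.* 2 ℕ.^ k ℕ.* k ! ℕ.* evenDF (n ∸ k)
  evenDF-binomial {n} {k} k≤n = begin
    2 ℕ.^ n ℕ.* n !
      ≡⟨ cong₂ ℕ._*_ (trans (cong (2 ℕ.^_) (sym (ℕ.m+[n∸m]≡n k≤n))) (ℕ.^-distribˡ-+-* 2 k (n ∸ k)))
           (sym (nCk-factorials k≤n)) ⟩
    2 ℕ.^ k ℕ.* 2 ℕ.^ (n ∸ k) ℕ.* ((n C k) ℕ.* (k ! ℕ.* (n ∸ k) !))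
      ≡⟨ ℕ-solve 5 (λ a b c x y → (a :*ℕ b) :*ℕ (c :*ℕ (x :*ℕ y)) :=ℕ ((c :*ℕ a) :*ℕ x) :*ℕ (b :*ℕ y)) refl
           (2 ℕ.^ k) (2 ℕ.^ (n ∸ k)) (n C k) (k !) ((n ∸ k) !) ⟩
    (n C k) ℕ.* 2 ℕ.^ k ℕ.* k ! ℕ.* (2 ℕ.^ (n ∸ k) ℕ.* (n ∸ k) !) ∎
    where open ≡-Reasoning

  -- This makes the binomial sum in `e` a Cauchy product: the k! supplied by the Stirling numbers
  -- completes the weight C(n,k) 2ᵏ to the quotient (2n)!! / (2(n - k))!!.
  1/evenDF-binomial : ∀ {n k} → k ℕ.≤ n →
    1/evenDF n * (fromℕ (n C k) * fromℕ (2 ℕ.^ k) * fromℕ (k !)) ≡ 1/evenDF (n ∸ k)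
  1/evenDF-binomial {n} {k} k≤n = begin
    1/evenDF n * c                                              ≡⟨ ℚ.*-identityʳ _ ⟨
    1/evenDF n * c * 1ℚ                                         ≡⟨ cong (1/evenDF n * c *_) (fromℕ-evenDF (n ∸ k)) ⟨
    1/evenDF n * c * (fromℕ (evenDF (n ∸ k)) * 1/evenDF (n ∸ k)) ≡⟨ solve 4 (λ a b x y → a :* b :* (x :* y) := (b :* x :* a) :* y)
                                                                     refl (1/evenDF n) c (fromℕ (evenDF (n ∸ k))) (1/evenDF (n ∸ k)) ⟩
    c * fromℕ (evenDF (n ∸ k)) * 1/evenDF n * 1/evenDF (n ∸ k)   ≡⟨ cong (λ t → t * 1/evenDF n * 1/evenDF (n ∸ k)) homo ⟨
    fromℕ (evenDF n) * 1/evenDF n * 1/evenDF (n ∸ k)            ≡⟨ cong (_* 1/evenDF (n ∸ k)) (fromℕ-evenDF n) ⟩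
    1ℚ * 1/evenDF (n ∸ k)                                       ≡⟨ ℚ.*-identityˡ (1/evenDF (n ∸ k)) ⟩
    1/evenDF (n ∸ k)                                            ∎
    where
    open ≡-Reasoning
    c : ℚ
    c = fromℕ (n C k) * fromℕ (2 ℕ.^ k) * fromℕ (k !)
    homo : fromℕ (evenDF n) ≡ c * fromℕ (evenDF (n ∸ k))
    homo = trans (cong fromℕ (evenDF-binomial k≤n))
      (trans (fromℕ-* ((n C k) ℕ.* 2 ℕ.^ k ℕ.* k !) (evenDF (n ∸ k))) (cong (_* fromℕ (evenDF (n ∸ k)))
        (trans (fromℕ-* ((n C k) ℕ.* 2 ℕ.^ k) (k !)) (cong (_* fromℕ (k !)) (fromℕ-* (n C k) (2 ℕ.^ k))))))

-- The commutative ring of formal power series over the rationals.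

module FormalPowerSeries where

  open Prelude
  open FiniteSums
  open import Algebra.Bundles using (CommutativeRing)
  open import Algebra.Solver.Ring.AlmostCommutativeRing using (fromCommutativeRing; _-Raw-AlmostCommutative⟶_)
  open import Data.Maybe.Base using (Maybe; just; nothing)
  open import Level using (0ℓ)
  open import Function.Base using (_∘_)
  open import Relation.Nullary using (yes; no)
  open +-*-Solver using (solve; _:=_; _:+_; _:*_)

  infixl 6 _+ˢ_
  infix  8 -ˢ_
  infixl 7 _⊛_

  _+ˢ_ : FPS → FPS → FPS
  (f +ˢ g) n = f n + g n

  -ˢ_ : FPS → FPS
  (-ˢ f) n = - f n

  constˢ : ℚ → FPS
  constˢ c zero    = c
  constˢ c (suc _) = 0ℚ

  tail : FPS → FPS
  tail f = f ∘ suc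

  *ˢ-suc : ∀ f g n → (f *ˢ g) (suc n) ≡ f 0 * g (suc n) + (tail f *ˢ g) n
  *ˢ-suc f g n = Σ-first n (λ k → f k * g (suc n ∸ k))

  *ˢ-cong : ∀ {f f′ g g′} → f ≗ f′ → g ≗ g′ → (f *ˢ g) ≗ (f′ *ˢ g′)
  *ˢ-cong p q n = Σ-cong n λ k _ → cong₂ _*_ (p k) (q (n ∸ k))

  *ˢ-comm : ∀ f g → (f *ˢ g) ≗ (g *ˢ f)
  *ˢ-comm f g n = trans (Σ-reverse n (λ k → f k * g (n ∸ k)))
    (Σ-cong n λ k k≤n → trans (cong (λ j → f (n ∸ k) * g j) (ℕ.m∸[m∸n]≡n k≤n))
      (ℚ.*-comm (f (n ∸ k)) (g k)))

  *ˢ-distribʳ : ∀ h f g → ((f +ˢ g) *ˢ h) ≗ ((f *ˢ h) +ˢ (g *ˢ h))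
  *ˢ-distribʳ h f g n = trans
    (Σ-cong n λ k _ → ℚ.*-distribʳ-+ (h (n ∸ k)) (f k) (g k))
    (Σ-+ n (λ k → f k * h (n ∸ k)) (λ k → g k * h (n ∸ k)))

  *ˢ-distribˡ : ∀ h f g → (h *ˢ (f +ˢ g)) ≗ ((h *ˢ f) +ˢ (h *ˢ g))
  *ˢ-distribˡ h f g n = trans (*ˢ-comm h (f +ˢ g) n)
    (trans (*ˢ-distribʳ h f g n) (cong₂ _+_ (*ˢ-comm f h n) (*ˢ-comm g h n)))

  *ˢ-scalar : ∀ c f g → ((λ n → c * f n) *ˢ g) ≗ (λ n → c * (f *ˢ g) n)
  *ˢ-scalar c f g n = trans (Σ-cong n λ k _ → ℚ.*-assoc c (f k) (g (n ∸ k)))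
    (Σ-*ˡ n c (λ k → f k * g (n ∸ k)))

  -- Splitting off the constant term of `f` reduces the claim in degree n + 1 to the one in degree n
  -- for `tail f`, so no double sum has to be rearranged.
  *ˢ-assoc : ∀ f g h → ((f *ˢ g) *ˢ h) ≗ (f *ˢ (g *ˢ h))
  *ˢ-assoc f g h zero    = ℚ.*-assoc (f 0) (g 0) (h 0)
  *ˢ-assoc f g h (suc n) = begin
    ((f *ˢ g) *ˢ h) (suc n)
      ≡⟨ *ˢ-suc (f *ˢ g) h n ⟩
    f 0 * g 0 * h (suc n) + (tail (f *ˢ g) *ˢ h) n
      ≡⟨ cong (f 0 * g 0 * h (suc n) +_) (begin
        (tail (f *ˢ g) *ˢ h) n
          ≡⟨ *ˢ-cong {g = h} (*ˢ-suc f g) (λ _ → refl) n ⟩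
        (((λ k → f 0 * tail g k) +ˢ (tail f *ˢ g)) *ˢ h) n
          ≡⟨ *ˢ-distribʳ h (λ k → f 0 * tail g k) (tail f *ˢ g) n ⟩
        ((λ k → f 0 * tail g k) *ˢ h) n + ((tail f *ˢ g) *ˢ h) n
          ≡⟨ cong₂ _+_ (*ˢ-scalar (f 0) (tail g) h n) (*ˢ-assoc (tail f) g h n) ⟩
        f 0 * (tail g *ˢ h) n + (tail f *ˢ (g *ˢ h)) n ∎) ⟩
    f 0 * g 0 * h (suc n) + (f 0 * (tail g *ˢ h) n + (tail f *ˢ (g *ˢ h)) n)
      ≡⟨ solve 5 (λ a b c s t → a :* b :* c :+ (a :* s :+ t) := a :* (b :* c :+ s) :+ t) refl
           (f 0) (g 0) (h (suc n)) ((tail g *ˢ h) n) ((tail f *ˢ (g *ˢ h)) n) ⟩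
    f 0 * (g 0 * h (suc n) + (tail g *ˢ h) n) + (tail f *ˢ (g *ˢ h)) n
      ≡⟨ cong (λ t → f 0 * t + (tail f *ˢ (g *ˢ h)) n) (*ˢ-suc g h n) ⟨
    f 0 * (g *ˢ h) (suc n) + (tail f *ˢ (g *ˢ h)) n
      ≡⟨ *ˢ-suc f (g *ˢ h) n ⟨
    (f *ˢ (g *ˢ h)) (suc n) ∎
    where open ≡-Reasoning

  constˢ-*ˢ : ∀ c f → (constˢ c *ˢ f) ≗ (λ n → c * f n)
  constˢ-*ˢ c f zero    = refl
  constˢ-*ˢ c f (suc n) = trans (*ˢ-suc (constˢ c) f n)
    (trans (cong (c * f (suc n) +_) (Σ-zero n λ k _ → ℚ.*-zeroˡ (f (n ∸ k))))
      (ℚ.+-identityʳ (c * f (suc n))))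

  constˢ-1 : constˢ 1ℚ ≗ oneˢ
  constˢ-1 zero    = refl
  constˢ-1 (suc _) = refl

  *ˢ-identityˡ : ∀ f → (oneˢ *ˢ f) ≗ f
  *ˢ-identityˡ f n = trans (*ˢ-cong {g = f} (λ k → sym (constˢ-1 k)) (λ _ → refl) n)
    (trans (constˢ-*ˢ 1ℚ f n) (ℚ.*-identityˡ (f n)))

  -- Opaque, since the factors of _*ˢ_ cannot be inferred from the coefficients of a product.
  opaque
    _⊛_ : FPS → FPS → FPS
    _⊛_ = _*ˢ_

    ⊛≗*ˢ : ∀ f g → (f ⊛ g) ≗ (f *ˢ g)
    ⊛≗*ˢ f g n = refl

    ⊛-cong : ∀ {f f′ g g′} → f ≗ f′ → g ≗ g′ → (f ⊛ g) ≗ (f′ ⊛ g′)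
    ⊛-cong = *ˢ-cong

    ⊛-assoc : ∀ f g h → ((f ⊛ g) ⊛ h) ≗ (f ⊛ (g ⊛ h))
    ⊛-assoc = *ˢ-assoc

    ⊛-comm : ∀ f g → (f ⊛ g) ≗ (g ⊛ f)
    ⊛-comm = *ˢ-comm

    ⊛-identityˡ : ∀ f → (oneˢ ⊛ f) ≗ f
    ⊛-identityˡ = *ˢ-identityˡ

    ⊛-distribˡ : ∀ h f g → (h ⊛ (f +ˢ g)) ≗ ((h ⊛ f) +ˢ (h ⊛ g))
    ⊛-distribˡ = *ˢ-distribˡ

    ⊛-distribʳ : ∀ h f g → ((f +ˢ g) ⊛ h) ≗ ((f ⊛ h) +ˢ (g ⊛ h))
    ⊛-distribʳ = *ˢ-distribʳ

    constˢ-⊛ : ∀ c f → (constˢ c ⊛ f) ≗ (λ n → c * f n)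
    constˢ-⊛ = constˢ-*ˢ

  -- Allows a composition to be replaced by a polynomial in `u` inside a product when a single
  -- coefficient is read off.
  ⊛-local : ∀ f {g g′} n → (∀ k → k ℕ.≤ n → g k ≡ g′ k) → (f ⊛ g) n ≡ (f ⊛ g′) n
  ⊛-local f {g} {g′} n g≡g′ = trans (⊛≗*ˢ f g n) (trans
    (Σ-cong n λ k _ → cong (f k *_) (g≡g′ (n ∸ k) (ℕ.m∸n≤m n k))) (sym (⊛≗*ˢ f g′ n)))

  ⊛-congˡ : ∀ {f g g′} → g ≗ g′ → (f ⊛ g) ≗ (f ⊛ g′)
  ⊛-congˡ = ⊛-cong (λ _ → refl)

  ⊛-congʳ : ∀ {f f′ g} → f ≗ f′ → (f ⊛ g) ≗ (f′ ⊛ g)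
  ⊛-congʳ p = ⊛-cong p (λ _ → refl)

  +ˢ-cong : ∀ {f f′ g g′} → f ≗ f′ → g ≗ g′ → (f +ˢ g) ≗ (f′ +ˢ g′)
  +ˢ-cong p q n = cong₂ _+_ (p n) (q n)

  +ˢ-congˡ : ∀ f {g g′} → g ≗ g′ → (f +ˢ g) ≗ (f +ˢ g′)
  +ˢ-congˡ f p n = cong (f n +_) (p n)

  +ˢ-congʳ : ∀ g {f f′} → f ≗ f′ → (f +ˢ g) ≗ (f′ +ˢ g)
  +ˢ-congʳ g p n = cong (_+ g n) (p n)

  -ˢ-cong : ∀ {f f′} → f ≗ f′ → (-ˢ f) ≗ (-ˢ f′)
  -ˢ-cong p n = cong -_ (p n)

  constˢ-cong : ∀ {a b} → a ≡ b → constˢ a ≗ constˢ b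
  constˢ-cong a≡b n = cong (λ c → constˢ c n) a≡b

  constˢ-+ : ∀ a b → constˢ (a + b) ≗ (constˢ a +ˢ constˢ b)
  constˢ-+ a b zero    = refl
  constˢ-+ a b (suc n) = refl

  constˢ-* : ∀ a b → constˢ (a * b) ≗ (constˢ a ⊛ constˢ b)
  constˢ-* a b n = trans (scale n) (sym (constˢ-⊛ a (constˢ b) n))
    where
    scale : ∀ n → constˢ (a * b) n ≡ a * constˢ b n
    scale zero    = refl
    scale (suc _) = sym (ℚ.*-zeroʳ a)

  commutativeRing : CommutativeRing 0ℓ 0ℓ
  commutativeRing = record
    { Carrier = FPS ; _≈_ = _≗_ ; _+_ = _+ˢ_ ; _*_ = _⊛_ ; -_ = -ˢ_ ; 0# = λ _ → 0ℚ ; 1# = oneˢ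
    ; isCommutativeRing = record
      { isRing = record
        { +-isAbelianGroup = record
          { isGroup = record
            { isMonoid = record
              { isSemigroup = record
                { isMagma = record
                  { isEquivalence = record
                    { refl  = λ _ → refl
                    ; sym   = λ p n → sym (p n)
                    ; trans = λ p q n → trans (p n) (q n) }
                  ; ∙-cong = +ˢ-cong }
                ; assoc = λ f g h n → ℚ.+-assoc (f n) (g n) (h n) }
              ; identity = (λ f n → ℚ.+-identityˡ (f n)) , (λ f n → ℚ.+-identityʳ (f n)) }
            ; inverse = (λ f n → ℚ.+-inverseˡ (f n)) , (λ f n → ℚ.+-inverseʳ (f n))
            ; ⁻¹-cong = -ˢ-cong }
          ; comm = λ f g n → ℚ.+-comm (f n) (g n) }
        ; *-cong     = ⊛-cong
        ; *-assoc    = ⊛-assoc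
        ; *-identity = ⊛-identityˡ , (λ f n → trans (⊛-comm f oneˢ n) (⊛-identityˡ f n))
        ; distrib    = ⊛-distribˡ , ⊛-distribʳ }
      ; *-comm = ⊛-comm } }

  constˢ-homomorphism : CommutativeRing.rawRing ℚ.+-*-commutativeRing
    -Raw-AlmostCommutative⟶ fromCommutativeRing commutativeRing
  constˢ-homomorphism = record
    { ⟦_⟧    = constˢ
    ; +-homo = constˢ-+
    ; *-homo = constˢ-*
    ; -‿homo = λ { a zero → refl ; a (suc _) → refl }
    ; 0-homo = λ { zero → refl ; (suc _) → refl }
    ; 1-homo = constˢ-1 }

  constˢ-≟ : ∀ a b → Maybe (constˢ a ≗ constˢ b)
  constˢ-≟ a b with a ℚ.≟ b
  ... | yes a≡b = just (constˢ-cong a≡b)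
  ... | no  _   = nothing

  module ≗-Reasoning = Relation.Binary.Reasoning.Setoid (CommutativeRing.setoid commutativeRing)

  -- Equality of series cannot be decided, so the solver takes its coefficients from the rationals,
  -- embedded by `constˢ`.
  module FPS-Solver = Algebra.Solver.Ring
    (CommutativeRing.rawRing ℚ.+-*-commutativeRing) (fromCommutativeRing commutativeRing)
    constˢ-homomorphism constˢ-≟

-- Formal derivative, uniqueness for linear differential equations, cancellation.

module Derivation where

  open Prelude
  open FiniteSums
  open FormalPowerSeries
  open RationalConstants
  open import Data.Nat.Induction using (<-rec)
  open import Data.Sum.Base using (inj₁; inj₂)
  open +-*-Solver using (solve; _:=_; _:+_; _:*_)

  D : FPS → FPS
  D f n = fromℕ (suc n) * f (suc n)

  private
    -- The operator x d/dx keeps degrees, so its product rule holds termwise from n = k + (n - k).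
    -- The rule for `D` follows by a shift.
    euler : FPS → FPS
    euler f n = fromℕ n * f n

    euler-* : ∀ f g → euler (f *ˢ g) ≗ ((euler f *ˢ g) +ˢ (f *ˢ euler g))
    euler-* f g n = trans (sym (Σ-*ˡ n (fromℕ n) (λ k → f k * g (n ∸ k))))
      (trans (Σ-cong n term) (Σ-+ n (λ k → euler f k * g (n ∸ k)) (λ k → f k * euler g (n ∸ k))))
      where
      term : ∀ k → k ℕ.≤ n → fromℕ n * (f k * g (n ∸ k)) ≡ euler f k * g (n ∸ k) + f k * euler g (n ∸ k)
      term k k≤n = trans
        (cong (λ c → c * (f k * g (n ∸ k)))
          (trans (cong fromℕ (sym (ℕ.m+[n∸m]≡n k≤n))) (fromℕ-+ k (n ∸ k))))
        (solve 4 (λ i j x y → (i :+ j) :* (x :* y) := i :* x :* y :+ x :* (j :* y)) refl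
          (fromℕ k) (fromℕ (n ∸ k)) (f k) (g (n ∸ k)))

    tail-euler-* : ∀ f g → tail (euler f *ˢ g) ≗ (D f *ˢ g)
    tail-euler-* f g n = trans (*ˢ-suc (euler f) g n)
      (trans (cong (λ t → t * g (suc n) + (D f *ˢ g) n) (ℚ.*-zeroˡ (f 0)))
        (trans (cong (_+ (D f *ˢ g) n) (ℚ.*-zeroˡ (g (suc n)))) (ℚ.+-identityˡ _)))

  D-cong : ∀ {f g} → f ≗ g → D f ≗ D g
  D-cong f≗g n = cong (fromℕ (suc n) *_) (f≗g (suc n))

  D-+ : ∀ f g → D (f +ˢ g) ≗ (D f +ˢ D g)
  D-+ f g n = ℚ.*-distribˡ-+ (fromℕ (suc n)) (f (suc n)) (g (suc n))

  D-neg : ∀ f → D (-ˢ f) ≗ -ˢ (D f)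
  D-neg f n = sym (ℚ.neg-distribʳ-* (fromℕ (suc n)) (f (suc n)))

  D-const : ∀ c → D (constˢ c) ≗ constˢ 0ℚ
  D-const c zero    = refl
  D-const c (suc n) = ℚ.*-zeroʳ (fromℕ (suc (suc n)))

  D-one : D oneˢ ≗ constˢ 0ℚ
  D-one n = trans (D-cong (λ k → sym (constˢ-1 k)) n) (D-const 1ℚ n)

  private
    D-*ˢ : ∀ f g → D (f *ˢ g) ≗ ((D f *ˢ g) +ˢ (f *ˢ D g))
    D-*ˢ f g n = trans (euler-* f g (suc n)) (cong₂ _+_ (tail-euler-* f g n)
      (trans (*ˢ-comm f (euler g) (suc n)) (trans (tail-euler-* g f n) (*ˢ-comm (D g) f n))))

  D-⊛ : ∀ f g → D (f ⊛ g) ≗ ((D f ⊛ g) +ˢ (f ⊛ D g))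
  D-⊛ f g n = trans (D-cong (⊛≗*ˢ f g) n)
    (trans (D-*ˢ f g n) (sym (cong₂ _+_ (⊛≗*ˢ (D f) g n) (⊛≗*ˢ f (D g) n))))

  *ˢ-vanish : ∀ f {g} n → (∀ k → k ℕ.≤ n → g k ≡ 0ℚ) → (f *ˢ g) n ≡ 0ℚ
  *ˢ-vanish f n g≡0 = Σ-zero n λ k _ →
    trans (cong (f k *_) (g≡0 (n ∸ k) (ℕ.m∸n≤m n k))) (ℚ.*-zeroʳ (f k))

  *ˢ-leading : ∀ f {g} n → (∀ k → k ℕ.< n → g k ≡ 0ℚ) → (f *ˢ g) n ≡ f 0 * g n
  *ˢ-leading f     zero    g≡0 = refl
  *ˢ-leading f {g} (suc n) g≡0 = trans (*ˢ-suc f g n)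
    (trans (cong (f 0 * g (suc n) +_) (*ˢ-vanish (tail f) n λ k k≤n → g≡0 k (ℕ.s≤s k≤n)))
      (ℚ.+-identityʳ _))

  -- If y vanishes up to degree n, then coefficient n of w y is 0 and that of v y′ is v₀ (n + 1)
  -- yₙ₊₁, so yₙ₊₁ = 0.
  ode-unique : ∀ {v w y} → v 0 ≡ 1ℚ → (v ⊛ D y) ≗ (w ⊛ y) → y 0 ≡ 0ℚ → ∀ n → y n ≡ 0ℚ
  ode-unique {v} {w} {y} v₀ eq y₀ n = vanish n n ℕ.≤-refl
    where
    vanish : ∀ n k → k ℕ.≤ n → y k ≡ 0ℚ
    step : ∀ n → y (suc n) ≡ 0ℚ
    vanish zero    zero ℕ.z≤n = y₀
    vanish (suc n) k k≤1+n with ℕ.m≤n⇒m<n∨m≡n k≤1+n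
    ... | inj₁ k<1+n = vanish n k (ℕ.s≤s⁻¹ k<1+n)
    ... | inj₂ refl  = step n
    step n = fromℕ-cancelˡ (suc n) (begin
      D y n         ≡⟨ ℚ.*-identityˡ (D y n) ⟨
      1ℚ * D y n    ≡⟨ cong (_* D y n) v₀ ⟨
      v 0 * D y n   ≡⟨ *ˢ-leading v n (λ k k<n → trans (cong (fromℕ (suc k) *_) (vanish n (suc k) k<n))
                         (ℚ.*-zeroʳ (fromℕ (suc k)))) ⟨
      (v *ˢ D y) n  ≡⟨ ⊛≗*ˢ v (D y) n ⟨
      (v ⊛ D y) n   ≡⟨ eq n ⟩
      (w ⊛ y) n     ≡⟨ ⊛≗*ˢ w y n ⟩
      (w *ˢ y) n    ≡⟨ *ˢ-vanish w n (vanish n) ⟩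
      0ℚ            ≡⟨ ℚ.*-zeroʳ (fromℕ (suc n)) ⟨
      fromℕ (suc n) * 0ℚ ∎)
      where open ≡-Reasoning

  -- By strong induction: if g vanishes below degree n, coefficient n of f g is f₀ gₙ. The constant
  -- term is given as a natural number so that `fromℕ-cancelˡ` divides by it.
  ⊛-cancel : ∀ f {g} m .{{_ : ℕ.NonZero m}} → f 0 ≡ fromℕ m →
              (∀ n → (f ⊛ g) n ≡ 0ℚ) → ∀ n → g n ≡ 0ℚ
  ⊛-cancel f {g} m f₀ fg≡0 = <-rec _ λ n rec → fromℕ-cancelˡ m (begin
    fromℕ m * g n  ≡⟨ cong (_* g n) f₀ ⟨
    f 0 * g n      ≡⟨ *ˢ-leading f n (λ k k<n → rec k<n) ⟨
    (f *ˢ g) n     ≡⟨ ⊛≗*ˢ f g n ⟨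
    (f ⊛ g) n      ≡⟨ fg≡0 n ⟩
    0ℚ             ≡⟨ ℚ.*-zeroʳ (fromℕ m) ⟨
    fromℕ m * 0ℚ   ∎)
    where open ≡-Reasoning

-- Substitution into the binomial series of the square root.

module SquareRootSeries where

  open Prelude
  open FiniteSums
  open FormalPowerSeries
  open RationalConstants
  open Derivation
  open FPS-Solver using (solve; _:=_; _:+_; _:*_; _:-_; :-_; con)

  ^ˢ-vanish : ∀ u → u 0 ≡ 0ℚ → ∀ k n → n ℕ.< k → (u ^ˢ k) n ≡ 0ℚ
  ^ˢ-vanish u u₀ (suc k) zero    n<k = trans (cong (_* (u ^ˢ k) 0) u₀) (ℚ.*-zeroˡ ((u ^ˢ k) 0))
  ^ˢ-vanish u u₀ (suc k) (suc n) n<k = trans (*ˢ-suc u (u ^ˢ k) n) (cong₂ _+_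
    (trans (cong (_* (u ^ˢ k) (suc n)) u₀) (ℚ.*-zeroˡ ((u ^ˢ k) (suc n))))
    (*ˢ-vanish (tail u) n λ j j≤n → ^ˢ-vanish u u₀ k j (ℕ.<-≤-trans (ℕ.s≤s j≤n) (ℕ.s≤s⁻¹ n<k))))

  D-^ˢ : ∀ u k → D (u ^ˢ suc k) ≗ (constˢ (fromℕ (suc k)) ⊛ ((u ^ˢ k) ⊛ D u))
  D-^ˢ u zero = begin
    D (u *ˢ oneˢ)                     ≈⟨ D-cong (λ n → ⊛≗*ˢ u oneˢ n) ⟨
    D (u ⊛ oneˢ)                      ≈⟨ D-⊛ u oneˢ ⟩
    (D u ⊛ oneˢ) +ˢ (u ⊛ D oneˢ)      ≈⟨ +ˢ-congˡ (D u ⊛ oneˢ) (⊛-congˡ D-one) ⟩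
    (D u ⊛ oneˢ) +ˢ (u ⊛ constˢ 0ℚ)   ≈⟨ solve 3 (λ p u o → p :* o :+ u :* con 0ℚ := con 1ℚ :* (o :* p))
                                           (λ _ → refl) (D u) u oneˢ ⟩
    constˢ 1ℚ ⊛ (oneˢ ⊛ D u)          ∎
    where
    open ≗-Reasoning
  D-^ˢ u (suc k) = begin
    D (u *ˢ (u ^ˢ suc k))                            ≈⟨ D-cong (λ n → ⊛≗*ˢ u (u ^ˢ suc k) n) ⟨
    D (u ⊛ (u ^ˢ suc k))                             ≈⟨ D-⊛ u (u ^ˢ suc k) ⟩
    (D u ⊛ (u ^ˢ suc k)) +ˢ (u ⊛ D (u ^ˢ suc k))     ≈⟨ +ˢ-cong (⊛-congˡ (λ n → sym (⊛≗*ˢ u (u ^ˢ k) n))) (⊛-congˡ (D-^ˢ u k)) ⟩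
    (D u ⊛ (u ⊛ (u ^ˢ k))) +ˢ (u ⊛ (constˢ (fromℕ (suc k)) ⊛ ((u ^ˢ k) ⊛ D u)))
      ≈⟨ solve 4 (λ p u w c → p :* (u :* w) :+ u :* (c :* (w :* p)) := (con 1ℚ :+ c) :* ((u :* w) :* p))
           (λ _ → refl) (D u) u (u ^ˢ k) (constˢ (fromℕ (suc k))) ⟩
    (constˢ 1ℚ +ˢ constˢ (fromℕ (suc k))) ⊛ ((u ⊛ (u ^ˢ k)) ⊛ D u)
      ≈⟨ ⊛-cong (λ n → trans (sym (constˢ-+ 1ℚ (fromℕ (suc k)) n)) (constˢ-cong (sym (fromℕ-suc (suc k))) n))
           (⊛-congʳ (λ n → ⊛≗*ˢ u (u ^ˢ k) n)) ⟩
    constˢ (fromℕ (suc (suc k))) ⊛ ((u ^ˢ suc k) ⊛ D u) ∎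
    where
    open ≗-Reasoning

  -- For `u` without constant term, uᵏ starts in degree k, so cutting the sum at k = n loses
  -- nothing.
  compose : (ℕ → ℚ) → FPS → FPS
  compose σ u n = Σ≤ n (λ k → σ k * (u ^ˢ k) n)

  -- A genuine polynomial in `u`, to which sum and product rules apply; in `compose` the cut-off
  -- moves with the coefficient.
  composeUpTo : ℕ → (ℕ → ℚ) → FPS → FPS
  composeUpTo zero    σ u = constˢ (σ 0)
  composeUpTo (suc K) σ u = composeUpTo K σ u +ˢ constˢ (σ (suc K)) ⊛ (u ^ˢ suc K)

  compose-truncate : ∀ σ u → u 0 ≡ 0ℚ → ∀ {n K} → n ℕ.≤ K → composeUpTo K σ u n ≡ compose σ u n
  compose-truncate σ u u₀ {n} {K} n≤K = trans (expand K)
    (Σ-truncate (λ k → σ k * (u ^ˢ k) n) n≤K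
      λ k n<k → trans (cong (σ k *_) (^ˢ-vanish u u₀ k n n<k)) (ℚ.*-zeroʳ (σ k)))
    where
    expand : ∀ K → composeUpTo K σ u n ≡ Σ≤ K (λ k → σ k * (u ^ˢ k) n)
    expand zero    = constant n
      where
      constant : ∀ n → constˢ (σ 0) n ≡ σ 0 * oneˢ n
      constant zero    = sym (ℚ.*-identityʳ (σ 0))
      constant (suc n) = sym (ℚ.*-zeroʳ (σ 0))
    expand (suc K) = cong₂ _+_ (expand K) (constˢ-⊛ (σ (suc K)) (u ^ˢ suc K) n)

  -- The coefficients of √(1 - 2hy).
  record SqrtCoefficients (h : ℚ) (σ : ℕ → ℚ) : Set where
    field
      σ-zero : σ 0 ≡ 1ℚ
      σ-suc  : ∀ k → fromℕ (suc k) * σ (suc k) ≡ h * ((fromℕ k + fromℕ k - 1ℚ) * σ k)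

  module _ {h σ} (sqrt : SqrtCoefficients h σ) (u : FPS) (u₀ : u 0 ≡ 0ℚ) where
    open SqrtCoefficients sqrt

    radicand : FPS
    radicand = constˢ 1ℚ +ˢ -ˢ (constˢ (h + h) ⊛ u)

    private
      B p H : FPS
      B = compose σ u
      p = D u
      H = constˢ h

      -- By the recurrence this is (K + 1) σₖ₊₁ at k = K, the contribution to uᴷ u′ that is missing
      -- when the series is cut at degree K.
      cross : ℕ → ℚ
      cross K = h * ((fromℕ K + fromℕ K - 1ℚ) * σ K)

      radicand-split : radicand ≗ (constˢ 1ℚ +ˢ -ˢ ((H +ˢ H) ⊛ u))
      radicand-split = +ˢ-congˡ (constˢ 1ℚ) (-ˢ-cong (⊛-congʳ (constˢ-+ h h)))

      cross-suc : ∀ K → constˢ (cross (suc K)) ≗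
        (H ⊛ ((constˢ (fromℕ (suc K)) +ˢ constˢ (fromℕ (suc K)) +ˢ -ˢ (constˢ 1ℚ)) ⊛ constˢ (σ (suc K))))
      cross-suc K = λ n → trans (constˢ-* h _ n) (⊛-congˡ (λ n → trans (constˢ-* _ (σ (suc K)) n)
        (⊛-congʳ split n)) n)
        where
        split : constˢ (fromℕ (suc K) + fromℕ (suc K) - 1ℚ) ≗
                (constˢ (fromℕ (suc K)) +ˢ constˢ (fromℕ (suc K)) +ˢ -ˢ (constˢ 1ℚ))
        split zero    = refl
        split (suc n) = refl

      -- The remainder in uᴷ does not affect the coefficients of degree below K.
      truncated : ∀ K → (radicand ⊛ D (composeUpTo K σ u)) ≗
        (-ˢ (H ⊛ (p ⊛ composeUpTo K σ u)) +ˢ -ˢ (constˢ (cross K) ⊛ (p ⊛ (u ^ˢ K))))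
      truncated zero = begin
        radicand ⊛ D (constˢ (σ 0))   ≈⟨ ⊛-congˡ (D-const (σ 0)) ⟩
        radicand ⊛ constˢ 0ℚ
          ≈⟨ solve 3 (λ v H p → v :* con 0ℚ := :- (H :* (p :* con 1ℚ)) :- ((:- H) :* (p :* con 1ℚ)))
               (λ _ → refl) radicand H p ⟩
        -ˢ (H ⊛ (p ⊛ constˢ 1ℚ)) +ˢ -ˢ ((-ˢ H) ⊛ (p ⊛ constˢ 1ℚ))
          ≈⟨ +ˢ-cong (-ˢ-cong (⊛-congˡ (⊛-congˡ (constˢ-cong (sym σ-zero)))))
               (-ˢ-cong (⊛-cong cross₀ (⊛-congˡ constˢ-1))) ⟩
        -ˢ (H ⊛ (p ⊛ constˢ (σ 0))) +ˢ -ˢ (constˢ (cross 0) ⊛ (p ⊛ oneˢ)) ∎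
        where
        open ≗-Reasoning
        cross₀ : (-ˢ H) ≗ constˢ (cross 0)
        cross₀ zero    = trans (sym (ℚ.*-identityʳ (- h)))
          (trans (sym (ℚ.neg-distribˡ-* h 1ℚ)) (trans (ℚ.neg-distribʳ-* h 1ℚ) (cong (λ s → h * (- 1ℚ * s)) (sym σ-zero))))
        cross₀ (suc n) = refl
      truncated (suc K) = begin
        radicand ⊛ D (P +ˢ C ⊛ (u ^ˢ suc K))
          ≈⟨ ⊛-congˡ (λ n → trans (D-+ P (C ⊛ (u ^ˢ suc K)) n) (+ˢ-congˡ (D P) monomial n)) ⟩
        radicand ⊛ (D P +ˢ C ⊛ (N ⊛ (w ⊛ p)))
          ≈⟨ ⊛-distribˡ radicand (D P) (C ⊛ (N ⊛ (w ⊛ p))) ⟩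
        (radicand ⊛ D P) +ˢ (radicand ⊛ (C ⊛ (N ⊛ (w ⊛ p))))
          ≈⟨ +ˢ-cong (truncated K) (⊛-congʳ radicand-split) ⟩
        (-ˢ (H ⊛ (p ⊛ P)) +ˢ -ˢ (constˢ (cross K) ⊛ (p ⊛ w))) +ˢ
          ((constˢ 1ℚ +ˢ -ˢ ((H +ˢ H) ⊛ u)) ⊛ (C ⊛ (N ⊛ (w ⊛ p))))
          -- Rewriting the old remainder by the recurrence makes it cancel against the part of the
          -- new monomial's derivative that is multiplied by the 1 of the radicand.
          ≈⟨ +ˢ-congʳ _ (+ˢ-congˡ (-ˢ (H ⊛ (p ⊛ P))) (-ˢ-cong (⊛-congʳ λ n →
               trans (constˢ-cong (sym (σ-suc K)) n) (constˢ-* (fromℕ (suc K)) (σ (suc K)) n)))) ⟩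
        (-ˢ (H ⊛ (p ⊛ P)) +ˢ -ˢ ((N ⊛ C) ⊛ (p ⊛ w))) +ˢ
          ((constˢ 1ℚ +ˢ -ˢ ((H +ˢ H) ⊛ u)) ⊛ (C ⊛ (N ⊛ (w ⊛ p))))
          ≈⟨ solve 7 (λ H p P N C w u →
               (:- (H :* (p :* P)) :- ((N :* C) :* (p :* w))) :+
                 ((con 1ℚ :- (H :+ H) :* u) :* (C :* (N :* (w :* p)))) :=
               :- (H :* (p :* (P :+ C :* (u :* w)))) :-
                 (H :* ((N :+ N :- con 1ℚ) :* C)) :* (p :* (u :* w)))
               (λ _ → refl) H p P N C w u ⟩
        -ˢ (H ⊛ (p ⊛ (P +ˢ C ⊛ (u ⊛ w)))) +ˢ
          -ˢ ((H ⊛ ((N +ˢ N +ˢ -ˢ (constˢ 1ℚ)) ⊛ C)) ⊛ (p ⊛ (u ⊛ w)))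
          ≈⟨ +ˢ-cong (-ˢ-cong (⊛-congˡ (⊛-congˡ (+ˢ-congˡ P (⊛-congˡ power)))))
               (-ˢ-cong (⊛-cong (λ n → sym (cross-suc K n)) (⊛-congˡ power))) ⟩
        -ˢ (H ⊛ (p ⊛ (P +ˢ C ⊛ (u ^ˢ suc K)))) +ˢ -ˢ (constˢ (cross (suc K)) ⊛ (p ⊛ (u ^ˢ suc K))) ∎
        where
        open ≗-Reasoning
        P C N w : FPS
        P = composeUpTo K σ u
        C = constˢ (σ (suc K))
        N = constˢ (fromℕ (suc K))
        w = u ^ˢ K
        power : (u ⊛ w) ≗ (u ^ˢ suc K)
        power = ⊛≗*ˢ u w
        monomial : D (C ⊛ (u ^ˢ suc K)) ≗ (C ⊛ (N ⊛ (w ⊛ p)))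
        monomial = begin
          D (C ⊛ (u ^ˢ suc K))                              ≈⟨ D-⊛ C (u ^ˢ suc K) ⟩
          (D C ⊛ (u ^ˢ suc K)) +ˢ (C ⊛ D (u ^ˢ suc K))      ≈⟨ +ˢ-cong (⊛-congʳ (D-const (σ (suc K)))) (⊛-congˡ (D-^ˢ u K)) ⟩
          (constˢ 0ℚ ⊛ (u ^ˢ suc K)) +ˢ (C ⊛ (N ⊛ (w ⊛ p)))
            ≈⟨ solve 2 (λ x y → con 0ℚ :* x :+ y := y) (λ _ → refl) (u ^ˢ suc K) (C ⊛ (N ⊛ (w ⊛ p))) ⟩
          C ⊛ (N ⊛ (w ⊛ p)) ∎

      sqrt-ode : (radicand ⊛ D B) ≗ (-ˢ (H ⊛ (p ⊛ B)))
      sqrt-ode n = begin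
        (radicand ⊛ D B) n       ≡⟨ ⊛-local radicand n (λ k k≤n → cong (fromℕ (suc k) *_) (sym (agree (ℕ.s≤s k≤n)))) ⟩
        (radicand ⊛ D P) n       ≡⟨ truncated (suc n) n ⟩
        - (H ⊛ (p ⊛ P)) n - (constˢ (cross (suc n)) ⊛ (p ⊛ (u ^ˢ suc n))) n
                                 ≡⟨ cong₂ (λ a b → - a - b) (⊛-local H n λ k k≤n → ⊛-local p k λ j j≤k →
                                      agree (ℕ.m≤n⇒m≤1+n (ℕ.≤-trans j≤k k≤n))) remainder ⟩
        - (H ⊛ (p ⊛ B)) n - 0ℚ   ≡⟨ ℚ.+-identityʳ (- (H ⊛ (p ⊛ B)) n) ⟩
        - (H ⊛ (p ⊛ B)) n        ∎
        where
        open ≡-Reasoning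
        P : FPS
        -- Degree n + 1, since `D` shifts by one; the remainder then carries u to the power n + 1
        -- and has no coefficient in degree n.
        P = composeUpTo (suc n) σ u
        agree : ∀ {k} → k ℕ.≤ suc n → P k ≡ B k
        agree = compose-truncate σ u u₀
        remainder : (constˢ (cross (suc n)) ⊛ (p ⊛ (u ^ˢ suc n))) n ≡ 0ℚ
        remainder = trans (constˢ-⊛ (cross (suc n)) (p ⊛ (u ^ˢ suc n)) n) (trans
          (cong (cross (suc n) *_) (trans (⊛≗*ˢ p (u ^ˢ suc n) n)
            (*ˢ-vanish p n λ k k≤n → ^ˢ-vanish u u₀ (suc n) k (ℕ.s≤s k≤n))))
          (ℚ.*-zeroʳ (cross (suc n))))

      D-radicand : D radicand ≗ (-ˢ ((H +ˢ H) ⊛ p))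
      D-radicand = begin
        D radicand
          ≈⟨ (λ n → trans (D-+ (constˢ 1ℚ) (-ˢ (C ⊛ u)) n) (+ˢ-cong (D-const 1ℚ) (D-neg (C ⊛ u)) n)) ⟩
        constˢ 0ℚ +ˢ -ˢ (D (C ⊛ u))
          ≈⟨ +ˢ-congˡ (constˢ 0ℚ) (-ˢ-cong (λ n → trans (D-⊛ C u n) (+ˢ-congʳ (C ⊛ p) (⊛-congʳ (D-const (h + h))) n))) ⟩
        constˢ 0ℚ +ˢ -ˢ ((constˢ 0ℚ ⊛ u) +ˢ (C ⊛ p))
          ≈⟨ solve 3 (λ C u p → con 0ℚ :- (con 0ℚ :* u :+ C :* p) := :- (C :* p)) (λ _ → refl) C u p ⟩
        -ˢ (C ⊛ p)          ≈⟨ -ˢ-cong (⊛-congʳ (constˢ-+ h h)) ⟩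
        -ˢ ((H +ˢ H) ⊛ p)   ∎
        where
        open ≗-Reasoning
        C : FPS
        C = constˢ (h + h)

    compose-zero : compose σ u 0 ≡ 1ℚ
    compose-zero = trans (ℚ.*-identityʳ (σ 0)) σ-zero

    compose-square : (compose σ u ⊛ compose σ u) ≗ radicand
    compose-square n = trans (sym (cancel ((B ⊛ B) n) (radicand n)))
      (trans (cong (_+ radicand n) (ode-unique {v = radicand} {w = W} radicand₀ ode y₀ n)) (ℚ.+-identityˡ (radicand n)))
      where
      cancel : ∀ a b → (a - b) + b ≡ a
      cancel = +-*-Solver.solve 2 (λ a b → (a +-*-Solver.:- b) +-*-Solver.:+ b +-*-Solver.:= a) refl
      y W : FPS
      y = (B ⊛ B) +ˢ -ˢ radicand
      -- `W` is the derivative of `radicand`, so `radicand` solves v y′ = W y trivially; B² solves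
      -- it by `sqrt-ode`.
      W = -ˢ ((H +ˢ H) ⊛ p)
      radicand₀ : radicand 0 ≡ 1ℚ
      radicand₀ = cong (λ t → 1ℚ - t) (trans (constˢ-⊛ (h + h) u 0)
        (trans (cong ((h + h) *_) u₀) (ℚ.*-zeroʳ (h + h))))
      y₀ : y 0 ≡ 0ℚ
      y₀ = cong₂ _-_ (trans (⊛≗*ˢ B B 0) (cong₂ _*_ compose-zero compose-zero)) radicand₀
      ode : (radicand ⊛ D y) ≗ (W ⊛ y)
      ode = begin
        radicand ⊛ D y
          ≈⟨ ⊛-congˡ (λ n → trans (D-+ (B ⊛ B) (-ˢ radicand) n) (+ˢ-cong (D-⊛ B B)
               (λ n → trans (D-neg radicand n) (-ˢ-cong D-radicand n)) n)) ⟩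
        radicand ⊛ (((D B ⊛ B) +ˢ (B ⊛ D B)) +ˢ -ˢ W)
          ≈⟨ solve 4 (λ v B DB W → v :* ((DB :* B :+ B :* DB) :- W) := (con 1ℚ :+ con 1ℚ) :* B :* (v :* DB) :- v :* W)
               (λ _ → refl) radicand B (D B) W ⟩
        ((constˢ 1ℚ +ˢ constˢ 1ℚ) ⊛ B) ⊛ (radicand ⊛ D B) +ˢ -ˢ (radicand ⊛ W)
          ≈⟨ +ˢ-congʳ (-ˢ (radicand ⊛ W)) (⊛-congˡ sqrt-ode) ⟩
        ((constˢ 1ℚ +ˢ constˢ 1ℚ) ⊛ B) ⊛ (-ˢ (H ⊛ (p ⊛ B))) +ˢ -ˢ (radicand ⊛ W)
          ≈⟨ solve 4 (λ v B H p → (con 1ℚ :+ con 1ℚ) :* B :* (:- (H :* (p :* B))) :- v :* (:- ((H :+ H) :* p))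
                         := (:- ((H :+ H) :* p)) :* (B :* B :- v))
               (λ _ → refl) radicand B H p ⟩
        W ⊛ y ∎
        where open ≗-Reasoning

-- Closed forms of the generating functions of e and d, and their relation.

module CoefficientIdentities where

  open Prelude
  open FiniteSums
  open FormalPowerSeries
  open RationalConstants
  open Derivation
  open SquareRootSeries
  open import Data.Nat.Combinatorics using (_C_)
  open FPS-Solver using () renaming
    (solve to solveˢ; _:=_ to _:=ˢ_; _:+_ to _:+ˢ_; _:*_ to _:*ˢ_; _:-_ to _:-ˢ_; :-_ to :-ˢ_; con to conˢ)
  open +-*-Solver using (solve; _:=_; _:+_; _:*_; _:-_; :-_; con)

  -- The series e^(ax), characterised by its differential equation. The product rule adds exponents,
  -- and uniqueness then yields e^(x/2) e^(x/2) = eˣ and e⁻ˣ eˣ = 1 without the binomial theorem.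
  record Exponential (a : ℚ) (f : FPS) : Set where
    field
      at-0       : f 0 ≡ 1ℚ
      derivative : D f ≗ (constˢ a ⊛ f)

  exponential-unique : ∀ {a f g} → Exponential a f → Exponential a g → f ≗ g
  exponential-unique {a} {f} {g} ef eg n = trans (sym (cancel (f n) (g n)))
    (trans (cong (_+ g n) (ode-unique {v = oneˢ} {w = constˢ a} {y = y} refl ode y₀ n)) (ℚ.+-identityˡ (g n)))
    where
    open Exponential
    open ≗-Reasoning
    cancel : ∀ p q → (p - q) + q ≡ p
    cancel = solve 2 (λ p q → (p :- q) :+ q := p) refl
    y : FPS
    y = f +ˢ -ˢ g
    y₀ : y 0 ≡ 0ℚ
    y₀ = cong₂ _-_ (at-0 ef) (at-0 eg)
    ode : (oneˢ ⊛ D y) ≗ (constˢ a ⊛ y)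
    ode = begin
      oneˢ ⊛ D y                              ≈⟨ ⊛-identityˡ (D y) ⟩
      D y                                     ≈⟨ D-+ f (-ˢ g) ⟩
      D f +ˢ D (-ˢ g)                         ≈⟨ +ˢ-cong (derivative ef) (λ n → trans (D-neg g n) (-ˢ-cong (derivative eg) n)) ⟩
      (constˢ a ⊛ f) +ˢ -ˢ (constˢ a ⊛ g)     ≈⟨ solveˢ 3 (λ a f g → a :*ˢ f :-ˢ a :*ˢ g :=ˢ a :*ˢ (f :-ˢ g)) (λ _ → refl) (constˢ a) f g ⟩
      constˢ a ⊛ y                            ∎

  exponential-⊛ : ∀ {a b f g} → Exponential a f → Exponential b g → Exponential (a + b) (f ⊛ g)
  exponential-⊛ {a} {b} {f} {g} ef eg = record
    { at-0       = trans (⊛≗*ˢ f g 0) (cong₂ _*_ (at-0 ef) (at-0 eg))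
    ; derivative = begin
        D (f ⊛ g)                                       ≈⟨ D-⊛ f g ⟩
        (D f ⊛ g) +ˢ (f ⊛ D g)                          ≈⟨ +ˢ-cong (⊛-congʳ (derivative ef)) (⊛-congˡ (derivative eg)) ⟩
        ((constˢ a ⊛ f) ⊛ g) +ˢ (f ⊛ (constˢ b ⊛ g))    ≈⟨ solveˢ 4 (λ a b f g → a :*ˢ f :*ˢ g :+ˢ f :*ˢ (b :*ˢ g) :=ˢ (a :+ˢ b) :*ˢ (f :*ˢ g))
                                                             (λ _ → refl) (constˢ a) (constˢ b) f g ⟩
        (constˢ a +ˢ constˢ b) ⊛ (f ⊛ g)                ≈⟨ ⊛-congʳ (constˢ-+ a b) ⟨
        constˢ (a + b) ⊛ (f ⊛ g)                        ∎ }
    where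
    open Exponential
    open ≗-Reasoning

  exponential-one : Exponential 0ℚ oneˢ
  exponential-one = record
    { at-0       = refl
    ; derivative = λ n → trans (D-one n)
        (solveˢ 1 (λ o → conˢ 0ℚ :=ˢ conˢ 0ℚ :*ˢ o) (λ _ → refl) oneˢ n) }

  -- The substitution x ↦ -x.
  alternate : FPS → FPS
  alternate f n = (-1^ n) * f n

  alternate-⊛ : ∀ f g → alternate (f ⊛ g) ≗ (alternate f ⊛ alternate g)
  alternate-⊛ f g n = begin
    (-1^ n) * (f ⊛ g) n                                       ≡⟨ cong ((-1^ n) *_) (⊛≗*ˢ f g n) ⟩
    (-1^ n) * (f *ˢ g) n                                      ≡⟨ Σ-*ˡ n (-1^ n) (λ k → f k * g (n ∸ k)) ⟨
    Σ≤ n (λ k → (-1^ n) * (f k * g (n ∸ k)))                  ≡⟨ Σ-cong n term ⟩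
    (alternate f *ˢ alternate g) n                            ≡⟨ ⊛≗*ˢ (alternate f) (alternate g) n ⟨
    (alternate f ⊛ alternate g) n                             ∎
    where
    open ≡-Reasoning
    term : ∀ k → k ℕ.≤ n → (-1^ n) * (f k * g (n ∸ k)) ≡ alternate f k * alternate g (n ∸ k)
    term k k≤n = trans
      (cong (_* (f k * g (n ∸ k))) (trans (cong -1^_ (sym (ℕ.m+[n∸m]≡n k≤n))) (-1^-+ k (n ∸ k))))
      (solve 4 (λ i j x y → i :* j :* (x :* y) := i :* x :* (j :* y)) refl
        (-1^ k) (-1^ (n ∸ k)) (f k) (g (n ∸ k)))

  D-alternate : ∀ f → D (alternate f) ≗ (-ˢ (alternate (D f)))
  D-alternate f n = trans (cong (λ s → fromℕ (suc n) * (s * f (suc n))) (-1^-suc n))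
    (solve 3 (λ m s x → m :* (:- s :* x) := :- (s :* (m :* x))) refl (fromℕ (suc n)) (-1^ n) (f (suc n)))

  expˢ : FPS
  expˢ = 1/_!

  exponential-exp : Exponential 1ℚ expˢ
  exponential-exp = record
    { at-0 = refl
    ; derivative = λ n → trans (suc-1/! n) (sym (trans (constˢ-⊛ 1ℚ expˢ n) (ℚ.*-identityˡ (expˢ n)))) }

  -- Since 1/(2n)!! = (1/2)ⁿ / n!.
  exponential-half : Exponential ½ 1/evenDF
  exponential-half = record
    { at-0       = refl
    ; derivative = λ n → begin
        fromℕ (suc n) * 1/evenDF (suc n)              ≡⟨ cong (fromℕ (suc n) *_) (trans (1/evenDF-split (suc n))
                                                           (cong (_* 1/ suc n !) (1/2^-suc n))) ⟩
        fromℕ (suc n) * (½ * 1/2^ n * 1/ suc n !)     ≡⟨ solve 4 (λ m h p q → m :* (h :* p :* q) := h :* (p :* (m :* q))) refl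
                                                           (fromℕ (suc n)) ½ (1/2^ n) (1/ suc n !) ⟩
        ½ * (1/2^ n * (fromℕ (suc n) * 1/ suc n !))   ≡⟨ cong (λ t → ½ * (1/2^ n * t)) (suc-1/! n) ⟩
        ½ * (1/2^ n * 1/ n !)                         ≡⟨ cong (½ *_) (1/evenDF-split n) ⟨
        ½ * 1/evenDF n                                ≡⟨ constˢ-⊛ ½ 1/evenDF n ⟨
        (constˢ ½ ⊛ 1/evenDF) n                       ∎ }
    where open ≡-Reasoning

  exponential-alternate : ∀ {f} → Exponential 1ℚ f → Exponential (- 1ℚ) (alternate f)
  exponential-alternate {f} ef = record
    { at-0       = trans (ℚ.*-identityˡ (f 0)) at-0
    ; derivative = begin
        D (alternate f)                   ≈⟨ D-alternate f ⟩
        -ˢ (alternate (D f))              ≈⟨ -ˢ-cong (λ n → cong ((-1^ n) *_)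
                                               (trans (derivative n) (trans (constˢ-⊛ 1ℚ f n) (ℚ.*-identityˡ (f n))))) ⟩
        -ˢ (alternate f)                  ≈⟨ solveˢ 1 (λ f → :-ˢ f :=ˢ conˢ (- 1ℚ) :*ˢ f) (λ _ → refl) (alternate f) ⟩
        constˢ (- 1ℚ) ⊛ alternate f       ∎ }
    where
    open Exponential ef
    open ≗-Reasoning

  exp-1≗exp-one : exp-1ˢ ≗ (expˢ +ˢ -ˢ constˢ 1ℚ)
  exp-1≗exp-one zero    = refl
  exp-1≗exp-one (suc n) = sym (ℚ.+-identityʳ (1/ suc n !))

  -- With p k = hᵏ these are the Taylor coefficients of √(1 - 2hy). The leading minus sign offsets
  -- (-3)!! = -1, so that the series starts with 1.
  σ : (ℕ → ℚ) → ℕ → ℚ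
  σ p k = - (1/ k ! * ([2 k -3]!! * p k))

  [2_-3]!!-suc : ∀ k → [2 suc k -3]!! ≡ (fromℕ k + fromℕ k - 1ℚ) * [2 k -3]!!
  -- (-1)!! = (-1) · (-3)!!: the convention for negative arguments continues the recurrence.
  [2 zero -3]!!-suc  = refl
  [2 suc k -3]!!-suc = begin
    fromℕ (oddProduct k ℕ.* suc (2 ℕ.* k))          ≡⟨ fromℕ-* (oddProduct k) (suc (2 ℕ.* k)) ⟩
    fromℕ (oddProduct k) * fromℕ (suc (2 ℕ.* k))    ≡⟨ ℚ.*-comm (fromℕ (oddProduct k)) (fromℕ (suc (2 ℕ.* k))) ⟩
    fromℕ (suc (2 ℕ.* k)) * fromℕ (oddProduct k)    ≡⟨ cong (_* fromℕ (oddProduct k)) odd ⟩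
    (fromℕ (suc k) + fromℕ (suc k) - 1ℚ) * fromℕ (oddProduct k) ∎
    where
    open ≡-Reasoning
    odd : fromℕ (suc (2 ℕ.* k)) ≡ fromℕ (suc k) + fromℕ (suc k) - 1ℚ
    odd = begin
      fromℕ (suc (2 ℕ.* k))                  ≡⟨ fromℕ-suc (2 ℕ.* k) ⟩
      1ℚ + fromℕ (k ℕ.+ (k ℕ.+ 0))           ≡⟨ cong (λ m → 1ℚ + fromℕ (k ℕ.+ m)) (ℕ.+-identityʳ k) ⟩
      1ℚ + fromℕ (k ℕ.+ k)                   ≡⟨ cong (1ℚ +_) (fromℕ-+ k k) ⟩
      1ℚ + (fromℕ k + fromℕ k)               ≡⟨ solve 1 (λ x → con 1ℚ :+ (x :+ x) := (con 1ℚ :+ x) :+ (con 1ℚ :+ x) :- con 1ℚ) refl (fromℕ k) ⟩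
      (1ℚ + fromℕ k) + (1ℚ + fromℕ k) - 1ℚ   ≡⟨ cong (λ t → t + t - 1ℚ) (fromℕ-suc k) ⟨
      fromℕ (suc k) + fromℕ (suc k) - 1ℚ     ∎

  σ-sqrtCoefficients : ∀ {h p} → p 0 ≡ 1ℚ → (∀ k → p (suc k) ≡ h * p k) → SqrtCoefficients h (σ p)
  σ-sqrtCoefficients {h} {p} p-zero p-suc = record
    { σ-zero = cong (λ t → - (1ℚ * (- 1ℚ * t))) p-zero
    ; σ-suc  = λ k → begin
        fromℕ (suc k) * - (1/ suc k ! * ([2 suc k -3]!! * p (suc k)))
          ≡⟨ cong₂ (λ a b → fromℕ (suc k) * - (1/ suc k ! * (a * b))) [2 k -3]!!-suc (p-suc k) ⟩
        fromℕ (suc k) * - (1/ suc k ! * ((fromℕ k + fromℕ k - 1ℚ) * [2 k -3]!! * (h * p k)))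
          ≡⟨ solve 6 (λ m q c o h p → m :* :- (q :* (c :* o :* (h :* p))) := h :* (c :* :- (m :* q :* (o :* p)))) refl
               (fromℕ (suc k)) (1/ suc k !) (fromℕ k + fromℕ k - 1ℚ) [2 k -3]!! h (p k) ⟩
        h * ((fromℕ k + fromℕ k - 1ℚ) * - (fromℕ (suc k) * 1/ suc k ! * ([2 k -3]!! * p k)))
          ≡⟨ cong (λ t → h * ((fromℕ k + fromℕ k - 1ℚ) * - (t * ([2 k -3]!! * p k)))) (suc-1/! k) ⟩
        h * ((fromℕ k + fromℕ k - 1ℚ) * σ p k) ∎ }
    where open ≡-Reasoning

  √[2-exp] √[2exp-1] : FPS
  √[2-exp]  = compose (σ 1/2^_) exp-1ˢ
  √[2exp-1] = compose (σ -1^_) exp-1ˢ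

  private
    sqrt½ : SqrtCoefficients ½ (σ 1/2^_)
    sqrt½ = σ-sqrtCoefficients refl 1/2^-suc

    sqrt-1 : SqrtCoefficients (- 1ℚ) (σ -1^_)
    sqrt-1 = σ-sqrtCoefficients refl λ k → trans (-1^-suc k)
      (trans (cong -_ (sym (ℚ.*-identityˡ (-1^ k)))) (ℚ.neg-distribˡ-* 1ℚ (-1^ k)))

  √[2-exp]-square : (√[2-exp] ⊛ √[2-exp]) ≗ (constˢ (fromℕ 2) +ˢ -ˢ expˢ)
  √[2-exp]-square = begin
    √[2-exp] ⊛ √[2-exp]                     ≈⟨ compose-square sqrt½ exp-1ˢ refl ⟩
    constˢ 1ℚ +ˢ -ˢ (constˢ 1ℚ ⊛ exp-1ˢ)    ≈⟨ +ˢ-congˡ (constˢ 1ℚ) (-ˢ-cong (⊛-congˡ exp-1≗exp-one)) ⟩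
    constˢ 1ℚ +ˢ -ˢ (constˢ 1ℚ ⊛ (expˢ +ˢ -ˢ constˢ 1ℚ))
      ≈⟨ solveˢ 1 (λ x → conˢ 1ℚ :-ˢ conˢ 1ℚ :*ˢ (x :-ˢ conˢ 1ℚ) :=ˢ conˢ (fromℕ 2) :-ˢ x) (λ _ → refl) expˢ ⟩
    constˢ (fromℕ 2) +ˢ -ˢ expˢ             ∎
    where open ≗-Reasoning

  √[2exp-1]-square : (√[2exp-1] ⊛ √[2exp-1]) ≗ ((constˢ (fromℕ 2) ⊛ expˢ) +ˢ -ˢ constˢ 1ℚ)
  √[2exp-1]-square = begin
    √[2exp-1] ⊛ √[2exp-1]                            ≈⟨ compose-square sqrt-1 exp-1ˢ refl ⟩
    constˢ 1ℚ +ˢ -ˢ (constˢ (- 1ℚ - 1ℚ) ⊛ exp-1ˢ)    ≈⟨ +ˢ-congˡ (constˢ 1ℚ) (-ˢ-cong (⊛-congˡ exp-1≗exp-one)) ⟩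
    constˢ 1ℚ +ˢ -ˢ (constˢ (- 1ℚ - 1ℚ) ⊛ (expˢ +ˢ -ˢ constˢ 1ℚ))
      ≈⟨ solveˢ 1 (λ x → conˢ 1ℚ :-ˢ conˢ (- 1ℚ - 1ℚ) :*ˢ (x :-ˢ conˢ 1ℚ) :=ˢ conˢ (fromℕ 2) :*ˢ x :-ˢ conˢ 1ℚ) (λ _ → refl) expˢ ⟩
    (constˢ (fromℕ 2) ⊛ expˢ) +ˢ -ˢ constˢ 1ℚ        ∎
    where open ≗-Reasoning

  -- S(n,k) carries the factor n!/k!: its n! comes out of the sum and its 1/k! is the one in `σ p`.
  stirling-compose : ∀ p n → Σ≤ n (λ k → S n k * ([2 k -3]!! * p k)) ≡ - (fromℕ (n !) * compose (σ p) exp-1ˢ n)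
  stirling-compose p n = begin
    Σ≤ n (λ k → S n k * ([2 k -3]!! * p k))
      ≡⟨ Σ-cong n (λ k _ → solve 4 (λ f q u w → f :* (q :* u) :* w := (:- f) :* (:- (q :* w) :* u)) refl
           (fromℕ (n !)) (1/ k !) ((exp-1ˢ ^ˢ k) n) ([2 k -3]!! * p k)) ⟩
    Σ≤ n (λ k → (- fromℕ (n !)) * (σ p k * (exp-1ˢ ^ˢ k) n))
      ≡⟨ Σ-*ˡ n (- fromℕ (n !)) (λ k → σ p k * (exp-1ˢ ^ˢ k) n) ⟩
    (- fromℕ (n !)) * compose (σ p) exp-1ˢ n
      ≡⟨ ℚ.neg-distribˡ-* (fromℕ (n !)) (compose (σ p) exp-1ˢ n) ⟨
    - (fromℕ (n !) * compose (σ p) exp-1ˢ n) ∎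
    where open ≡-Reasoning

  -- Up to sign, the inner sum is k! times the k-th coefficient of √(2 - eˣ), and
  -- `1/evenDF-binomial` turns the outer weights into coefficients of e^(x/2).
  e≗ : e ≗ (√[2-exp] ⊛ 1/evenDF)
  e≗ n = begin
    - (1/evenDF n * Σ≤ n (λ k → c k * Σ≤ k (λ l → S k l * ([2 l -3]!! * 1/2^ l))))
      ≡⟨ cong (λ t → - (1/evenDF n * t)) (Σ-cong n λ k _ → cong (c k *_) (stirling-compose 1/2^_ k)) ⟩
    - (1/evenDF n * Σ≤ n (λ k → c k * - (fromℕ (k !) * √[2-exp] k)))
      ≡⟨ cong -_ (Σ-*ˡ n (1/evenDF n) (λ k → c k * - (fromℕ (k !) * √[2-exp] k))) ⟨
    - Σ≤ n (λ k → 1/evenDF n * (c k * - (fromℕ (k !) * √[2-exp] k)))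
      ≡⟨ Σ-neg n (λ k → 1/evenDF n * (c k * - (fromℕ (k !) * √[2-exp] k))) ⟨
    Σ≤ n (λ k → - (1/evenDF n * (c k * - (fromℕ (k !) * √[2-exp] k))))
      ≡⟨ Σ-cong n (λ k k≤n → trans
           (solve 4 (λ a c f b → :- (a :* (c :* :- (f :* b))) := b :* (a :* (c :* f))) refl
             (1/evenDF n) (c k) (fromℕ (k !)) (√[2-exp] k))
           (cong (√[2-exp] k *_) (1/evenDF-binomial k≤n))) ⟩
    (√[2-exp] *ˢ 1/evenDF) n
      ≡⟨ ⊛≗*ˢ √[2-exp] 1/evenDF n ⟨
    (√[2-exp] ⊛ 1/evenDF) n ∎
    where
    open ≡-Reasoning
    c : ℕ → ℚ
    c k = fromℕ (n C k) * fromℕ (2 ℕ.^ k)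

  -- The (-1)ᵏ inside the sum selects h = -1; the (-1)ⁿ in front is the substitution x ↦ -x.
  d≗ : d ≗ (-ˢ (alternate √[2exp-1]))
  d≗ n = begin
    (-1^ n) * 1/ n ! * Σ≤ n (λ k → (-1^ k) * S n k * [2 k -3]!!)
      ≡⟨ cong ((-1^ n) * 1/ n ! *_) (trans
           (Σ-cong n λ k _ → solve 3 (λ s t o → s :* t :* o := t :* (o :* s)) refl (-1^ k) (S n k) [2 k -3]!!)
           (stirling-compose -1^_ n)) ⟩
    (-1^ n) * 1/ n ! * - (fromℕ (n !) * √[2exp-1] n)
      ≡⟨ solve 4 (λ s q f b → s :* q :* :- (f :* b) := :- (s :* (f :* q :* b))) refl (-1^ n) (1/ n !) (fromℕ (n !)) (√[2exp-1] n) ⟩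
    - ((-1^ n) * (fromℕ (n !) * 1/ n ! * √[2exp-1] n))
      ≡⟨ cong (λ t → - ((-1^ n) * t)) (trans (cong (_* √[2exp-1] n) (fromℕ-1/! n)) (ℚ.*-identityˡ (√[2exp-1] n))) ⟩
    - ((-1^ n) * √[2exp-1] n) ∎
    where open ≡-Reasoning

  e-square : (e ⊛ e) ≗ ((constˢ (fromℕ 2) ⊛ expˢ) +ˢ -ˢ (expˢ ⊛ expˢ))
  e-square = begin
    e ⊛ e                                                ≈⟨ ⊛-cong e≗ e≗ ⟩
    (√[2-exp] ⊛ 1/evenDF) ⊛ (√[2-exp] ⊛ 1/evenDF)        ≈⟨ solveˢ 2 (λ b h → b :*ˢ h :*ˢ (b :*ˢ h) :=ˢ b :*ˢ b :*ˢ (h :*ˢ h))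
                                                              (λ _ → refl) √[2-exp] 1/evenDF ⟩
    (√[2-exp] ⊛ √[2-exp]) ⊛ (1/evenDF ⊛ 1/evenDF)        ≈⟨ ⊛-cong √[2-exp]-square
                                                              (exponential-unique (exponential-⊛ exponential-half exponential-half) exponential-exp) ⟩
    (constˢ (fromℕ 2) +ˢ -ˢ expˢ) ⊛ expˢ                 ≈⟨ solveˢ 1 (λ x → (conˢ (fromℕ 2) :-ˢ x) :*ˢ x :=ˢ conˢ (fromℕ 2) :*ˢ x :-ˢ x :*ˢ x)
                                                              (λ _ → refl) expˢ ⟩
    (constˢ (fromℕ 2) ⊛ expˢ) +ˢ -ˢ (expˢ ⊛ expˢ)        ∎
    where open ≗-Reasoning

  -- (f + g)(f - g) = 0, and f + g has constant term 2, so it can be cancelled.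
  square-root-unique : ∀ {f g} → f 0 ≡ 1ℚ → g 0 ≡ 1ℚ → (f ⊛ f) ≗ (g ⊛ g) → f ≗ g
  square-root-unique {f} {g} f₀ g₀ f²≗g² n = begin
    f n                  ≡⟨ solve 2 (λ a b → a := (a :- b) :+ b) refl (f n) (g n) ⟩
    (f n - g n) + g n    ≡⟨ cong (_+ g n) (⊛-cancel (f +ˢ g) 2 (cong₂ _+_ f₀ g₀) product n) ⟩
    0ℚ + g n             ≡⟨ ℚ.+-identityˡ (g n) ⟩
    g n                  ∎
    where
    open ≡-Reasoning
    product : ∀ n → ((f +ˢ g) ⊛ (f +ˢ -ˢ g)) n ≡ 0ℚ
    product n = trans (solveˢ 2 (λ f g → (f :+ˢ g) :*ˢ (f :-ˢ g) :=ˢ f :*ˢ f :-ˢ g :*ˢ g) (λ _ → refl) f g n)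
      (trans (cong (_- (g ⊛ g) n) (f²≗g² n)) (ℚ.+-inverseʳ ((g ⊛ g) n)))

  -- Write r̄ = -d. Then r̄² = 2e⁻ˣ - 1 and r̄ = e⁻ˣ e(x). Differentiating the first relation gives
  -- 2 r̄ r̄′ = -2e⁻ˣ, and inserting the second leaves -r̄′ e(x) = 1.
  e-reciprocal : (D d ⊛ e) ≗ oneˢ
  e-reciprocal n = trans (solve 2 (λ a b → a := (a :- b) :+ b) refl ((D d ⊛ e) n) (oneˢ n))
    -- Instead of dividing by e⁻ˣ, the difference d′e - 1 is multiplied by 2e⁻ˣ, whose constant term
    -- 2 allows cancellation.
    (trans (cong (_+ oneˢ n) (⊛-cancel ((2ˢ ⊛ x̄)) 2 (trans (constˢ-⊛ (fromℕ 2) x̄ 0) refl) scaled n)) (ℚ.+-identityˡ (oneˢ n)))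
    where
    x̄ r̄ 2ˢ : FPS
    x̄ = alternate expˢ
    r̄ = alternate √[2exp-1]
    2ˢ = constˢ (fromℕ 2)
    x̄-exponential : Exponential (- 1ℚ) x̄
    x̄-exponential = exponential-alternate exponential-exp
    x̄⊛exp : (x̄ ⊛ expˢ) ≗ oneˢ
    x̄⊛exp = exponential-unique (exponential-⊛ x̄-exponential exponential-exp) exponential-one
    r̄-square : (r̄ ⊛ r̄) ≗ ((2ˢ ⊛ x̄) +ˢ -ˢ constˢ 1ℚ)
    r̄-square n = trans (sym (alternate-⊛ √[2exp-1] √[2exp-1] n)) (trans
      (cong ((-1^ n) *_) (trans (√[2exp-1]-square n) (cong (_- constˢ 1ℚ n) (constˢ-⊛ (fromℕ 2) expˢ n))))
      (trans (distribute n) (cong (_- constˢ 1ℚ n) (sym (constˢ-⊛ (fromℕ 2) x̄ n)))))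
      where
      distribute : ∀ n → (-1^ n) * (fromℕ 2 * expˢ n - constˢ 1ℚ n) ≡ fromℕ 2 * x̄ n - constˢ 1ℚ n
      distribute zero    = refl
      distribute (suc n) = solve 3 (λ s t x → s :* (t :* x :- con 0ℚ) := t :* (s :* x) :- con 0ℚ) refl
        (-1^ suc n) (fromℕ 2) (expˢ (suc n))
    r̄≗x̄⊛e : r̄ ≗ (x̄ ⊛ e)
    -- Both sides start with 1 and have the same square, as e⁻²ˣ (2eˣ - e²ˣ) = 2e⁻ˣ - 1.
    r̄≗x̄⊛e = square-root-unique refl (trans (⊛≗*ˢ x̄ e 0) refl) λ n → trans (r̄-square n) (sym ((begin
      (x̄ ⊛ e) ⊛ (x̄ ⊛ e)
        ≈⟨ solveˢ 2 (λ x e → x :*ˢ e :*ˢ (x :*ˢ e) :=ˢ x :*ˢ x :*ˢ (e :*ˢ e)) (λ _ → refl) x̄ e ⟩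
      (x̄ ⊛ x̄) ⊛ (e ⊛ e)
        ≈⟨ ⊛-congˡ e-square ⟩
      (x̄ ⊛ x̄) ⊛ ((2ˢ ⊛ expˢ) +ˢ -ˢ (expˢ ⊛ expˢ))
        ≈⟨ solveˢ 3 (λ x c y → x :*ˢ x :*ˢ (c :*ˢ y :-ˢ y :*ˢ y) :=ˢ c :*ˢ x :*ˢ (x :*ˢ y) :-ˢ x :*ˢ y :*ˢ (x :*ˢ y))
             (λ _ → refl) x̄ 2ˢ expˢ ⟩
      ((2ˢ ⊛ x̄) ⊛ (x̄ ⊛ expˢ)) +ˢ -ˢ ((x̄ ⊛ expˢ) ⊛ (x̄ ⊛ expˢ))
        ≈⟨ +ˢ-cong (⊛-congˡ x̄⊛exp≗1) (-ˢ-cong (⊛-cong x̄⊛exp≗1 x̄⊛exp≗1)) ⟩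
      ((2ˢ ⊛ x̄) ⊛ constˢ 1ℚ) +ˢ -ˢ (constˢ 1ℚ ⊛ constˢ 1ℚ)
        ≈⟨ solveˢ 1 (λ y → y :*ˢ conˢ 1ℚ :-ˢ conˢ 1ℚ :*ˢ conˢ 1ℚ :=ˢ y :-ˢ conˢ 1ℚ) (λ _ → refl) (2ˢ ⊛ x̄) ⟩
      (2ˢ ⊛ x̄) +ˢ -ˢ constˢ 1ℚ ∎) n))
      where
      open ≗-Reasoning
      x̄⊛exp≗1 : (x̄ ⊛ expˢ) ≗ constˢ 1ℚ
      x̄⊛exp≗1 n = trans (x̄⊛exp n) (sym (constˢ-1 n))
    D-r̄-square : ((D r̄ ⊛ r̄) +ˢ (r̄ ⊛ D r̄)) ≗ (-ˢ (2ˢ ⊛ x̄))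
    D-r̄-square = begin
      (D r̄ ⊛ r̄) +ˢ (r̄ ⊛ D r̄)                   ≈⟨ D-⊛ r̄ r̄ ⟨
      D (r̄ ⊛ r̄)                                 ≈⟨ D-cong r̄-square ⟩
      D ((2ˢ ⊛ x̄) +ˢ -ˢ constˢ 1ℚ)              ≈⟨ (λ n → trans (D-+ (2ˢ ⊛ x̄) (-ˢ constˢ 1ℚ) n)
                                                     (+ˢ-cong (D-⊛ 2ˢ x̄) (λ n → trans (D-neg (constˢ 1ℚ) n) (-ˢ-cong (D-const 1ℚ) n)) n)) ⟩
      ((D 2ˢ ⊛ x̄) +ˢ (2ˢ ⊛ D x̄)) +ˢ -ˢ constˢ 0ℚ
        ≈⟨ +ˢ-congʳ (-ˢ constˢ 0ℚ) (+ˢ-cong (⊛-congʳ (D-const (fromℕ 2))) (⊛-congˡ (Exponential.derivative x̄-exponential))) ⟩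
      ((constˢ 0ℚ ⊛ x̄) +ˢ (2ˢ ⊛ (constˢ (- 1ℚ) ⊛ x̄))) +ˢ -ˢ constˢ 0ℚ
        ≈⟨ solveˢ 2 (λ c x → conˢ 0ℚ :*ˢ x :+ˢ c :*ˢ (conˢ (- 1ℚ) :*ˢ x) :-ˢ conˢ 0ℚ :=ˢ :-ˢ (c :*ˢ x)) (λ _ → refl) 2ˢ x̄ ⟩
      -ˢ (2ˢ ⊛ x̄)                               ∎
      where open ≗-Reasoning
    scaled : ∀ n → ((2ˢ ⊛ x̄) ⊛ ((D d ⊛ e) +ˢ -ˢ oneˢ)) n ≡ 0ℚ
    scaled n = trans ((begin
      (2ˢ ⊛ x̄) ⊛ ((D d ⊛ e) +ˢ -ˢ oneˢ)
        ≈⟨ ⊛-congˡ (+ˢ-cong (⊛-congʳ (λ n → trans (D-cong d≗ n) (D-neg r̄ n))) (-ˢ-cong λ n → sym (constˢ-1 n))) ⟩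
      (2ˢ ⊛ x̄) ⊛ ((-ˢ (D r̄) ⊛ e) +ˢ -ˢ constˢ 1ℚ)
        ≈⟨ solveˢ 3 (λ x q e → conˢ (fromℕ 2) :*ˢ x :*ˢ (:-ˢ q :*ˢ e :-ˢ conˢ 1ℚ) :=ˢ
               :-ˢ (q :*ˢ (x :*ˢ e) :+ˢ x :*ˢ e :*ˢ q) :-ˢ conˢ (fromℕ 2) :*ˢ x) (λ _ → refl) x̄ (D r̄) e ⟩
      -ˢ ((D r̄ ⊛ (x̄ ⊛ e)) +ˢ ((x̄ ⊛ e) ⊛ D r̄)) +ˢ -ˢ (2ˢ ⊛ x̄)
        ≈⟨ +ˢ-congʳ (-ˢ (2ˢ ⊛ x̄)) (-ˢ-cong (+ˢ-cong (⊛-congˡ r̄≗x̄⊛e) (⊛-congʳ r̄≗x̄⊛e))) ⟨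
      -ˢ ((D r̄ ⊛ r̄) +ˢ (r̄ ⊛ D r̄)) +ˢ -ˢ (2ˢ ⊛ x̄)
        ≈⟨ +ˢ-congʳ (-ˢ (2ˢ ⊛ x̄)) (-ˢ-cong D-r̄-square) ⟩
      -ˢ (-ˢ (2ˢ ⊛ x̄)) +ˢ -ˢ (2ˢ ⊛ x̄)
        ≈⟨ solveˢ 1 (λ y → :-ˢ (:-ˢ y) :-ˢ y :=ˢ conˢ 0ℚ) (λ _ → refl) (2ˢ ⊛ x̄) ⟩
      constˢ 0ℚ ∎) n) (zero-const n)
      where
      open ≗-Reasoning
      zero-const : ∀ n → constˢ 0ℚ n ≡ 0ℚ
      zero-const zero    = refl
      zero-const (suc _) = refl

-- Determinants of Hessenberg Toeplitz matrices and reciprocal series.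

module HessenbergDeterminants where

  open Prelude
  open FiniteSums
  open FormalPowerSeries
  open RationalConstants
  open Derivation
  open CoefficientIdentities
  open import Data.Bool.Base using (true; false; if_then_else_; T)
  open import Data.Unit.Base using (tt)
  open import Data.Fin.Base using (Fin; zero; suc; toℕ; punchIn)
  open import Function.Base using (_∘_)
  open +-*-Solver using (solve; _:=_; _:+_; _:*_; _:-_; :-_; con)

  sum-cong : ∀ n {f g : Fin n → ℚ} → (∀ i → f i ≡ g i) → sum f ≡ sum g
  sum-cong zero    f≗g = refl
  sum-cong (suc n) f≗g = cong₂ _+_ (f≗g zero) (sum-cong n (f≗g ∘ suc))

  sum-zero : ∀ n {f : Fin n → ℚ} → (∀ i → f i ≡ 0ℚ) → sum f ≡ 0ℚ
  sum-zero zero    f≗0 = refl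
  sum-zero (suc n) f≗0 = cong₂ _+_ (f≗0 zero) (sum-zero n (f≗0 ∘ suc))

  det-cong : ∀ n {A B : Matrix n} → (∀ i j → A i j ≡ B i j) → det A ≡ det B
  det-cong zero    A≗B = refl
  det-cong (suc n) A≗B = sum-cong (suc n) λ j → cong₂ (λ a m → (-1^ toℕ j) * a * m) (A≗B zero j)
    (det-cong n λ i k → A≗B (suc i) (punchIn j k))

  toeplitz : FPS → ∀ n → Matrix n
  toeplitz a n i j = if toℕ j ℕ.≤ᵇ suc (toℕ i) then a (suc (toℕ i) ∸ toℕ j) else 0ℚ

  -- Striking out the first row and the second column of a Hessenberg Toeplitz
  -- matrix only changes its first column, which is therefore kept as a parameter.
  bordered : (ℕ → ℚ) → FPS → ∀ n → Matrix n
  bordered c a n i zero    = c (toℕ i)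
  bordered c a n i (suc j) = toeplitz a n i (suc j)

  bordered-toeplitz : ∀ a n i j → bordered (tail a) a n i j ≡ toeplitz a n i j
  bordered-toeplitz a n i zero    = refl
  bordered-toeplitz a n i (suc j) = refl

  module _ (a : FPS) (a₀ : a 0 ≡ 1ℚ) where

    private
      t : ℕ → ℚ
      t n = det (toeplitz a n)

      toeplitz-minor : ∀ n i j → toeplitz a (suc n) (suc i) (suc j) ≡ toeplitz a n i j
      toeplitz-minor n i zero    = refl
      toeplitz-minor n i (suc j) = refl

      bordered-minor : ∀ c n i j →
        bordered c a (suc (suc n)) (suc i) (punchIn (suc zero) j) ≡ bordered (c ∘ suc) a (suc n) i j
      bordered-minor c n i zero    = refl
      bordered-minor c n i (suc j) = refl

      -- The first row is c₀, a₀ = 1, 0, ..., 0, so only two minors survive: a smaller Toeplitz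
      -- matrix, and a smaller bordered matrix whose first column has moved up by one.
      det-bordered-suc : ∀ c n → det (bordered c a (suc (suc n))) ≡
        c 0 * t (suc n) - det (bordered (c ∘ suc) a (suc n))
      det-bordered-suc c n = trans
        (cong₂ (λ p q → 1ℚ * c 0 * p + q)
          (det-cong (suc n) (toeplitz-minor (suc n)))
          (cong₂ _+_
            (cong₂ (λ p q → - 1ℚ * p * q) a₀ (det-cong (suc n) (bordered-minor c n)))
            (sum-zero n λ j → trans
              (cong (_* det (minor (suc (suc j)))) (ℚ.*-zeroʳ (-1^ toℕ (suc (suc j)))))
              (ℚ.*-zeroˡ (det (minor (suc (suc j))))))))
        (solve 3 (λ c p q → con 1ℚ :* c :* p :+ (:- con 1ℚ :* con 1ℚ :* q :+ con 0ℚ) := c :* p :- q) refl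
          (c 0) (t (suc n)) (det (bordered (c ∘ suc) a (suc n))))
        where
        minor : Fin (suc (suc n)) → Matrix (suc n)
        minor j i k = bordered c a (suc (suc n)) (suc i) (punchIn j k)

      det-bordered : ∀ c n → det (bordered c a (suc n)) ≡ Σ≤ n (λ k → (-1^ k) * c k * t (n ∸ k))
      det-bordered c zero    = ℚ.+-identityʳ (1ℚ * c 0 * 1ℚ)
      det-bordered c (suc n) = begin
        det (bordered c a (suc (suc n)))
          ≡⟨ det-bordered-suc c n ⟩
        c 0 * t (suc n) - det (bordered (c ∘ suc) a (suc n))
          ≡⟨ cong (λ s → c 0 * t (suc n) - s) (det-bordered (c ∘ suc) n) ⟩
        c 0 * t (suc n) - Σ≤ n (λ k → (-1^ k) * c (suc k) * t (n ∸ k))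
          ≡⟨ cong₂ _+_ (sym (cong (_* t (suc n)) (ℚ.*-identityˡ (c 0)))) (trans
               (sym (Σ-neg n (λ k → (-1^ k) * c (suc k) * t (n ∸ k))))
               (Σ-cong n λ k _ → trans
                 (solve 3 (λ s x y → :- (s :* x :* y) := (:- s) :* x :* y) refl (-1^ k) (c (suc k)) (t (n ∸ k)))
                 (cong (λ s → s * c (suc k) * t (n ∸ k)) (sym (-1^-suc k))))) ⟩
        1ℚ * c 0 * t (suc n) + Σ≤ n (λ k → (-1^ suc k) * c (suc k) * t (n ∸ k))
          ≡⟨ Σ-first n (λ k → (-1^ k) * c k * t (suc n ∸ k)) ⟨
        Σ≤ (suc n) (λ k → (-1^ k) * c k * t (suc n ∸ k)) ∎
        where open ≡-Reasoning

      -- The sign turns the alternating sum of `det-bordered`, taken with the column a₁, a₂, ...,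
      -- into the convolution recurrence of the reciprocal of `a`.
      s : FPS
      s n = (-1^ n) * t n

      s-suc : ∀ n → s (suc n) ≡ - (tail a *ˢ s) n
      s-suc n = begin
        (-1^ suc n) * t (suc n)
          ≡⟨ cong₂ _*_ (-1^-suc n) (trans (det-cong (suc n) λ i j → sym (bordered-toeplitz a (suc n) i j))
               (det-bordered (tail a) n)) ⟩
        (- (-1^ n)) * Σ≤ n (λ k → (-1^ k) * a (suc k) * t (n ∸ k))
          ≡⟨ ℚ.neg-distribˡ-* (-1^ n) _ ⟨
        - ((-1^ n) * Σ≤ n (λ k → (-1^ k) * a (suc k) * t (n ∸ k)))
          ≡⟨ cong -_ (trans (sym (Σ-*ˡ n (-1^ n) (λ k → (-1^ k) * a (suc k) * t (n ∸ k)))) (Σ-cong n term)) ⟩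
        - (tail a *ˢ s) n ∎
        where
        open ≡-Reasoning
        term : ∀ k → k ℕ.≤ n → (-1^ n) * ((-1^ k) * a (suc k) * t (n ∸ k)) ≡ a (suc k) * s (n ∸ k)
        term k k≤n = begin
          (-1^ n) * ((-1^ k) * a (suc k) * t (n ∸ k))
            ≡⟨ cong (_* ((-1^ k) * a (suc k) * t (n ∸ k))) (trans (cong -1^_ (sym (ℕ.m+[n∸m]≡n k≤n))) (-1^-+ k (n ∸ k))) ⟩
          (-1^ k) * (-1^ (n ∸ k)) * ((-1^ k) * a (suc k) * t (n ∸ k))
            ≡⟨ solve 4 (λ i j x y → i :* j :* (i :* x :* y) := (i :* i) :* (x :* (j :* y))) refl
                 (-1^ k) (-1^ (n ∸ k)) (a (suc k)) (t (n ∸ k)) ⟩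
          ((-1^ k) * (-1^ k)) * (a (suc k) * s (n ∸ k))
            ≡⟨ trans (cong (_* (a (suc k) * s (n ∸ k))) (-1^-square k)) (ℚ.*-identityˡ _) ⟩
          a (suc k) * s (n ∸ k) ∎

      a*s : (a *ˢ s) ≗ oneˢ
      a*s zero    = cong (_* s 0) a₀
      a*s (suc n) = begin
        (a *ˢ s) (suc n)                        ≡⟨ *ˢ-suc a s n ⟩
        a 0 * s (suc n) + (tail a *ˢ s) n       ≡⟨ cong₂ (λ p q → p * q + (tail a *ˢ s) n) a₀ (s-suc n) ⟩
        1ℚ * - (tail a *ˢ s) n + (tail a *ˢ s) n  ≡⟨ solve 1 (λ x → con 1ℚ :* :- x :+ x := con 0ℚ) refl ((tail a *ˢ s) n) ⟩
        0ℚ                                      ∎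
        where open ≡-Reasoning

    -- Both `r` and the signed determinants invert `a`, and r = r (a s) = (r a) s = s.
    reciprocal-det : ∀ {r} → (r ⊛ a) ≗ oneˢ → ∀ n → r n ≡ (-1^ n) * det (toeplitz a n)
    reciprocal-det {r} ra≗1 = begin
      r              ≈⟨ ⊛-identityˡ r ⟨
      oneˢ ⊛ r       ≈⟨ ⊛-comm oneˢ r ⟩
      r ⊛ oneˢ       ≈⟨ ⊛-congˡ (λ n → trans (⊛≗*ˢ a s n) (a*s n)) ⟨
      r ⊛ (a ⊛ s)    ≈⟨ ⊛-assoc r a s ⟨
      (r ⊛ a) ⊛ s    ≈⟨ ⊛-congʳ ra≗1 ⟩
      oneˢ ⊛ s       ≈⟨ ⊛-identityˡ s ⟩
      s              ∎
      where open ≗-Reasoning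

  d-det : ∀ n → d (suc n) ≡ ((-1^ n) * 1/ℕ (suc n)) * det (E n)
  d-det n = fromℕ-cancelˡ (suc n) (begin
    -- `E n` is `toeplitz e n` by definition, so the general result applies as it stands.
    D d n                                                    ≡⟨ reciprocal-det e refl e-reciprocal n ⟩
    (-1^ n) * det (E n)                                      ≡⟨ ℚ.*-identityˡ _ ⟨
    1ℚ * ((-1^ n) * det (E n))                               ≡⟨ cong (_* ((-1^ n) * det (E n))) (fromℕ-1/ℕ (suc n)) ⟨
    fromℕ (suc n) * 1/ℕ (suc n) * ((-1^ n) * det (E n))      ≡⟨ solve 4 (λ m q s x → m :* q :* (s :* x) := m :* (s :* q :* x)) refl
                                                                  (fromℕ (suc n)) (1/ℕ (suc n)) (-1^ n) (det (E n)) ⟩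
    fromℕ (suc n) * ((-1^ n) * 1/ℕ (suc n) * det (E n))      ∎)
    where open ≡-Reasoning

  -- The indices suc (i + 1 - j) and i + 2 - j agree under truncated subtraction only if j ≤ i + 1,
  -- hence the split on the guard.
  toeplitz-F : ∀ n i j → toeplitz (D d) n i j ≡ F n i j
  toeplitz-F n i j with toℕ j ℕ.≤ᵇ suc (toℕ i) in eq
  ... | false = refl
  ... | true  = cong (λ m → fromℕ m * d m)
    (sym (ℕ.+-∸-assoc 1 (ℕ.≤ᵇ⇒≤ (toℕ j) (suc (toℕ i)) (subst T (sym eq) tt))))

  e-det : ∀ n → e n ≡ (-1^ n) * det (F n)
  e-det n = trans
    (reciprocal-det (D d) refl (λ k → trans (⊛-comm e (D d) k) (e-reciprocal k)) n)
    (cong ((-1^ n) *_) (det-cong n (toeplitz-F n)))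

-- Order, powers and geometric decay in the rationals.

module RationalOrder where

  open Prelude
  open RationalConstants
  open import Algebra.Bundles using (CommutativeRing)
  open import Algebra.Definitions.RawSemiring ℚ.+-*-rawSemiring public using (_^_)
  open import Data.Sum.Base using (inj₁; inj₂)
  open +-*-Solver using (solve; _:=_; _:+_; _:*_; _:-_; :-_; con)

  module Pow where
    open Algebra.Properties.Semiring.Exp (CommutativeRing.semiring ℚ.+-*-commutativeRing) public
    open Algebra.Properties.CommutativeSemiring.Exp (CommutativeRing.commutativeSemiring ℚ.+-*-commutativeRing) public
      using (^-distrib-*)

  0≤1 : 0ℚ ≤ 1ℚ
  0≤1 = ℚ.<⇒≤ (ℚ.positive⁻¹ 1ℚ)

  ≤-+nonNeg : ∀ p {s} → 0ℚ ≤ s → p ≤ p + s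
  ≤-+nonNeg p {s} 0≤s = subst (_≤ p + s) (ℚ.+-identityʳ p) (ℚ.+-monoʳ-≤ p 0≤s)

  <-+pos : ∀ p {s} → 0ℚ < s → p < p + s
  <-+pos p {s} 0<s = subst (_< p + s) (ℚ.+-identityʳ p) (ℚ.+-monoʳ-< p 0<s)

  ≤⇒0≤- : ∀ {p q} → p ≤ q → 0ℚ ≤ q - p
  ≤⇒0≤- {p} {q} p≤q = subst (_≤ q - p) (ℚ.+-inverseʳ p) (ℚ.+-monoˡ-≤ (- p) p≤q)

  <⇒0<- : ∀ {p q} → p < q → 0ℚ < q - p
  <⇒0<- {p} {q} p<q = subst (_< q - p) (ℚ.+-inverseʳ p) (ℚ.+-monoˡ-< (- p) p<q)

  *-mono-≤ : ∀ {p q r s} → 0ℚ ≤ p → 0ℚ ≤ s → p ≤ q → r ≤ s → p * r ≤ q * s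
  *-mono-≤ {p} {q} {r} {s} 0≤p 0≤s p≤q r≤s = ℚ.≤-trans
    (ℚ.*-monoˡ-≤-nonNeg p {{ℚ.nonNegative 0≤p}} r≤s)
    (ℚ.*-monoʳ-≤-nonNeg s {{ℚ.nonNegative 0≤s}} p≤q)

  *-monoˡ : ∀ {p r s} → 0ℚ ≤ p → r ≤ s → p * r ≤ p * s
  *-monoˡ {p} 0≤p = ℚ.*-monoˡ-≤-nonNeg p {{ℚ.nonNegative 0≤p}}

  *-monoʳ : ∀ {p r s} → 0ℚ ≤ p → r ≤ s → r * p ≤ s * p
  *-monoʳ {p} 0≤p = ℚ.*-monoʳ-≤-nonNeg p {{ℚ.nonNegative 0≤p}}

  0≤* : ∀ {p q} → 0ℚ ≤ p → 0ℚ ≤ q → 0ℚ ≤ p * q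
  0≤* {p} {q} 0≤p 0≤q = subst (_≤ p * q) (ℚ.*-zeroʳ p) (*-monoˡ 0≤p 0≤q)

  0<* : ∀ {p q} → 0ℚ < p → 0ℚ < q → 0ℚ < p * q
  0<* {p} {q} 0<p 0<q = subst (_< p * q) (ℚ.*-zeroʳ p) (ℚ.*-monoʳ-<-pos p {{ℚ.positive 0<p}} 0<q)

  square-nonNeg : ∀ p → 0ℚ ≤ p * p
  square-nonNeg p with ℚ.≤-total 0ℚ p
  ... | inj₁ 0≤p = 0≤* 0≤p 0≤p
  ... | inj₂ p≤0 = subst (0ℚ ≤_) (solve 1 (λ p → :- p :* :- p := p :* p) refl p) (0≤* 0≤-p 0≤-p)
    where
    0≤-p : 0ℚ ≤ - p
    0≤-p = ℚ.neg-antimono-≤ p≤0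

  p≤∣p∣ : ∀ p → p ≤ ∣ p ∣
  p≤∣p∣ p with ℚ.≤-total 0ℚ p
  ... | inj₁ 0≤p = ℚ.≤-reflexive (sym (ℚ.0≤p⇒∣p∣≡p 0≤p))
  ... | inj₂ p≤0 = ℚ.≤-trans p≤0 (ℚ.0≤∣p∣ p)

  ∣p∣*∣p∣ : ∀ p → ∣ p ∣ * ∣ p ∣ ≡ p * p
  ∣p∣*∣p∣ p = trans (sym (ℚ.∣p*q∣≡∣p∣*∣q∣ p p)) (ℚ.0≤p⇒∣p∣≡p (square-nonNeg p))

  square-cancel-≤ : ∀ {p q} → 0ℚ ≤ q → p * p ≤ q * q → p ≤ q
  square-cancel-≤ {p} {q} 0≤q p²≤q² = ℚ.≮⇒≥ λ q<p → ℚ.<-irrefl refl (ℚ.<-≤-trans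
    (ℚ.≤-<-trans (*-monoˡ 0≤q (ℚ.<⇒≤ q<p)) (ℚ.*-monoˡ-<-pos p {{ℚ.positive (ℚ.≤-<-trans 0≤q q<p)}} q<p)) p²≤q²)

  square-cancel-∣∣ : ∀ {p q} → 0ℚ ≤ q → p * p ≤ q * q → ∣ p ∣ ≤ q
  square-cancel-∣∣ {p} {q} 0≤q p²≤q² = square-cancel-≤ 0≤q (subst (_≤ q * q) (sym (∣p∣*∣p∣ p)) p²≤q²)

  ^-nonNeg : ∀ {p} n → 0ℚ ≤ p → 0ℚ ≤ p ^ n
  ^-nonNeg zero    0≤p = 0≤1
  ^-nonNeg (suc n) 0≤p = 0≤* 0≤p (^-nonNeg n 0≤p)

  ^-mono-≤ : ∀ {p q} n → 0ℚ ≤ p → p ≤ q → p ^ n ≤ q ^ n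
  ^-mono-≤ zero    0≤p p≤q = ℚ.≤-refl
  ^-mono-≤ (suc n) 0≤p p≤q = *-mono-≤ 0≤p (^-nonNeg n (ℚ.≤-trans 0≤p p≤q)) p≤q (^-mono-≤ n 0≤p p≤q)

  ^-antimono : ∀ {p m n} → 0ℚ ≤ p → p ≤ 1ℚ → m ℕ.≤ n → p ^ n ≤ p ^ m
  ^-antimono {p} {n = n} 0≤p p≤1 ℕ.z≤n = go n
    where
    go : ∀ n → p ^ n ≤ 1ℚ
    go zero    = ℚ.≤-refl
    go (suc n) = ℚ.≤-trans (*-mono-≤ 0≤p 0≤1 p≤1 (go n)) (ℚ.≤-reflexive (ℚ.*-identityˡ 1ℚ))
  ^-antimono {p} 0≤p p≤1 (ℕ.s≤s m≤n) = *-monoˡ 0≤p (^-antimono 0≤p p≤1 m≤n)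

  quotient : ∀ p {q} → 0ℚ < q → ∃[ t ] t * q ≡ p
  quotient p {q} 0<q = p * 1/q , trans (ℚ.*-assoc p 1/q q)
    (trans (cong (p *_) (ℚ.*-inverseˡ q)) (ℚ.*-identityʳ p))
    where
    instance
      q≢0 : ℚ.NonZero q
      q≢0 = ℚ.pos⇒nonZero q {{ℚ.positive 0<q}}
    1/q : ℚ
    1/q = ℚ.1/ q

  *-cancelʳ-≤ : ∀ {p q r} → 0ℚ < r → p * r ≤ q * r → p ≤ q
  *-cancelʳ-≤ {r = r} 0<r = ℚ.*-cancelʳ-≤-pos r {{ℚ.positive 0<r}}

  *-cancelʳ-< : ∀ {p q r} → 0ℚ < r → p * r < q * r → p < q
  *-cancelʳ-< {r = r} 0<r = ℚ.*-cancelʳ-<-nonNeg r {{ℚ.nonNegative (ℚ.<⇒≤ 0<r)}}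

  ratio : ∀ {p q} → 0ℚ ≤ p → p < q → ∃[ t ] 0ℚ ≤ t × t < 1ℚ × t * q ≡ p
  ratio {p} {q} 0≤p p<q with ℚ.≤-<-trans 0≤p p<q
  ... | 0<q with quotient p 0<q
  ... | t , tq≡p = t
    , *-cancelʳ-≤ 0<q (subst₂ _≤_ (sym (ℚ.*-zeroˡ q)) (sym tq≡p) 0≤p)
    , *-cancelʳ-< 0<q (subst₂ _<_ (sym tq≡p) (sym (ℚ.*-identityˡ q)) p<q)
    , tq≡p

  0≤fromℕ : ∀ n → 0ℚ ≤ fromℕ n
  0≤fromℕ n = ℚ.nonNegative⁻¹ (fromℕ n) {{ℚ.normalize-nonNeg n 1}}

  -- With s = 1 - t, the induction step is (1 - s)(1 + (n + 1) s) ≤ 1 + n s.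
  bernoulli : ∀ {t} → 0ℚ ≤ t → t ≤ 1ℚ → ∀ n → t ^ n * (1ℚ + fromℕ n * (1ℚ - t)) ≤ 1ℚ
  bernoulli {t} 0≤t t≤1 zero    = ℚ.≤-reflexive (solve 1 (λ s → con 1ℚ :* (con 1ℚ :+ con 0ℚ :* s) := con 1ℚ) refl (1ℚ - t))
  bernoulli {t} 0≤t t≤1 (suc n) = begin
    t * t ^ n * (1ℚ + fromℕ (suc n) * (1ℚ - t))
      ≡⟨ cong (λ k → t * t ^ n * (1ℚ + k * (1ℚ - t))) (fromℕ-suc n) ⟩
    t * t ^ n * (1ℚ + (1ℚ + fromℕ n) * (1ℚ - t))
      ≤⟨ ≤-+nonNeg _ (0≤* (^-nonNeg n 0≤t) (0≤* (0≤fromℕ (suc n)) (square-nonNeg (1ℚ - t)))) ⟩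
    t * t ^ n * (1ℚ + (1ℚ + fromℕ n) * (1ℚ - t)) + t ^ n * (fromℕ (suc n) * ((1ℚ - t) * (1ℚ - t)))
      ≡⟨ cong (λ k → t * t ^ n * (1ℚ + (1ℚ + fromℕ n) * (1ℚ - t)) + t ^ n * (k * ((1ℚ - t) * (1ℚ - t)))) (fromℕ-suc n) ⟩
    t * t ^ n * (1ℚ + (1ℚ + fromℕ n) * (1ℚ - t)) + t ^ n * ((1ℚ + fromℕ n) * ((1ℚ - t) * (1ℚ - t)))
      ≡⟨ solve 3 (λ t x k → t :* x :* (con 1ℚ :+ (con 1ℚ :+ k) :* (con 1ℚ :- t)) :+
                   x :* ((con 1ℚ :+ k) :* ((con 1ℚ :- t) :* (con 1ℚ :- t)))
                 := x :* (con 1ℚ :+ k :* (con 1ℚ :- t))) refl t (t ^ n) (fromℕ n) ⟩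
    t ^ n * (1ℚ + fromℕ n * (1ℚ - t))
      ≤⟨ bernoulli 0≤t t≤1 n ⟩
    1ℚ ∎
    where
    open ℚ.≤-Reasoning

  -- Bernoulli's inequality gives n tⁿ (1 - t) ≤ 1, so t^(m+1) (1 - t) is at most 1/(m + 1) =
  -- `mesh m`, and it suffices that `mesh m` drops below δ = ε (1 - t) / C.
  geometric-decay : ∀ {t C} → 0ℚ ≤ t → t < 1ℚ → 0ℚ < C → ∀ ε → 0ℚ < ε →
                    ∃[ N ] ∀ n → N ℕ.≤ n → t ^ n * C ≤ ε
  geometric-decay {t} {C} 0≤t t<1 0<C ε 0<ε with quotient (ε * (1ℚ - t)) 0<C
  ... | δ , δC≡εs with mesh-small δ (*-cancelʳ-< 0<C (subst₂ _<_ (sym (ℚ.*-zeroˡ C)) (sym δC≡εs) (0<* 0<ε (<⇒0<- t<1))))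
  ... | N , small = suc N , λ { (suc m) (ℕ.s≤s N≤m) → *-cancelʳ-≤ 0<s (begin
        t ^ suc m * C * s      ≡⟨ solve 3 (λ x C s → x :* C :* s := x :* s :* C) refl (t ^ suc m) C s ⟩
        t ^ suc m * s * C      ≤⟨ *-monoʳ (ℚ.<⇒≤ 0<C) (ℚ.≤-trans (decay m) (small m N≤m)) ⟩
        δ * C                  ≡⟨ δC≡εs ⟩
        ε * s                  ∎) }
    where
    open ℚ.≤-Reasoning
    s : ℚ
    s = 1ℚ - t
    0<s : 0ℚ < s
    0<s = <⇒0<- t<1
    decay : ∀ m → t ^ suc m * s ≤ mesh m
    decay m = begin
      t ^ suc m * s                                        ≡⟨ ℚ.*-identityʳ (t ^ suc m * s) ⟨
      t ^ suc m * s * 1ℚ                                   ≡⟨ cong (t ^ suc m * s *_) (fromℕ-1/ℕ (suc m)) ⟨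
      t ^ suc m * s * (fromℕ (suc m) * 1/ℕ (suc m))        ≡⟨ cong (λ q → t ^ suc m * s * (fromℕ (suc m) * q)) (ℚ.↥p/↧p≡p (mesh m)) ⟩
      t ^ suc m * s * (fromℕ (suc m) * mesh m)             ≡⟨ solve 4 (λ x s k q → x :* s :* (k :* q) := x :* (k :* s) :* q) refl
                                                                (t ^ suc m) s (fromℕ (suc m)) (mesh m) ⟩
      t ^ suc m * (fromℕ (suc m) * s) * mesh m             ≤⟨ *-monoʳ (ℚ.<⇒≤ (ℚ.positive⁻¹ (mesh m)))
                                                                (*-monoˡ (^-nonNeg (suc m) 0≤t) (subst (_≤ 1ℚ + fromℕ (suc m) * s)
                                                                  (ℚ.+-identityˡ (fromℕ (suc m) * s)) (ℚ.+-monoˡ-≤ (fromℕ (suc m) * s) 0≤1))) ⟩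
      t ^ suc m * (1ℚ + fromℕ (suc m) * s) * mesh m        ≤⟨ *-monoʳ (ℚ.<⇒≤ (ℚ.positive⁻¹ (mesh m))) (bernoulli 0≤t (ℚ.<⇒≤ t<1) (suc m)) ⟩
      1ℚ * mesh m                                          ≡⟨ ℚ.*-identityˡ (mesh m) ⟩
      mesh m                                               ∎

-- Tails and Cauchy products of absolutely convergent series.

module PowerSeriesEstimates where

  open Prelude
  open FiniteSums
  open FormalPowerSeries
  open RationalOrder
  open import Function.Base using (_∘_)
  open +-*-Solver using (solve; _:=_; _:+_; _:*_; _:-_)

  -- The weight `φ` depends on the degree alone and is otherwise arbitrary: it is used with Rᵏ, but
  -- also with the real and imaginary parts of xᵏ, which are not multiplicative.
  Σ-*ˢ : ∀ n a b (φ : ℕ → ℚ) → Σ≤ n (λ k → (a *ˢ b) k * φ k) ≡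
                     Σ≤ n (λ i → a i * Σ≤ (n ∸ i) (λ j → b j * φ (i ℕ.+ j)))
  Σ-*ˢ zero    a b φ = ℚ.*-assoc (a 0) (b 0) (φ 0)
  Σ-*ˢ (suc n) a b φ = begin
    Σ≤ (suc n) (λ k → (a *ˢ b) k * φ k)
      ≡⟨ Σ-first n (λ k → (a *ˢ b) k * φ k) ⟩
    a 0 * b 0 * φ 0 + Σ≤ n (λ k → (a *ˢ b) (suc k) * φ (suc k))
      ≡⟨ cong₂ _+_ (ℚ.*-assoc (a 0) (b 0) (φ 0)) (trans
           (Σ-cong n λ k _ → trans (cong (_* φ (suc k)) (*ˢ-suc a b k))
             (solve 4 (λ x y z w → (x :* y :+ z) :* w := x :* (y :* w) :+ z :* w) refl
               (a 0) (b (suc k)) ((tail a *ˢ b) k) (φ (suc k))))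
           (trans (Σ-+ n (λ k → a 0 * (b (suc k) * φ (suc k))) (λ k → (tail a *ˢ b) k * φ (suc k)))
             (cong₂ _+_ (Σ-*ˡ n (a 0) (λ k → b (suc k) * φ (suc k))) (Σ-*ˢ n (tail a) b (φ ∘ suc))))) ⟩
    a 0 * (b 0 * φ 0) + (a 0 * Σ≤ n (λ k → b (suc k) * φ (suc k)) + rest)
      ≡⟨ solve 4 (λ x y z w → x :* y :+ (x :* z :+ w) := x :* (y :+ z) :+ w) refl
           (a 0) (b 0 * φ 0) (Σ≤ n (λ k → b (suc k) * φ (suc k))) rest ⟩
    a 0 * (b 0 * φ 0 + Σ≤ n (λ k → b (suc k) * φ (suc k))) + rest
      ≡⟨ cong (λ s → a 0 * s + rest) (Σ-first n (λ j → b j * φ j)) ⟨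
    a 0 * Σ≤ (suc n) (λ j → b j * φ j) + rest
      ≡⟨ Σ-first n (λ i → a i * Σ≤ (suc n ∸ i) (λ j → b j * φ (i ℕ.+ j))) ⟨
    Σ≤ (suc n) (λ i → a i * Σ≤ (suc n ∸ i) (λ j → b j * φ (i ℕ.+ j))) ∎
    where
    open ≡-Reasoning
    rest : ℚ
    rest = Σ≤ n (λ i → a (suc i) * Σ≤ (n ∸ i) (λ j → b j * φ (suc (i ℕ.+ j))))

  Σ-tail : ∀ {m n} f g K → 0ℚ ≤ K → (∀ k → 0ℚ ≤ g k) → (∀ k → m ℕ.< k → ∣ f k ∣ ≤ K * g k) →
           m ℕ.≤ n → ∣ Σ≤ n f - Σ≤ m f ∣ ≤ K * Σ≤ n g
  Σ-tail {m} f g K 0≤K 0≤g f≤g m≤n = go (ℕ.≤⇒≤′ m≤n)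
    where
    open ℚ.≤-Reasoning
    go : ∀ {n} → m ℕ.≤′ n → ∣ Σ≤ n f - Σ≤ m f ∣ ≤ K * Σ≤ n g
    go ℕ.≤′-refl = subst (_≤ K * Σ≤ m g) (cong ∣_∣ (sym (ℚ.+-inverseʳ (Σ≤ m f))))
      (0≤* 0≤K (Σ-nonNeg m λ k _ → 0≤g k))
    go {suc n} (ℕ.≤′-step m≤n) = begin
      ∣ Σ≤ n f + f (suc n) - Σ≤ m f ∣      ≡⟨ cong ∣_∣ (solve 3 (λ x y z → x :+ y :- z := (x :- z) :+ y) refl (Σ≤ n f) (f (suc n)) (Σ≤ m f)) ⟩
      ∣ (Σ≤ n f - Σ≤ m f) + f (suc n) ∣    ≤⟨ ℚ.∣p+q∣≤∣p∣+∣q∣ (Σ≤ n f - Σ≤ m f) (f (suc n)) ⟩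
      ∣ Σ≤ n f - Σ≤ m f ∣ + ∣ f (suc n) ∣  ≤⟨ ℚ.+-mono-≤ (go m≤n) (f≤g (suc n) (ℕ.s≤s (ℕ.≤′⇒≤ m≤n))) ⟩
      K * Σ≤ n g + K * g (suc n)           ≡⟨ ℚ.*-distribˡ-+ K (Σ≤ n g) (g (suc n)) ⟨
      K * Σ≤ (suc n) g                     ∎

  majorant : FPS → ℚ → ℕ → ℚ
  majorant a r n = Σ≤ n (λ k → ∣ a k ∣ * r ^ k)

  -- t < 1 is the ratio between the radius t R at which a series is evaluated
  -- and a radius R at which it converges absolutely.
  module _ {t R : ℚ} (0≤t : 0ℚ ≤ t) (t≤1 : t ≤ 1ℚ) (0≤R : 0ℚ ≤ R)
           {φ : ℕ → ℚ} (φ≤ : ∀ k → ∣ φ k ∣ ≤ (t * R) ^ k) where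

    open ℚ.≤-Reasoning

    private
      -- From degree m on, a factor tᵐ can be extracted while Rᵏ is kept for the majorant.
      φ≤′ : ∀ {m} k → m ℕ.≤ k → ∣ φ k ∣ ≤ t ^ m * R ^ k
      φ≤′ {m} k m≤k = begin
        ∣ φ k ∣         ≤⟨ φ≤ k ⟩
        (t * R) ^ k     ≡⟨ Pow.^-distrib-* t R k ⟩
        t ^ k * R ^ k   ≤⟨ *-monoʳ (^-nonNeg k 0≤R) (^-antimono 0≤t t≤1 m≤k) ⟩
        t ^ m * R ^ k   ∎

      0≤term : ∀ (a : FPS) k → 0ℚ ≤ ∣ a k ∣ * R ^ k
      0≤term a k = 0≤* (ℚ.0≤∣p∣ (a k)) (^-nonNeg k 0≤R)

    power-series-tail : ∀ {a : FPS} {A} → (∀ n → majorant a R n ≤ A) → ∀ {m n} → m ℕ.≤ n →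
      ∣ Σ≤ n (λ k → a k * φ k) - Σ≤ m (λ k → a k * φ k) ∣ ≤ t ^ m * A
    power-series-tail {a} {A} bound {m} {n} m≤n = begin
      ∣ Σ≤ n (λ k → a k * φ k) - Σ≤ m (λ k → a k * φ k) ∣
        ≤⟨ Σ-tail (λ k → a k * φ k) (λ k → ∣ a k ∣ * R ^ k) (t ^ m) (^-nonNeg m 0≤t) (0≤term a) (λ k m<k → begin
             ∣ a k * φ k ∣               ≡⟨ ℚ.∣p*q∣≡∣p∣*∣q∣ (a k) (φ k) ⟩
             ∣ a k ∣ * ∣ φ k ∣           ≤⟨ *-monoˡ (ℚ.0≤∣p∣ (a k)) (φ≤′ k (ℕ.<⇒≤ m<k)) ⟩
             ∣ a k ∣ * (t ^ m * R ^ k)   ≡⟨ solve 3 (λ x y z → x :* (y :* z) := y :* (x :* z)) refl ∣ a k ∣ (t ^ m) (R ^ k) ⟩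
             t ^ m * (∣ a k ∣ * R ^ k)   ∎) m≤n ⟩
      t ^ m * majorant a R n
        ≤⟨ *-monoˡ (^-nonNeg m 0≤t) (bound n) ⟩
      t ^ m * A ∎

    -- The truncated product contains the terms of the Cauchy product up to degree n;
    -- the others have degree i + j > n.
    cauchy-product-error : ∀ {a b : FPS} {A B} → 0ℚ ≤ B →
      (∀ n → majorant a R n ≤ A) → (∀ n → majorant b R n ≤ B) → ∀ n →
      ∣ Σ≤ n (λ i → a i * Σ≤ n (λ j → b j * φ (i ℕ.+ j))) - Σ≤ n (λ k → (a *ˢ b) k * φ k) ∣ ≤ t ^ n * (A * B)
    cauchy-product-error {a} {b} {A} {B} 0≤B boundᵃ boundᵇ n = begin
      ∣ Σ≤ n (λ i → a i * inner i n) - Σ≤ n (λ k → (a *ˢ b) k * φ k) ∣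
        ≡⟨ cong ∣_∣ (trans (cong (λ s → Σ≤ n (λ i → a i * inner i n) - s) (Σ-*ˢ n a b φ))
             (trans (cong (Σ≤ n (λ i → a i * inner i n) +_) (sym (Σ-neg n (λ i → a i * inner i (n ∸ i)))))
               (sym (Σ-+ n (λ i → a i * inner i n) (λ i → - (a i * inner i (n ∸ i))))))) ⟩
      ∣ Σ≤ n (λ i → a i * inner i n - a i * inner i (n ∸ i)) ∣
        ≤⟨ Σ-∣∣ n _ ⟩
      Σ≤ n (λ i → ∣ a i * inner i n - a i * inner i (n ∸ i) ∣)
        ≤⟨ Σ-mono n term ⟩
      Σ≤ n (λ i → t ^ n * B * (∣ a i ∣ * R ^ i))
        ≡⟨ Σ-*ˡ n (t ^ n * B) (λ i → ∣ a i ∣ * R ^ i) ⟩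
      t ^ n * B * majorant a R n
        ≤⟨ *-monoˡ (0≤* (^-nonNeg n 0≤t) 0≤B) (boundᵃ n) ⟩
      t ^ n * B * A
        ≡⟨ solve 3 (λ x y z → x :* y :* z := x :* (z :* y)) refl (t ^ n) B A ⟩
      t ^ n * (A * B) ∎
      where
      inner : ℕ → ℕ → ℚ
      inner i m = Σ≤ m (λ j → b j * φ (i ℕ.+ j))
      inner-tail : ∀ i → i ℕ.≤ n → ∣ inner i n - inner i (n ∸ i) ∣ ≤ t ^ n * R ^ i * B
      inner-tail i i≤n = begin
        ∣ inner i n - inner i (n ∸ i) ∣
          ≤⟨ Σ-tail (λ j → b j * φ (i ℕ.+ j)) (λ j → ∣ b j ∣ * R ^ j) (t ^ n * R ^ i)
               (0≤* (^-nonNeg n 0≤t) (^-nonNeg i 0≤R)) (0≤term b) (λ j n∸i<j → begin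
                 ∣ b j * φ (i ℕ.+ j) ∣             ≡⟨ ℚ.∣p*q∣≡∣p∣*∣q∣ (b j) (φ (i ℕ.+ j)) ⟩
                 ∣ b j ∣ * ∣ φ (i ℕ.+ j) ∣         ≤⟨ *-monoˡ (ℚ.0≤∣p∣ (b j)) (φ≤′ (i ℕ.+ j)
                                                       -- The omitted terms have i + j ≥ n, which
                                                       -- yields tⁿ independently of i.
                                                       (subst (ℕ._≤ i ℕ.+ j) (ℕ.m+[n∸m]≡n i≤n) (ℕ.+-monoʳ-≤ i (ℕ.<⇒≤ n∸i<j)))) ⟩
                 ∣ b j ∣ * (t ^ n * R ^ (i ℕ.+ j)) ≡⟨ cong (λ p → ∣ b j ∣ * (t ^ n * p)) (Pow.^-homo-* R i j) ⟩
                 ∣ b j ∣ * (t ^ n * (R ^ i * R ^ j)) ≡⟨ solve 4 (λ x y z w → x :* (y :* (z :* w)) := y :* z :* (x :* w)) refl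
                                                       ∣ b j ∣ (t ^ n) (R ^ i) (R ^ j) ⟩
                 t ^ n * R ^ i * (∣ b j ∣ * R ^ j) ∎) (ℕ.m∸n≤m n i) ⟩
        t ^ n * R ^ i * majorant b R n
          ≤⟨ *-monoˡ (0≤* (^-nonNeg n 0≤t) (^-nonNeg i 0≤R)) (boundᵇ n) ⟩
        t ^ n * R ^ i * B ∎
      term : ∀ i → i ℕ.≤ n → ∣ a i * inner i n - a i * inner i (n ∸ i) ∣ ≤ t ^ n * B * (∣ a i ∣ * R ^ i)
      term i i≤n = begin
        ∣ a i * inner i n - a i * inner i (n ∸ i) ∣   ≡⟨ cong ∣_∣ (solve 3 (λ x y z → x :* y :- x :* z := x :* (y :- z)) refl
                                                          (a i) (inner i n) (inner i (n ∸ i))) ⟩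
        ∣ a i * (inner i n - inner i (n ∸ i)) ∣       ≡⟨ ℚ.∣p*q∣≡∣p∣*∣q∣ (a i) (inner i n - inner i (n ∸ i)) ⟩
        ∣ a i ∣ * ∣ inner i n - inner i (n ∸ i) ∣     ≤⟨ *-monoˡ (ℚ.0≤∣p∣ (a i)) (inner-tail i i≤n) ⟩
        ∣ a i ∣ * (t ^ n * R ^ i * B)                 ≡⟨ solve 4 (λ x y z w → x :* (y :* z :* w) := y :* w :* (x :* z)) refl
                                                          ∣ a i ∣ (t ^ n) (R ^ i) B ⟩
        t ^ n * B * (∣ a i ∣ * R ^ i)                 ∎

-- Non-negativity and size of the coefficients of 1 - e.

module CoefficientBounds where

  open Prelude
  open FiniteSums
  open FormalPowerSeries
  open CoefficientIdentities
  open RationalOrder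
  open PowerSeriesEstimates
  open import Data.Nat.Induction using (<-rec)
  open import Data.Sum.Base using ([_,_]′)
  open FPS-Solver using () renaming
    (solve to solveˢ; _:=_ to _:=ˢ_; _:+_ to _:+ˢ_; _:*_ to _:*ˢ_; _:-_ to _:-ˢ_; :-_ to :-ˢ_; con to conˢ)
  open +-*-Solver using (solve; _:=_; _:+_; _:*_; _:-_; :-_; con)

  0≤1/! : ∀ n → 0ℚ ≤ 1/ n !
  0≤1/! n = ℚ.nonNegative⁻¹ (1/ n !) {{ℚ.normalize-nonNeg 1 (n !) {{n ℕ.!≢0}}}}

  exp-1-nonNeg : ∀ n → 0ℚ ≤ exp-1ˢ n
  exp-1-nonNeg zero    = ℚ.≤-refl
  exp-1-nonNeg (suc n) = 0≤1/! (suc n)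

  1-e : FPS
  1-e = constˢ 1ℚ +ˢ -ˢ e

  -- Equivalent to e² = 1 - (eˣ - 1)², a rewriting of `e-square`.
  1-e-quadratic : (1-e +ˢ 1-e) ≗ ((1-e ⊛ 1-e) +ˢ (exp-1ˢ ⊛ exp-1ˢ))
  1-e-quadratic n = sym ((begin
    (1-e ⊛ 1-e) +ˢ (exp-1ˢ ⊛ exp-1ˢ)
      ≈⟨ +ˢ-cong expand (⊛-cong exp-1≗exp-one exp-1≗exp-one) ⟩
    ((constˢ 1ℚ +ˢ -ˢ e +ˢ -ˢ e) +ˢ ((constˢ (fromℕ 2) ⊛ expˢ) +ˢ -ˢ (expˢ ⊛ expˢ))) +ˢ
      ((expˢ +ˢ -ˢ constˢ 1ℚ) ⊛ (expˢ +ˢ -ˢ constˢ 1ℚ))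
      ≈⟨ solveˢ 2 (λ e x → ((conˢ 1ℚ :-ˢ e :-ˢ e) :+ˢ (conˢ (fromℕ 2) :*ˢ x :-ˢ x :*ˢ x)) :+ˢ
             (x :-ˢ conˢ 1ℚ) :*ˢ (x :-ˢ conˢ 1ℚ) :=ˢ (conˢ 1ℚ :-ˢ e) :+ˢ (conˢ 1ℚ :-ˢ e)) (λ _ → refl) e expˢ ⟩
    1-e +ˢ 1-e ∎) n)
    where
    open ≗-Reasoning
    expand : (1-e ⊛ 1-e) ≗ ((constˢ 1ℚ +ˢ -ˢ e +ˢ -ˢ e) +ˢ ((constˢ (fromℕ 2) ⊛ expˢ) +ˢ -ˢ (expˢ ⊛ expˢ)))
    expand = begin
      1-e ⊛ 1-e                               ≈⟨ solveˢ 1 (λ e → (conˢ 1ℚ :-ˢ e) :*ˢ (conˢ 1ℚ :-ˢ e) :=ˢ (conˢ 1ℚ :-ˢ e :-ˢ e) :+ˢ e :*ˢ e)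
                                                   (λ _ → refl) e ⟩
      (constˢ 1ℚ +ˢ -ˢ e +ˢ -ˢ e) +ˢ (e ⊛ e)  ≈⟨ +ˢ-congˡ (constˢ 1ℚ +ˢ -ˢ e +ˢ -ˢ e) e-square ⟩
      (constˢ 1ℚ +ˢ -ˢ e +ˢ -ˢ e) +ˢ ((constˢ (fromℕ 2) ⊛ expˢ) +ˢ -ˢ (expˢ ⊛ expˢ)) ∎

  1-e-quadratic-*ˢ : ∀ n → 1-e n + 1-e n ≡ (1-e *ˢ 1-e) n + (exp-1ˢ *ˢ exp-1ˢ) n
  1-e-quadratic-*ˢ n = trans (1-e-quadratic n) (cong₂ _+_ (⊛≗*ˢ 1-e 1-e n) (⊛≗*ˢ exp-1ˢ exp-1ˢ n))

  0≤double⇒0≤ : ∀ {p} → 0ℚ ≤ p + p → 0ℚ ≤ p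
  0≤double⇒0≤ {p} 0≤p+p = subst (0ℚ ≤_) (solve 1 (λ p → con ½ :* (p :+ p) := p) refl p)
    (0≤* (ℚ.<⇒≤ (ℚ.positive⁻¹ ½)) 0≤p+p)

  -- As g₀ = 0, the two products in (g²)ₙ that contain gₙ vanish. The quadratic relation thus
  -- expresses 2gₙ by lower coefficients and those of (eˣ - 1)², with plus signs only.
  1-e-nonNeg : ∀ n → 0ℚ ≤ 1-e n
  1-e-nonNeg = <-rec _ step
    where
    step : ∀ n → (∀ {k} → k ℕ.< n → 0ℚ ≤ 1-e k) → 0ℚ ≤ 1-e n
    step zero    rec = ℚ.≤-refl
    step (suc n) rec = 0≤double⇒0≤ (subst (0ℚ ≤_) (sym (1-e-quadratic-*ˢ (suc n)))
      (ℚ.+-mono-≤ (Σ-nonNeg (suc n) term) (Σ-nonNeg (suc n) λ k _ → 0≤* (exp-1-nonNeg k) (exp-1-nonNeg (suc n ∸ k)))))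
      where
      term : ∀ k → k ℕ.≤ suc n → 0ℚ ≤ 1-e k * 1-e (suc n ∸ k)
      term zero    _ = ℚ.≤-reflexive (sym (ℚ.*-zeroˡ (1-e (suc n))))
      term (suc k) k≤n = [ (λ k<n → 0≤* (rec k<n) (rec (ℕ.s≤s (ℕ.m∸n≤m n k))))
        , (λ k≡n → ℚ.≤-reflexive (sym (trans
            (cong (λ m → 1-e (suc k) * 1-e m) (ℕ.m≤n⇒m∸n≡0 (ℕ.≤-reflexive (ℕ.suc-injective (sym k≡n)))))
            (ℚ.*-zeroʳ (1-e (suc k))))))
        ]′ (ℕ.m≤n⇒m<n∨m≡n k≤n)

  Σ-*ˢ-powers : ∀ n a b R → Σ≤ n (λ k → (a *ˢ b) k * R ^ k) ≡
                            Σ≤ n (λ i → a i * R ^ i * Σ≤ (n ∸ i) (λ j → b j * R ^ j))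
  Σ-*ˢ-powers n a b R = trans (Σ-*ˢ n a b (R ^_)) (Σ-cong n λ i _ → trans
    (cong (a i *_) (trans
      (Σ-cong (n ∸ i) λ j _ → trans (cong (b j *_) (Pow.^-homo-* R i j))
        (solve 3 (λ x y z → x :* (y :* z) := y :* (x :* z)) refl (b j) (R ^ i) (R ^ j)))
      (Σ-*ˡ (n ∸ i) (R ^ i) (λ j → b j * R ^ j))))
    (sym (ℚ.*-assoc (a i) (R ^ i) (Σ≤ (n ∸ i) (λ j → b j * R ^ j)))))

  Σ-constˢ : ∀ n c (f : ℕ → ℚ) → Σ≤ n (λ k → constˢ c k * f k) ≡ c * f 0
  Σ-constˢ n c f = Σ-truncate {n = n} (λ k → constˢ c k * f k) ℕ.z≤n λ { (suc k) _ → ℚ.*-zeroˡ (f (suc k)) }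

  Σ-exp : ∀ n R → Σ≤ n (λ k → 1/ k ! * R ^ k) ≡ 1ℚ + Σ≤ n (λ k → exp-1ˢ k * R ^ k)
  Σ-exp n R = trans
    (Σ-cong n λ k _ → trans (cong (_* R ^ k) (split k)) (ℚ.*-distribʳ-+ (R ^ k) (constˢ 1ℚ k) (exp-1ˢ k)))
    (trans (Σ-+ n (λ k → constˢ 1ℚ k * R ^ k) (λ k → exp-1ˢ k * R ^ k))
      (cong (_+ Σ≤ n (λ k → exp-1ˢ k * R ^ k)) (Σ-constˢ n 1ℚ (R ^_))))
    where
    split : ∀ k → 1/ k ! ≡ constˢ 1ℚ k + exp-1ˢ k
    split zero    = refl
    split (suc k) = sym (ℚ.+-identityˡ (1/ suc k !))

  module _ {R ρ : ℚ} (0≤R : 0ℚ ≤ R) (ρ<1 : ρ < 1ℚ)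
           (exp-1-bound : ∀ n → Σ≤ n (λ k → exp-1ˢ k * R ^ k) ≤ ρ) where

    open ℚ.≤-Reasoning

    -- The partial sum up to degree 0 is 0.
    0≤ρ : 0ℚ ≤ ρ
    0≤ρ = exp-1-bound 0

    -- 2G ≤ ρG + ρ² forces G ≤ ρ.
    1-e-bound : ∀ n → Σ≤ n (λ k → 1-e k * R ^ k) ≤ ρ
    1-e-bound = <-rec _ step
      where
      G : ℕ → ℚ
      G n = Σ≤ n (λ k → 1-e k * R ^ k)
      U : ℕ → ℚ
      U n = Σ≤ n (λ k → exp-1ˢ k * R ^ k)
      step : ∀ n → (∀ {k} → k ℕ.< n → G k ≤ ρ) → G n ≤ ρ
      step zero    rec = 0≤ρ
      step n@(suc m) rec = *-cancelʳ-≤ 0<2-ρ (begin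
        G n * (fromℕ 2 - ρ)          ≡⟨ solve 2 (λ g r → g :* (con (fromℕ 2) :- r) := (g :+ g) :- g :* r) refl (G n) ρ ⟩
        (G n + G n) - G n * ρ        ≤⟨ ℚ.+-monoˡ-≤ (- (G n * ρ)) double ⟩
        (G n * ρ + ρ * ρ) - G n * ρ  ≡⟨ solve 2 (λ g r → (g :* r :+ r :* r) :- g :* r := r :* r) refl (G n) ρ ⟩
        ρ * ρ                        ≤⟨ *-monoˡ 0≤ρ (ℚ.≤-trans (ℚ.<⇒≤ ρ<1) 1≤2-ρ) ⟩
        ρ * (fromℕ 2 - ρ)            ∎)
        where
        1≤2-ρ : 1ℚ ≤ fromℕ 2 - ρ
        1≤2-ρ = subst (1ℚ ≤_) (solve 1 (λ r → con 1ℚ :+ (con 1ℚ :- r) := con (fromℕ 2) :- r) refl ρ)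
          (≤-+nonNeg 1ℚ (≤⇒0≤- (ℚ.<⇒≤ ρ<1)))
        0<2-ρ : 0ℚ < fromℕ 2 - ρ
        0<2-ρ = ℚ.<-≤-trans (ℚ.positive⁻¹ 1ℚ) 1≤2-ρ
        e-term : ∀ i → i ℕ.≤ n → 1-e i * R ^ i * G (n ∸ i) ≤ 1-e i * R ^ i * ρ
        -- For i = 0 the sum `G n` itself occurs, but with the factor g₀ = 0; all other terms fall
        -- under the induction hypothesis.
        e-term zero    _ = ℚ.≤-reflexive (trans (ℚ.*-zeroˡ (G n)) (sym (ℚ.*-zeroˡ ρ)))
        e-term (suc i) _ = *-monoˡ (0≤* (1-e-nonNeg (suc i)) (^-nonNeg (suc i) 0≤R)) (rec (ℕ.s≤s (ℕ.m∸n≤m m i)))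
        double : G n + G n ≤ G n * ρ + ρ * ρ
        double = begin
          G n + G n
            ≡⟨ Σ-+ n (λ k → 1-e k * R ^ k) (λ k → 1-e k * R ^ k) ⟨
          Σ≤ n (λ k → 1-e k * R ^ k + 1-e k * R ^ k)
            ≡⟨ Σ-cong n (λ k _ → trans (sym (ℚ.*-distribʳ-+ (R ^ k) (1-e k) (1-e k)))
                 (trans (cong (_* R ^ k) (1-e-quadratic-*ˢ k)) (ℚ.*-distribʳ-+ (R ^ k) ((1-e *ˢ 1-e) k) ((exp-1ˢ *ˢ exp-1ˢ) k)))) ⟩
          Σ≤ n (λ k → (1-e *ˢ 1-e) k * R ^ k + (exp-1ˢ *ˢ exp-1ˢ) k * R ^ k)
            ≡⟨ trans (Σ-+ n (λ k → (1-e *ˢ 1-e) k * R ^ k) (λ k → (exp-1ˢ *ˢ exp-1ˢ) k * R ^ k))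
                 (cong₂ _+_ (Σ-*ˢ-powers n 1-e 1-e R) (Σ-*ˢ-powers n exp-1ˢ exp-1ˢ R)) ⟩
          Σ≤ n (λ i → 1-e i * R ^ i * G (n ∸ i)) + Σ≤ n (λ i → exp-1ˢ i * R ^ i * U (n ∸ i))
            ≤⟨ ℚ.+-mono-≤ (Σ-mono n e-term) (Σ-mono n λ i _ →
                 *-monoˡ (0≤* (exp-1-nonNeg i) (^-nonNeg i 0≤R)) (exp-1-bound (n ∸ i))) ⟩
          Σ≤ n (λ i → 1-e i * R ^ i * ρ) + Σ≤ n (λ i → exp-1ˢ i * R ^ i * ρ)
            ≡⟨ cong₂ _+_ (Σ-*ʳ n ρ (λ i → 1-e i * R ^ i)) (Σ-*ʳ n ρ (λ i → exp-1ˢ i * R ^ i)) ⟩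
          G n * ρ + U n * ρ
            ≤⟨ ℚ.+-monoʳ-≤ (G n * ρ) (*-monoʳ 0≤ρ (exp-1-bound n)) ⟩
          G n * ρ + ρ * ρ ∎

    -- Beyond degree 0 the coefficients of e are those of -g, so their absolute values are the
    -- coefficients of g.
    majorant-e : ∀ n → majorant e R n ≤ 1ℚ + ρ
    majorant-e n = begin
      majorant e R n
        ≡⟨ Σ-cong n (λ k _ → trans (cong (_* R ^ k) (∣e∣ k)) (ℚ.*-distribʳ-+ (R ^ k) (constˢ 1ℚ k) (1-e k))) ⟩
      Σ≤ n (λ k → constˢ 1ℚ k * R ^ k + 1-e k * R ^ k)
        ≡⟨ trans (Σ-+ n (λ k → constˢ 1ℚ k * R ^ k) (λ k → 1-e k * R ^ k))
             (cong (_+ Σ≤ n (λ k → 1-e k * R ^ k)) (Σ-constˢ n 1ℚ (R ^_))) ⟩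
      1ℚ + Σ≤ n (λ k → 1-e k * R ^ k)
        ≤⟨ ℚ.+-monoʳ-≤ 1ℚ (1-e-bound n) ⟩
      1ℚ + ρ ∎
      where
      ∣e∣ : ∀ k → ∣ e k ∣ ≡ constˢ 1ℚ k + 1-e k
      ∣e∣ zero    = refl
      ∣e∣ (suc k) = trans (sym (ℚ.∣-p∣≡∣p∣ (e (suc k)))) (trans
        (ℚ.0≤p⇒∣p∣≡p (subst (0ℚ ≤_) (ℚ.+-identityˡ (- e (suc k))) (1-e-nonNeg (suc k))))
        (solve 1 (λ x → :- x := con 0ℚ :+ (con 0ℚ :- x)) refl (e (suc k))))

    majorant-exp : ∀ n → majorant 1/_! R n ≤ 1ℚ + ρ
    majorant-exp n = begin
      majorant 1/_! R n                      ≡⟨ Σ-cong n (λ k _ → cong (_* R ^ k) (ℚ.0≤p⇒∣p∣≡p (0≤1/! k))) ⟩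
      Σ≤ n (λ k → 1/ k ! * R ^ k)            ≡⟨ Σ-exp n R ⟩
      1ℚ + Σ≤ n (λ k → exp-1ˢ k * R ^ k)     ≤⟨ ℚ.+-monoʳ-≤ 1ℚ (exp-1-bound n) ⟩
      1ℚ + ρ                                 ∎

    -- The sum is 1 - Σ gₖ φₖ with gₖ ≥ 0, and Σ gₖ φₖ ≤ Σ gₖ Rᵏ ≤ ρ. With φ the real parts of the
    -- powers of x it keeps the real part of w away from 0.
    e-series-lower : ∀ {φ : ℕ → ℚ} → φ 0 ≡ 1ℚ → (∀ k → ∣ φ k ∣ ≤ R ^ k) →
                     ∀ n → 1ℚ - ρ ≤ Σ≤ n (λ k → e k * φ k)
    e-series-lower {φ} φ₀ φ≤ n = begin
      1ℚ - ρ
        ≤⟨ ℚ.+-monoʳ-≤ 1ℚ (ℚ.neg-antimono-≤ (ℚ.≤-trans (Σ-mono n λ k _ →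
             *-monoˡ (1-e-nonNeg k) (ℚ.≤-trans (p≤∣p∣ (φ k)) (φ≤ k))) (1-e-bound n))) ⟩
      1ℚ - Σ≤ n (λ k → 1-e k * φ k)
        ≡⟨ cong (λ s → 1ℚ * s - Σ≤ n (λ k → 1-e k * φ k)) φ₀ ⟨
      1ℚ * φ 0 - Σ≤ n (λ k → 1-e k * φ k)
        ≡⟨ cong₂ _+_ (sym (Σ-constˢ n 1ℚ φ)) (sym (Σ-neg n (λ k → 1-e k * φ k))) ⟩
      Σ≤ n (λ k → constˢ 1ℚ k * φ k) + Σ≤ n (λ k → - (1-e k * φ k))
        ≡⟨ Σ-+ n (λ k → constˢ 1ℚ k * φ k) (λ k → - (1-e k * φ k)) ⟨
      Σ≤ n (λ k → constˢ 1ℚ k * φ k - 1-e k * φ k)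
        ≡⟨ Σ-cong n (λ k _ → solve 3 (λ c x f → c :* f :- (c :- x) :* f := x :* f) refl (constˢ 1ℚ k) (e k) (φ k)) ⟩
      Σ≤ n (λ k → e k * φ k) ∎

-- Powers, partial sums and moduli at a fixed rational stage.

module ComplexSeries where

  open Prelude
  open RationalOrder
  open +-*-Solver using (solve; _:=_; _:+_; _:*_; _:-_; :-_; con)

  quarter : ℚ → ℚ
  quarter ε = ε * ½ * ½

  0<quarter : ∀ {ε} → 0ℚ < ε → 0ℚ < quarter ε
  0<quarter 0<ε = 0<* (0<* 0<ε (ℚ.positive⁻¹ ½)) (ℚ.positive⁻¹ ½)

  4*quarter : ∀ ε → quarter ε + quarter ε + quarter ε + quarter ε ≡ ε
  4*quarter = solve 1 (λ ε → let q = ε :* con ½ :* con ½ in q :+ q :+ q :+ q := ε) refl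

  3*quarter< : ∀ {ε} → 0ℚ < ε → quarter ε + quarter ε + quarter ε < ε
  3*quarter< {ε} 0<ε = subst (quarter ε + quarter ε + quarter ε <_) (4*quarter ε)
    (<-+pos (quarter ε + quarter ε + quarter ε) (0<quarter 0<ε))

  module _ (x : ℂ) where

    -- Multiplication is termwise, so at stage m these are exactly the parts of the k-th power of
    -- one Gaussian rational; this is why `power-+` is an equality of rationals.
    reᵖ imᵖ : ℕ → ℕ → ℚ
    reᵖ m k = seq (re (x ^ᶜ k)) m
    imᵖ m k = seq (im (x ^ᶜ k)) m

    power-+ : ∀ m i j → reᵖ m (i ℕ.+ j) ≡ reᵖ m i * reᵖ m j - imᵖ m i * imᵖ m j ×
                        imᵖ m (i ℕ.+ j) ≡ reᵖ m i * imᵖ m j + imᵖ m i * reᵖ m j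
    power-+ m zero    j =
      solve 2 (λ p q → p := con 1ℚ :* p :- con 0ℚ :* q) refl (reᵖ m j) (imᵖ m j) ,
      solve 2 (λ p q → q := con 1ℚ :* q :+ con 0ℚ :* p) refl (reᵖ m j) (imᵖ m j)
    power-+ m (suc i) j with power-+ m i j
    ... | re≡ , im≡ =
      trans (cong₂ (λ p q → a * p - b * q) re≡ im≡)
        (solve 6 (λ a b p q u v → a :* (p :* u :- q :* v) :- b :* (p :* v :+ q :* u)
           := (a :* p :- b :* q) :* u :- (a :* q :+ b :* p) :* v) refl
          a b (reᵖ m i) (imᵖ m i) (reᵖ m j) (imᵖ m j)) ,
      trans (cong₂ (λ p q → a * q + b * p) re≡ im≡)
        (solve 6 (λ a b p q u v → a :* (p :* v :+ q :* u) :+ b :* (p :* u :- q :* v)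
           := (a :* p :- b :* q) :* v :+ (a :* q :+ b :* p) :* u) refl
          a b (reᵖ m i) (imᵖ m i) (reᵖ m j) (imᵖ m j))
      where
      a b : ℚ
      a = seq (re x) m
      b = seq (im x) m

    module _ {r : ℚ} (0≤r : 0ℚ ≤ r) {m : ℕ}
             (inside : seq (re x) m * seq (re x) m + seq (im x) m * seq (im x) m ≤ r * r) where

      private
        norm : ℕ → ℚ
        norm k = reᵖ m k * reᵖ m k + imᵖ m k * imᵖ m k

        -- The squared modulus is multiplicative; working with squares keeps the estimate rational.
        norm≤ : ∀ k → norm k ≤ r ^ k * r ^ k
        norm≤ zero    = ℚ.≤-refl
        norm≤ (suc k) = begin
          norm (suc k)
            ≡⟨ solve 4 (λ a b p q → (a :* p :- b :* q) :* (a :* p :- b :* q) :+ (a :* q :+ b :* p) :* (a :* q :+ b :* p)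
                 := (a :* a :+ b :* b) :* (p :* p :+ q :* q)) refl (seq (re x) m) (seq (im x) m) (reᵖ m k) (imᵖ m k) ⟩
          (seq (re x) m * seq (re x) m + seq (im x) m * seq (im x) m) * norm k
            ≤⟨ *-mono-≤ (ℚ.+-mono-≤ (square-nonNeg (seq (re x) m)) (square-nonNeg (seq (im x) m)))
                 (square-nonNeg (r ^ k)) inside (norm≤ k) ⟩
          r * r * (r ^ k * r ^ k)
            ≡⟨ solve 2 (λ r s → r :* r :* (s :* s) := r :* s :* (r :* s)) refl r (r ^ k) ⟩
          r ^ suc k * r ^ suc k ∎
          where open ℚ.≤-Reasoning

      reᵖ-bound : ∀ k → ∣ reᵖ m k ∣ ≤ r ^ k
      reᵖ-bound k = square-cancel-∣∣ (^-nonNeg k 0≤r)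
        (ℚ.≤-trans (≤-+nonNeg (reᵖ m k * reᵖ m k) (square-nonNeg (imᵖ m k))) (norm≤ k))

      imᵖ-bound : ∀ k → ∣ imᵖ m k ∣ ≤ r ^ k
      imᵖ-bound k = square-cancel-∣∣ (^-nonNeg k 0≤r)
        (ℚ.≤-trans (≤-+nonNeg (imᵖ m k * imᵖ m k) (square-nonNeg (reᵖ m k)))
          (ℚ.≤-trans (ℚ.≤-reflexive (ℚ.+-comm (imᵖ m k * imᵖ m k) (reᵖ m k * reᵖ m k))) (norm≤ k)))

    partialSumᵖ : FPS → ℕ → ℂ
    partialSumᵖ c = partialSum (λ k → ratᶜ (c k) *ᶜ x ^ᶜ k)

    partialSum-re : ∀ c n m → seq (re (partialSumᵖ c n)) m ≡ Σ≤ n (λ k → c k * reᵖ m k)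
    partialSum-re c n m = go n
      where
      term : ∀ k → c k * reᵖ m k - 0ℚ * imᵖ m k ≡ c k * reᵖ m k
      term k = solve 2 (λ p q → p :- con 0ℚ :* q := p) refl (c k * reᵖ m k) (imᵖ m k)
      go : ∀ n → seq (re (partialSumᵖ c n)) m ≡ Σ≤ n (λ k → c k * reᵖ m k)
      go zero    = term 0
      go (suc n) = cong₂ _+_ (go n) (term (suc n))

    partialSum-im : ∀ c n m → seq (im (partialSumᵖ c n)) m ≡ Σ≤ n (λ k → c k * imᵖ m k)
    partialSum-im c n m = go n
      where
      term : ∀ k → c k * imᵖ m k + 0ℚ * reᵖ m k ≡ c k * imᵖ m k
      term k = solve 2 (λ p q → p :+ con 0ℚ :* q := p) refl (c k * imᵖ m k) (reᵖ m k)
      go : ∀ n → seq (im (partialSumᵖ c n)) m ≡ Σ≤ n (λ k → c k * imᵖ m k)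
      go zero    = term 0
      go (suc n) = cong₂ _+_ (go n) (term (suc n))

  -- Here `P n m` stands for the n-th partial sum at the m-th approximation of the point. One `K`
  -- serves all late stages m at once.
  UniformlyCauchy : (ℕ → ℕ → ℚ) → Set
  UniformlyCauchy P = ∀ ε → 0ℚ < ε →
    ∃[ K ] ∀ k n m → K ℕ.≤ k → k ℕ.≤ n → K ℕ.≤ m → ∣ P n m - P k m ∣ ≤ ε

  -- Two diagonal entries are compared through row K: uniformity controls the moves into and out of
  -- that row, and the row is a fixed Cauchy sequence.
  diagonal-cauchy : ∀ (P : ℕ → ℕ → ℚ) → (∀ k → Cauchy (P k)) → UniformlyCauchy P → Cauchy (λ n → P n n)
  diagonal-cauchy P cauchyₚ uniform ε 0<ε with uniform (quarter ε) (0<quarter 0<ε)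
  ... | K , close with cauchyₚ K (quarter ε) (0<quarter 0<ε)
  ... | N , pointwise = K ℕ.⊔ N , λ m n N≤m N≤n →
    let K≤m = ℕ.m⊔n≤o⇒m≤o K N N≤m ; K≤n = ℕ.m⊔n≤o⇒m≤o K N N≤n in begin-strict
      ∣ P m m - P n n ∣
        ≡⟨ cong ∣_∣ (solve 4 (λ a b c d → a :- d := ((a :- b) :+ (b :- c)) :- (d :- c)) refl
             (P m m) (P K m) (P K n) (P n n)) ⟩
      ∣ ((P m m - P K m) + (P K m - P K n)) - (P n n - P K n) ∣
        ≤⟨ ℚ.∣p-q∣≤∣p∣+∣q∣ ((P m m - P K m) + (P K m - P K n)) (P n n - P K n) ⟩
      ∣ (P m m - P K m) + (P K m - P K n) ∣ + ∣ P n n - P K n ∣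
        ≤⟨ ℚ.+-monoˡ-≤ ∣ P n n - P K n ∣ (ℚ.∣p+q∣≤∣p∣+∣q∣ (P m m - P K m) (P K m - P K n)) ⟩
      ∣ P m m - P K m ∣ + ∣ P K m - P K n ∣ + ∣ P n n - P K n ∣
        ≤⟨ ℚ.+-mono-≤ (ℚ.+-mono-≤ (close K m m ℕ.≤-refl K≤m K≤m)
             (ℚ.<⇒≤ (pointwise m n (ℕ.m⊔n≤o⇒n≤o K N N≤m) (ℕ.m⊔n≤o⇒n≤o K N N≤n))))
             (close K n n ℕ.≤-refl K≤n K≤n) ⟩
      quarter ε + quarter ε + quarter ε
        <⟨ 3*quarter< 0<ε ⟩
      ε ∎
    where open ℚ.≤-Reasoning

  modulus-nonNeg : ∀ z m → 0ℚ ≤ seq Defs.∣ z ∣ m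
  modulus-nonNeg z m = approxSqrt-nonNeg ((seq (re z) m * seq (re z) m + seq (im z) m * seq (im z) m) ℚ.⊔ 0ℚ) m

  -- The approximate square root falls short of the true one by less than `mesh m`, hence the extra
  -- summand.
  modulus-upper : ∀ z m → ∣ seq (re z) m ∣ ≤ seq Defs.∣ z ∣ m + mesh m ×
                          seq (re z) m * seq (re z) m + seq (im z) m * seq (im z) m ≤
                          (seq Defs.∣ z ∣ m + mesh m) * (seq Defs.∣ z ∣ m + mesh m)
  modulus-upper z m = square-cancel-∣∣ 0≤b (ℚ.≤-trans (≤-+nonNeg (u * u) (square-nonNeg v)) q≤) , q≤
    where
    u v b : ℚ
    u = seq (re z) m
    v = seq (im z) m
    b = seq Defs.∣ z ∣ m + mesh m
    0≤b : 0ℚ ≤ b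
    0≤b = ℚ.+-mono-≤ (modulus-nonNeg z m) (ℚ.<⇒≤ (ℚ.positive⁻¹ (mesh m)))
    q≤ : u * u + v * v ≤ b * b
    q≤ = ℚ.≤-trans (ℚ.p≤p⊔q (u * u + v * v) 0ℚ) (ℚ.<⇒≤ (approxSqrt-upper ((u * u + v * v) ℚ.⊔ 0ℚ) m))

  -- With η = ε/4, two parts of size η give a modulus of at most 2η, and `_<_` on reals asks for a
  -- rational gap, taken as another η; this leaves 3η < ε.
  modulus-small : ∀ z ε → 0ℚ < ε → ∀ N →
    (∀ m → N ℕ.≤ m → ∣ seq (re z) m ∣ ≤ quarter ε × ∣ seq (im z) m ∣ ≤ quarter ε) →
    Defs.∣ z ∣ Defs.< fromℚ ε
  modulus-small z ε 0<ε N small = η , 0<η , N , λ m N≤m →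
    ℚ.≤-<-trans (ℚ.+-monoˡ-≤ η (bound m (small m N≤m))) (3*quarter< 0<ε)
    where
    open ℚ.≤-Reasoning
    η : ℚ
    η = quarter ε
    0<η : 0ℚ < η
    0<η = 0<quarter 0<ε
    0≤η : 0ℚ ≤ η
    0≤η = ℚ.<⇒≤ 0<η
    square≤ : ∀ {u} → ∣ u ∣ ≤ η → u * u ≤ η * η
    square≤ {u} u≤η = subst (_≤ η * η) (∣p∣*∣p∣ u) (*-mono-≤ (ℚ.0≤∣p∣ u) 0≤η u≤η u≤η)
    bound : ∀ m → ∣ seq (re z) m ∣ ≤ η × ∣ seq (im z) m ∣ ≤ η → seq Defs.∣ z ∣ m ≤ η + η
    bound m (u≤η , v≤η) = square-cancel-≤ (ℚ.+-mono-≤ 0≤η 0≤η) (begin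
      seq Defs.∣ z ∣ m * seq Defs.∣ z ∣ m  ≤⟨ approxSqrt-lower (q ℚ.⊔ 0ℚ) m (ℚ.p≤q⊔p q 0ℚ) ⟩
      q ℚ.⊔ 0ℚ                             ≤⟨ ℚ.⊔-lub q≤ (0≤* (ℚ.+-mono-≤ 0≤η 0≤η) (ℚ.+-mono-≤ 0≤η 0≤η)) ⟩
      (η + η) * (η + η)                    ∎)
      where
      u v q : ℚ
      u = seq (re z) m
      v = seq (im z) m
      q = u * u + v * v
      q≤ : q ≤ (η + η) * (η + η)
      q≤ = begin
        u * u + v * v                      ≤⟨ ℚ.+-mono-≤ (square≤ u≤η) (square≤ v≤η) ⟩
        η * η + η * η                      ≤⟨ ≤-+nonNeg (η * η + η * η) (ℚ.+-mono-≤ (0≤* 0≤η 0≤η) (0≤* 0≤η 0≤η)) ⟩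
        (η * η + η * η) + (η * η + η * η)  ≡⟨ solve 1 (λ e → (e :* e :+ e :* e) :+ (e :* e :+ e :* e) := (e :+ e) :* (e :+ e)) refl η ⟩
        (η + η) * (η + η)                  ∎

-- Limits of the two series and the equation w² = eˣ (2 - eˣ).

module SeriesLimits where

  open Prelude
  open FiniteSums
  open FormalPowerSeries
  open CoefficientIdentities
  open RationalOrder
  open PowerSeriesEstimates
  open CoefficientBounds
  open ComplexSeries
  open import Data.Sum.Base using (inj₁)
  open +-*-Solver using (solve; _:=_; _:+_; _:*_; _:-_; :-_; con)

  ∣p-q∣≡∣q-p∣ : ∀ p q → ∣ p - q ∣ ≡ ∣ q - p ∣
  ∣p-q∣≡∣q-p∣ p q = trans (sym (ℚ.∣-p∣≡∣p∣ (p - q)))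
    (cong ∣_∣ (solve 2 (λ p q → :- (p :- q) := q :- p) refl p q))

  -- `W` and `X` play the squares of the limits of the series of e and exp, `Y` and `Z` the partial
  -- sums of the Cauchy squares, and `L` is 2eˣ. The coefficient identity enters only as Y = L - Z.
  squares-close : ∀ {t C} → 0ℚ ≤ t → t < 1ℚ → 0ℚ < C → ∀ (W X L Y Z : ℕ → ℚ) {from} →
    (∀ n → from ℕ.≤ n → ∣ W n - Y n ∣ ≤ t ^ n * C) →
    (∀ n → from ℕ.≤ n → ∣ X n - Z n ∣ ≤ t ^ n * C) →
    (∀ n → Y n ≡ L n - Z n) →
    ∀ ε → 0ℚ < ε → ∃[ N ] ∀ n → N ℕ.≤ n → ∣ W n - (L n - X n) ∣ < ε
  squares-close {t} {C} 0≤t t<1 0<C W X L Y Z {from} W≈Y X≈Z Y≡L-Z ε 0<ε = N ℕ.⊔ from , λ n N≤n →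
    let N≤ = ℕ.m⊔n≤o⇒m≤o N from N≤n ; from≤ = ℕ.m⊔n≤o⇒n≤o N from N≤n in begin-strict
      ∣ W n - (L n - X n) ∣                 ≡⟨ cong ∣_∣ (solve 4 (λ w l x z → w :- (l :- x) := (w :- (l :- z)) :+ (x :- z)) refl
                                                 (W n) (L n) (X n) (Z n)) ⟩
      ∣ (W n - (L n - Z n)) + (X n - Z n) ∣ ≡⟨ cong (λ y → ∣ (W n - y) + (X n - Z n) ∣) (Y≡L-Z n) ⟨
      ∣ (W n - Y n) + (X n - Z n) ∣         ≤⟨ ℚ.∣p+q∣≤∣p∣+∣q∣ (W n - Y n) (X n - Z n) ⟩
      ∣ W n - Y n ∣ + ∣ X n - Z n ∣         ≤⟨ ℚ.+-mono-≤ (ℚ.≤-trans (W≈Y n from≤) (decay n N≤))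
                                                 (ℚ.≤-trans (X≈Z n from≤) (decay n N≤)) ⟩
      quarter ε + quarter ε                 ≤⟨ ≤-+nonNeg (quarter ε + quarter ε) (ℚ.<⇒≤ (0<quarter 0<ε)) ⟩
      quarter ε + quarter ε + quarter ε     <⟨ 3*quarter< 0<ε ⟩
      ε                                     ∎
    where
    open ℚ.≤-Reasoning
    small : ∃[ N ] ∀ n → N ℕ.≤ n → t ^ n * C ≤ quarter ε
    small = geometric-decay 0≤t t<1 0<C (quarter ε) (0<quarter 0<ε)
    N : ℕ
    N = proj₁ small
    decay : ∀ n → N ℕ.≤ n → t ^ n * C ≤ quarter ε
    decay = proj₂ small

  quadratic-re : ∀ u n → fromℕ 2 * seq (re u) n - seq (re (u *ᶜ u)) n ≡ seq (re (u *ᶜ (ratᶜ (fromℕ 2) -ᶜ u))) n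
  quadratic-re u n = solve 3 (λ c a b → c :* a :- (a :* a :- b :* b) := a :* (c :- a) :- b :* (con 0ℚ :- b)) refl
    (fromℕ 2) (seq (re u) n) (seq (im u) n)

  quadratic-im : ∀ u n → fromℕ 2 * seq (im u) n - seq (im (u *ᶜ u)) n ≡ seq (im (u *ᶜ (ratᶜ (fromℕ 2) -ᶜ u))) n
  quadratic-im u n = solve 3 (λ c a b → c :* b :- (a :* b :+ b :* a) := a :* (con 0ℚ :- b) :+ b :* (c :- a)) refl
    (fromℕ 2) (seq (re u) n) (seq (im u) n)

  ≈-intro : ∀ u v (X : ℕ → ℚ) → (∀ n → X n ≡ seq v n) →
    (∀ ε → 0ℚ < ε → ∃[ N ] ∀ n → N ℕ.≤ n → ∣ seq u n - X n ∣ < ε) → u Defs.≈ v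
  ≈-intro u v X X≡v close ε 0<ε = proj₁ (close ε 0<ε) , λ n N≤n →
    subst (λ q → ∣ seq u n - q ∣ < ε) (X≡v n) (proj₂ (close ε 0<ε) n N≤n)

  -- Eventually |x| ≤ t R with t < 1.
  record InnerDisk (x : ℂ) (t R : ℚ) : Set where
    field
      0≤t    : 0ℚ ≤ t
      t<1    : t < 1ℚ
      0≤R    : 0ℚ ≤ R
      from  : ℕ
      inside : ∀ m → from ℕ.≤ m →
        seq (re x) m * seq (re x) m + seq (im x) m * seq (im x) m ≤ t * R * (t * R)

    t≤1 : t ≤ 1ℚ
    t≤1 = ℚ.<⇒≤ t<1

    0≤tR : 0ℚ ≤ t * R
    0≤tR = 0≤* 0≤t 0≤R

  module _ {x : ℂ} {t R : ℚ} (disk : InnerDisk x t R) where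
    open InnerDisk disk

    module Limit (c : FPS) {A : ℚ} (0<A : 0ℚ < A) (bound : ∀ n → majorant c R n ≤ A) where

      private
        P Q : ℕ → ℕ → ℚ
        P n = seq (re (partialSumᵖ x c n))
        Q n = seq (im (partialSumᵖ x c n))

        uniform : (P : ℕ → ℕ → ℚ) (φ : ℕ → ℕ → ℚ) → (∀ n m → P n m ≡ Σ≤ n (λ k → c k * φ m k)) →
          (∀ m → from ℕ.≤ m → ∀ k → ∣ φ m k ∣ ≤ (t * R) ^ k) → UniformlyCauchy P
        uniform P φ P≡ φ≤ ε 0<ε = N ℕ.⊔ from , λ k n m N≤k k≤n N≤m → ℚ.≤-trans
          (subst₂ (λ p q → ∣ p - q ∣ ≤ t ^ k * A) (sym (P≡ n m)) (sym (P≡ k m))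
            (power-series-tail 0≤t t≤1 0≤R (φ≤ m (ℕ.m⊔n≤o⇒n≤o N from N≤m)) {a = c} bound k≤n))
          (proj₂ small k (ℕ.m⊔n≤o⇒m≤o N from N≤k))
          where
          small : ∃[ N ] ∀ n → N ℕ.≤ n → t ^ n * A ≤ ε
          small = geometric-decay 0≤t t<1 0<A ε 0<ε
          N : ℕ
          N = proj₁ small

        uniformʳ : UniformlyCauchy P
        uniformʳ = uniform P (reᵖ x) (partialSum-re x c) λ m from≤m → reᵖ-bound x 0≤tR {m} (inside m from≤m)

        uniformⁱ : UniformlyCauchy Q
        uniformⁱ = uniform Q (imᵖ x) (partialSum-im x c) λ m from≤m → imᵖ-bound x 0≤tR {m} (inside m from≤m)

      -- The n-th rational approximation of the limit is the n-th partial sum at the n-th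
      -- approximation of x; this converges because the partial sums do so uniformly.
      opaque
        limit : ℂ
        limit = mkℝ (λ n → P n n) (diagonal-cauchy P (λ n → cauchy (re (partialSumᵖ x c n))) uniformʳ)
             +i mkℝ (λ n → Q n n) (diagonal-cauchy Q (λ n → cauchy (im (partialSumᵖ x c n))) uniformⁱ)

        -- At stage m ≥ n the difference is that of the partial sums of orders n and m at the same
        -- approximation of x, to which the uniform estimate applies.
        limit-sum : PowerSeries c x limit
        limit-sum ε 0<ε = K ℕ.⊔ K′ , λ n K≤n → modulus-small (partialSumᵖ x c n -ᶜ limit) ε 0<ε n λ m n≤m →
            (let K≤ = ℕ.m⊔n≤o⇒m≤o K K′ K≤n in
              subst (_≤ quarter ε) (∣p-q∣≡∣q-p∣ (P m m) (P n m)) (proj₂ U n m m K≤ n≤m (ℕ.≤-trans K≤ n≤m))) ,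
            (let K≤ = ℕ.m⊔n≤o⇒n≤o K K′ K≤n in
              subst (_≤ quarter ε) (∣p-q∣≡∣q-p∣ (Q m m) (Q n m)) (proj₂ V n m m K≤ n≤m (ℕ.≤-trans K≤ n≤m)))
          where
          U : ∃[ K ] ∀ k n m → K ℕ.≤ k → k ℕ.≤ n → K ℕ.≤ m → ∣ P n m - P k m ∣ ≤ quarter ε
          U = uniformʳ (quarter ε) (0<quarter 0<ε)
          V : ∃[ K ] ∀ k n m → K ℕ.≤ k → k ℕ.≤ n → K ℕ.≤ m → ∣ Q n m - Q k m ∣ ≤ quarter ε
          V = uniformⁱ (quarter ε) (0<quarter 0<ε)
          K K′ : ℕ
          K = proj₁ U
          K′ = proj₁ V

        limit-re : ∀ n → seq (re limit) n ≡ Σ≤ n (λ k → c k * reᵖ x n k)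
        limit-re n = partialSum-re x c n n

        limit-im : ∀ n → seq (im limit) n ≡ Σ≤ n (λ k → c k * imᵖ x n k)
        limit-im n = partialSum-im x c n n

      private
        Σ-bilinear : ∀ n (φ ψ : ℕ → ℚ) p q →
          Σ≤ n (λ k → c k * (φ k * p + ψ k * q)) ≡ Σ≤ n (λ k → c k * φ k) * p + Σ≤ n (λ k → c k * ψ k) * q
        Σ-bilinear n φ ψ p q = trans
          (Σ-cong n λ k _ → solve 5 (λ c f g p q → c :* (f :* p :+ g :* q) := c :* f :* p :+ c :* g :* q) refl
            (c k) (φ k) (ψ k) p q)
          (trans (Σ-+ n (λ k → c k * φ k * p) (λ k → c k * ψ k * q))
            (cong₂ _+_ (Σ-*ʳ n p (λ k → c k * φ k)) (Σ-*ʳ n q (λ k → c k * ψ k))))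

      -- At stage n the limit is a finite sum at a single Gaussian rational, so by `power-+` its
      -- square is the double sum over i, j ≤ n treated in `cauchy-product-error`.
      square-re-error : ∀ n → from ℕ.≤ n →
        ∣ seq (re (limit *ᶜ limit)) n - Σ≤ n (λ k → (c *ˢ c) k * reᵖ x n k) ∣ ≤ t ^ n * (A * A)
      square-re-error n from≤n = subst (λ s → ∣ s - Σ≤ n (λ k → (c *ˢ c) k * φ k) ∣ ≤ t ^ n * (A * A)) double
        (cauchy-product-error 0≤t t≤1 0≤R (reᵖ-bound x 0≤tR {n} (inside n from≤n)) {a = c} {b = c} (ℚ.<⇒≤ 0<A) bound bound n)
        where
        open ≡-Reasoning
        φ ψ : ℕ → ℚ
        φ = reᵖ x n
        ψ = imᵖ x n
        p q : ℚ
        p = Σ≤ n (λ k → c k * φ k)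
        q = Σ≤ n (λ k → c k * ψ k)
        double : Σ≤ n (λ i → c i * Σ≤ n (λ j → c j * φ (i ℕ.+ j))) ≡ seq (re (limit *ᶜ limit)) n
        double = begin
          Σ≤ n (λ i → c i * Σ≤ n (λ j → c j * φ (i ℕ.+ j)))
            ≡⟨ Σ-cong n (λ i _ → cong (c i *_) (trans
                 (Σ-cong n λ j _ → cong (c j *_) (trans (proj₁ (power-+ x n i j))
                   (solve 4 (λ a b u v → a :* u :- b :* v := u :* a :+ v :* (:- b)) refl (φ i) (ψ i) (φ j) (ψ j))))
                 (Σ-bilinear n φ ψ (φ i) (- ψ i)))) ⟩
          Σ≤ n (λ i → c i * (p * φ i + q * - ψ i))
            ≡⟨ Σ-cong n (λ i _ → cong (c i *_) (solve 4 (λ p q a b → p :* a :+ q :* (:- b) := a :* p :+ b :* (:- q)) refl p q (φ i) (ψ i))) ⟩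
          Σ≤ n (λ i → c i * (φ i * p + ψ i * - q))
            ≡⟨ Σ-bilinear n φ ψ p (- q) ⟩
          p * p + q * - q
            ≡⟨ cong (p * p +_) (ℚ.neg-distribʳ-* q q) ⟨
          p * p - q * q
            ≡⟨ cong₂ (λ u v → u * u - v * v) (limit-re n) (limit-im n) ⟨
          seq (re (limit *ᶜ limit)) n ∎

      square-im-error : ∀ n → from ℕ.≤ n →
        ∣ seq (im (limit *ᶜ limit)) n - Σ≤ n (λ k → (c *ˢ c) k * imᵖ x n k) ∣ ≤ t ^ n * (A * A)
      square-im-error n from≤n = subst (λ s → ∣ s - Σ≤ n (λ k → (c *ˢ c) k * ψ k) ∣ ≤ t ^ n * (A * A)) double
        (cauchy-product-error 0≤t t≤1 0≤R (imᵖ-bound x 0≤tR {n} (inside n from≤n)) {a = c} {b = c} (ℚ.<⇒≤ 0<A) bound bound n)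
        where
        open ≡-Reasoning
        φ ψ : ℕ → ℚ
        φ = reᵖ x n
        ψ = imᵖ x n
        p q : ℚ
        p = Σ≤ n (λ k → c k * φ k)
        q = Σ≤ n (λ k → c k * ψ k)
        double : Σ≤ n (λ i → c i * Σ≤ n (λ j → c j * ψ (i ℕ.+ j))) ≡ seq (im (limit *ᶜ limit)) n
        double = begin
          Σ≤ n (λ i → c i * Σ≤ n (λ j → c j * ψ (i ℕ.+ j)))
            ≡⟨ Σ-cong n (λ i _ → cong (c i *_) (trans
                 (Σ-cong n λ j _ → cong (c j *_) (trans (proj₂ (power-+ x n i j))
                   (solve 4 (λ a b u v → a :* v :+ b :* u := u :* b :+ v :* a) refl (φ i) (ψ i) (φ j) (ψ j))))
                 (Σ-bilinear n φ ψ (ψ i) (φ i)))) ⟩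
          Σ≤ n (λ i → c i * (p * ψ i + q * φ i))
            ≡⟨ Σ-cong n (λ i _ → cong (c i *_) (solve 4 (λ p q a b → p :* b :+ q :* a := a :* q :+ b :* p) refl p q (φ i) (ψ i))) ⟩
          Σ≤ n (λ i → c i * (φ i * q + ψ i * p))
            ≡⟨ Σ-bilinear n φ ψ q p ⟩
          p * q + q * p
            ≡⟨ cong₂ (λ u v → u * v + v * u) (limit-re n) (limit-im n) ⟨
          seq (im (limit *ᶜ limit)) n ∎

    module Solution {ρ : ℚ} (ρ<1 : ρ < 1ℚ) (exp-1-bound : ∀ n → Σ≤ n (λ k → exp-1ˢ k * R ^ k) ≤ ρ) where

      private
        0<1+ρ : 0ℚ < 1ℚ + ρ
        0<1+ρ = ℚ.<-≤-trans (ℚ.positive⁻¹ 1ℚ) (≤-+nonNeg 1ℚ (0≤ρ 0≤R ρ<1 exp-1-bound))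

        module Exp = Limit 1/_! 0<1+ρ (majorant-exp 0≤R ρ<1 exp-1-bound)
        module Root = Limit e 0<1+ρ (majorant-e 0≤R ρ<1 exp-1-bound)

      open Exp using () renaming (limit to eˣ)
      open Root using () renaming (limit to w)

      private
        e-square-*ˢ : ∀ k → (e *ˢ e) k ≡ fromℕ 2 * expˢ k - (expˢ *ˢ expˢ) k
        e-square-*ˢ k = trans (sym (⊛≗*ˢ e e k)) (trans (e-square k)
          (cong₂ _-_ (constˢ-⊛ (fromℕ 2) expˢ k) (⊛≗*ˢ expˢ expˢ k)))

        Σ-e-square : ∀ n (φ : ℕ → ℚ) → Σ≤ n (λ k → (e *ˢ e) k * φ k) ≡
          fromℕ 2 * Σ≤ n (λ k → expˢ k * φ k) - Σ≤ n (λ k → (expˢ *ˢ expˢ) k * φ k)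
        Σ-e-square n φ = trans
          (Σ-cong n λ k _ → trans (cong (_* φ k) (e-square-*ˢ k))
            (solve 4 (λ a x y f → (a :* x :- y) :* f := a :* (x :* f) :+ :- (y :* f)) refl
              (fromℕ 2) (expˢ k) ((expˢ *ˢ expˢ) k) (φ k)))
          (trans (Σ-+ n (λ k → fromℕ 2 * (expˢ k * φ k)) (λ k → - ((expˢ *ˢ expˢ) k * φ k)))
            (cong₂ _+_ (Σ-*ˡ n (fromℕ 2) (λ k → expˢ k * φ k)) (Σ-neg n (λ k → (expˢ *ˢ expˢ) k * φ k))))

      re-square : re (w *ᶜ w) Defs.≈ re (eˣ *ᶜ (ratᶜ (fromℕ 2) -ᶜ eˣ))
      re-square = ≈-intro (re (w *ᶜ w)) (re (eˣ *ᶜ (ratᶜ (fromℕ 2) -ᶜ eˣ))) (λ n → L n - X n) (quadratic-re eˣ)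
        (squares-close 0≤t t<1 (0<* 0<1+ρ 0<1+ρ) W X L Y Z Root.square-re-error Exp.square-re-error Y≡L-Z)
        where
        W X L Y Z : ℕ → ℚ
        W n = seq (re (w *ᶜ w)) n
        X n = seq (re (eˣ *ᶜ eˣ)) n
        L n = fromℕ 2 * seq (re eˣ) n
        Y n = Σ≤ n (λ k → (e *ˢ e) k * reᵖ x n k)
        Z n = Σ≤ n (λ k → (expˢ *ˢ expˢ) k * reᵖ x n k)
        Y≡L-Z : ∀ n → Y n ≡ L n - Z n
        Y≡L-Z n = trans (Σ-e-square n (reᵖ x n)) (cong (λ s → fromℕ 2 * s - Z n) (sym (Exp.limit-re n)))

      im-square : im (w *ᶜ w) Defs.≈ im (eˣ *ᶜ (ratᶜ (fromℕ 2) -ᶜ eˣ))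
      im-square = ≈-intro (im (w *ᶜ w)) (im (eˣ *ᶜ (ratᶜ (fromℕ 2) -ᶜ eˣ))) (λ n → L n - X n) (quadratic-im eˣ)
        (squares-close 0≤t t<1 (0<* 0<1+ρ 0<1+ρ) W X L Y Z Root.square-im-error Exp.square-im-error Y≡L-Z)
        where
        W X L Y Z : ℕ → ℚ
        W n = seq (im (w *ᶜ w)) n
        X n = seq (im (eˣ *ᶜ eˣ)) n
        L n = fromℕ 2 * seq (im eˣ) n
        Y n = Σ≤ n (λ k → (e *ˢ e) k * imᵖ x n k)
        Z n = Σ≤ n (λ k → (expˢ *ˢ expˢ) k * imᵖ x n k)
        Y≡L-Z : ∀ n → Y n ≡ L n - Z n
        Y≡L-Z n = trans (Σ-e-square n (imᵖ x n)) (cong (λ s → fromℕ 2 * s - Z n) (sym (Exp.limit-im n)))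

      re-positive : fromℚ 0ℚ Defs.< re w
      -- Half of the lower bound 1 - ρ, so that the inequality at each stage is strict.
      re-positive = (1ℚ - ρ) * ½ , 0<* 0<1-ρ (ℚ.positive⁻¹ ½) , from , λ n from≤n → begin-strict
        0ℚ + (1ℚ - ρ) * ½                   ≡⟨ ℚ.+-identityˡ ((1ℚ - ρ) * ½) ⟩
        (1ℚ - ρ) * ½                        <⟨ <-+pos ((1ℚ - ρ) * ½) (0<* 0<1-ρ (ℚ.positive⁻¹ ½)) ⟩
        (1ℚ - ρ) * ½ + (1ℚ - ρ) * ½         ≡⟨ solve 1 (λ s → s :* con ½ :+ s :* con ½ := s) refl (1ℚ - ρ) ⟩
        1ℚ - ρ                              ≤⟨ e-series-lower 0≤R ρ<1 exp-1-bound {reᵖ x n} refl (λ k → ℚ.≤-trans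
                                                 (reᵖ-bound x 0≤tR {n} (inside n from≤n) k) (^-mono-≤ k 0≤tR tR≤R)) n ⟩
        Σ≤ n (λ k → e k * reᵖ x n k)        ≡⟨ Root.limit-re n ⟨
        seq (re w) n                        ∎
        where
        open ℚ.≤-Reasoning
        0<1-ρ : 0ℚ < 1ℚ - ρ
        0<1-ρ = <⇒0<- ρ<1
        tR≤R : t * R ≤ R
        tR≤R = subst (t * R ≤_) (ℚ.*-identityˡ R) (*-monoʳ 0≤R t≤1)

      solution : ∃[ eˣ ] ∃[ w ]
        IsExp x eˣ × IsPrincipalSqrt (eˣ *ᶜ (ratᶜ (fromℕ 2) -ᶜ eˣ)) w × PowerSeries e x w
      solution = eˣ , w , Exp.limit-sum , ((re-square , im-square) , inj₁ re-positive) , Root.limit-sum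

-- Rational bounds extracted from ln 2, and the disk of convergence.

module LogTwo where

  open Prelude
  open FiniteSums
  open RationalOrder
  open CoefficientBounds
  open ComplexSeries
  open SeriesLimits
  open +-*-Solver using (solve; _:=_; _:+_; _:*_; _:-_; :-_; con)

  real-power : ∀ l m k → reᵖ (fromℝ l) m k ≡ seq l m ^ k × imᵖ (fromℝ l) m k ≡ 0ℚ
  real-power l m zero    = refl , refl
  real-power l m (suc k) =
    trans (cong₂ (λ p q → seq l m * p - 0ℚ * q) (proj₁ (real-power l m k)) (proj₂ (real-power l m k)))
      (solve 1 (λ p → p :- con 0ℚ :* con 0ℚ := p) refl (seq l m * seq l m ^ k)) ,
    trans (cong (λ q → seq l m * q + 0ℚ * reᵖ (fromℝ l) m k) (proj₂ (real-power l m k)))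
      (solve 2 (λ a p → a :* con 0ℚ :+ con 0ℚ :* p := con 0ℚ) refl (seq l m) (reᵖ (fromℝ l) m k))

  module _ {ln2 : ℝ} (isLn2 : IsLn2 ln2) {L : ℚ} (0≤L : 0ℚ ≤ L)
           {K : ℕ} (L≤ : ∀ m → K ℕ.≤ m → L ≤ seq ln2 m) where

    private
      expᴸ : ℕ → ℚ
      expᴸ n = Σ≤ n (λ k → 1/ k ! * L ^ k)

      exceeds : ∀ n m ε → expᴸ n ≡ fromℕ 2 + ε → ∀ n′ → n ℕ.≤ n′ → K ℕ.≤ m →
        ε ≤ seq (re (partialSumᵖ (fromℝ ln2) 1/_! n′ -ᶜ ratᶜ (fromℕ 2))) m
      exceeds n m ε eq n′ n≤n′ K≤m = begin
        ε                                                 ≡⟨ solve 2 (λ c ε → ε := c :+ ε :- c) refl (fromℕ 2) ε ⟩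
        fromℕ 2 + ε - fromℕ 2                             ≡⟨ cong (_- fromℕ 2) eq ⟨
        expᴸ n - fromℕ 2                                  ≤⟨ ℚ.+-monoˡ-≤ (- fromℕ 2) (ℚ.≤-trans
                                                               (Σ-monoˡ (λ k → 1/ k ! * L ^ k) (λ k → 0≤* (0≤1/! k) (^-nonNeg k 0≤L)) n≤n′)
                                                               (Σ-mono n′ λ k _ → *-monoˡ (0≤1/! k) (^-mono-≤ k 0≤L (L≤ m K≤m)))) ⟩
        Σ≤ n′ (λ k → 1/ k ! * seq ln2 m ^ k) - fromℕ 2     ≡⟨ cong (_- fromℕ 2) (Σ-cong n′ λ k _ → cong (1/ k ! *_) (proj₁ (real-power ln2 m k))) ⟨
        Σ≤ n′ (λ k → 1/ k ! * reᵖ (fromℝ ln2) m k) - fromℕ 2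
                                                          ≡⟨ cong (_- fromℕ 2) (partialSum-re (fromℝ ln2) 1/_! n′ m) ⟨
        seq (re (partialSumᵖ (fromℝ ln2) 1/_! n′)) m - fromℕ 2 ∎
        where open ℚ.≤-Reasoning

      -- If a partial sum at L exceeded 2 by ε, then, all terms being non-negative and L lying below
      -- the late approximations of ln 2, all later partial sums of the series at ln 2 would exceed
      -- 2 by at least ε at every late stage, against their convergence to 2.
      exp-bound : ∀ n → expᴸ n ≤ fromℕ 2
      exp-bound n = ℚ.≮⇒≥ λ 2<exp → ℚ.<-irrefl refl (contra 2<exp)
        where
        open ℚ.≤-Reasoning
        ε : ℚ
        ε = expᴸ n - fromℕ 2
        contra : fromℕ 2 < expᴸ n → ε < ε
        contra 2<exp = begin-strict
          ε                      ≤⟨ exceeds n m ε (solve 2 (λ c s → s := c :+ (s :- c)) refl (fromℕ 2) (expᴸ n)) n′ (ℕ.m≤m⊔n n N)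
                                      (ℕ.≤-trans (ℕ.m≤m⊔n K M) (ℕ.m≤m⊔n (K ℕ.⊔ M) M′)) ⟩
          seq (re z) m           ≤⟨ p≤∣p∣ (seq (re z) m) ⟩
          ∣ seq (re z) m ∣       ≤⟨ proj₁ (modulus-upper z m) ⟩
          seq Defs.∣ z ∣ m + mesh m
                                 ≤⟨ ℚ.+-monoʳ-≤ (seq Defs.∣ z ∣ m) (proj₂ fine m (ℕ.m≤n⊔m (K ℕ.⊔ M) M′)) ⟩
          seq Defs.∣ z ∣ m + δ   <⟨ proj₂ (proj₂ (proj₂ z<ε)) m (ℕ.≤-trans (ℕ.m≤n⊔m K M) (ℕ.m≤m⊔n (K ℕ.⊔ M) M′)) ⟩
          ε                      ∎
          where
          0<ε : 0ℚ < ε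
          0<ε = <⇒0<- 2<exp
          N n′ : ℕ
          N = proj₁ (isLn2 ε 0<ε)
          n′ = n ℕ.⊔ N
          z : ℂ
          z = partialSumᵖ (fromℝ ln2) 1/_! n′ -ᶜ ratᶜ (fromℕ 2)
          z<ε : Defs.∣ z ∣ Defs.< fromℚ ε
          z<ε = proj₂ (isLn2 ε 0<ε) n′ (ℕ.m≤n⊔m n N)
          δ : ℚ
          δ = proj₁ z<ε
          -- The real part is bounded by the approximate modulus only up to `mesh m`; the rational
          -- gap δ in `z<ε` absorbs this.
          fine : ∃[ M ] ∀ m → M ℕ.≤ m → mesh m ≤ δ
          fine = mesh-small δ (proj₁ (proj₂ z<ε))
          M M′ m : ℕ
          M = proj₁ (proj₂ (proj₂ z<ε))
          M′ = proj₁ fine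
          m = K ℕ.⊔ M ℕ.⊔ M′

    exp-1-bound-ln2 : ∀ n → Σ≤ n (λ k → exp-1ˢ k * L ^ k) ≤ 1ℚ
    exp-1-bound-ln2 n = begin
      Σ≤ n (λ k → exp-1ˢ k * L ^ k)                    ≡⟨ solve 1 (λ s → s := con 1ℚ :+ s :- con 1ℚ) refl (Σ≤ n (λ k → exp-1ˢ k * L ^ k)) ⟩
      1ℚ + Σ≤ n (λ k → exp-1ˢ k * L ^ k) - 1ℚ          ≡⟨ cong (_- 1ℚ) (Σ-exp n L) ⟨
      expᴸ n - 1ℚ                                      ≤⟨ ℚ.+-monoˡ-≤ (- 1ℚ) (exp-bound n) ⟩
      fromℕ 2 - 1ℚ                                     ≡⟨⟩
      1ℚ                                               ∎
      where open ℚ.≤-Reasoning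

  -- Convexity of eˣ - 1: there is no constant term, and ρᵏ ≤ ρ for k ≥ 1.
  exp-1-bound-scale : ∀ {ρ L} → 0ℚ ≤ ρ → ρ ≤ 1ℚ → 0ℚ ≤ L →
    (∀ n → Σ≤ n (λ k → exp-1ˢ k * L ^ k) ≤ 1ℚ) → ∀ n → Σ≤ n (λ k → exp-1ˢ k * (ρ * L) ^ k) ≤ ρ
  exp-1-bound-scale {ρ} {L} 0≤ρ ρ≤1 0≤L bound n = begin
    Σ≤ n (λ k → exp-1ˢ k * (ρ * L) ^ k)      ≤⟨ Σ-mono n (λ k _ → term k) ⟩
    Σ≤ n (λ k → ρ * (exp-1ˢ k * L ^ k))      ≡⟨ Σ-*ˡ n ρ (λ k → exp-1ˢ k * L ^ k) ⟩
    ρ * Σ≤ n (λ k → exp-1ˢ k * L ^ k)        ≤⟨ *-monoˡ 0≤ρ (bound n) ⟩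
    ρ * 1ℚ                                   ≡⟨ ℚ.*-identityʳ ρ ⟩
    ρ                                        ∎
    where
    open ℚ.≤-Reasoning
    term : ∀ k → exp-1ˢ k * (ρ * L) ^ k ≤ ρ * (exp-1ˢ k * L ^ k)
    term zero    = ℚ.≤-reflexive (sym (ℚ.*-zeroʳ ρ))
    term (suc k) = begin
      u * (ρ * L) ^ suc k             ≡⟨ cong (u *_) (Pow.^-distrib-* ρ L (suc k)) ⟩
      u * (ρ ^ suc k * L ^ suc k)     ≤⟨ *-monoˡ (exp-1-nonNeg (suc k)) (*-monoʳ (^-nonNeg (suc k) 0≤L) (^-antimono {n = suc k} 0≤ρ ρ≤1 (ℕ.s≤s ℕ.z≤n))) ⟩
      u * (ρ ^ 1 * L ^ suc k)         ≡⟨ solve 3 (λ u r l → u :* (r :* con 1ℚ :* l) := r :* (u :* l)) refl u ρ (L ^ suc k) ⟩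
      ρ * (u * L ^ suc k)             ∎
      where
      u : ℚ
      u = exp-1ˢ (suc k)

  -- The radii r < R < L separate |x| from ln 2; t = r / R and ρ = R / L.
  convergence-disk : ∀ {ln2} → IsLn2 ln2 → ∀ {x} → Defs.∣ x ∣ Defs.< ln2 →
    ∃[ t ] ∃[ R ] ∃[ ρ ] InnerDisk x t R × ρ < 1ℚ × (∀ n → Σ≤ n (λ k → exp-1ˢ k * R ^ k) ≤ ρ)
  convergence-disk {ln2} isLn2 {x} (δ , 0<δ , N , gap) =
    t , R , ρ ,
    record { 0≤t = proj₁ (proj₂ tR) ; t<1 = proj₁ (proj₂ (proj₂ tR)) ; 0≤R = 0≤R ; from = K
           ; inside = λ m K≤m → ℚ.≤-trans (proj₂ (modulus-upper x m))
               (subst (λ r′ → (X m + mesh m) * (X m + mesh m) ≤ r′ * r′) (sym tR≡r) (square-mono m (X+mesh≤r m K≤m))) } ,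
    proj₁ (proj₂ (proj₂ ρL)) ,
    subst (λ R′ → ∀ n → Σ≤ n (λ k → exp-1ˢ k * R′ ^ k) ≤ ρ) ρL≡R
      (exp-1-bound-scale (proj₁ (proj₂ ρL)) (ℚ.<⇒≤ (proj₁ (proj₂ (proj₂ ρL)))) 0≤L (exp-1-bound-ln2 isLn2 0≤L L≤))
    where
    open ℚ.≤-Reasoning
    X : ℕ → ℚ
    X = seq Defs.∣ x ∣
    q : ℚ
    q = quarter δ
    0<q : 0ℚ < q
    0<q = 0<quarter 0<δ
    X-cauchy : ∃[ N ] ∀ m n → N ℕ.≤ m → N ℕ.≤ n → ∣ X m - X n ∣ < q
    X-cauchy = cauchy Defs.∣ x ∣ q 0<q
    ln2-cauchy : ∃[ N ] ∀ m n → N ℕ.≤ m → N ℕ.≤ n → ∣ seq ln2 m - seq ln2 n ∣ < q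
    ln2-cauchy = cauchy ln2 q 0<q
    fine : ∃[ N ] ∀ m → N ℕ.≤ m → mesh m ≤ q
    fine = mesh-small q 0<q
    N₁ N₂ N₃ K : ℕ
    N₁ = proj₁ X-cauchy
    N₂ = proj₁ ln2-cauchy
    N₃ = proj₁ fine
    K = (N ℕ.⊔ N₁) ℕ.⊔ (N₂ ℕ.⊔ N₃)
    N≤K : N ℕ.≤ K
    N≤K = ℕ.≤-trans (ℕ.m≤m⊔n N N₁) (ℕ.m≤m⊔n (N ℕ.⊔ N₁) (N₂ ℕ.⊔ N₃))
    N₁≤K : N₁ ℕ.≤ K
    N₁≤K = ℕ.≤-trans (ℕ.m≤n⊔m N N₁) (ℕ.m≤m⊔n (N ℕ.⊔ N₁) (N₂ ℕ.⊔ N₃))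
    N₂≤K : N₂ ℕ.≤ K
    N₂≤K = ℕ.≤-trans (ℕ.m≤m⊔n N₂ N₃) (ℕ.m≤n⊔m (N ℕ.⊔ N₁) (N₂ ℕ.⊔ N₃))
    N₃≤K : N₃ ℕ.≤ K
    N₃≤K = ℕ.≤-trans (ℕ.m≤n⊔m N₂ N₃) (ℕ.m≤n⊔m (N ℕ.⊔ N₁) (N₂ ℕ.⊔ N₃))
    s r L : ℚ
    s = X K
    -- The gap δ is spent in quarters: one for the variation of |x| after stage K, one for the mesh
    -- of its approximate modulus, one to separate r from L, and the last for the variation of ln 2.
    r = s + q + q
    L = r + q
    0≤s : 0ℚ ≤ s
    0≤s = modulus-nonNeg x K
    0≤r : 0ℚ ≤ r
    0≤r = ℚ.+-mono-≤ (ℚ.+-mono-≤ 0≤s (ℚ.<⇒≤ 0<q)) (ℚ.<⇒≤ 0<q)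
    0≤X+mesh : ∀ m → 0ℚ ≤ X m + mesh m
    0≤X+mesh m = ℚ.+-mono-≤ (modulus-nonNeg x m) (ℚ.<⇒≤ (ℚ.positive⁻¹ (mesh m)))
    square-mono : ∀ m → X m + mesh m ≤ r → (X m + mesh m) * (X m + mesh m) ≤ r * r
    square-mono m le = *-mono-≤ (0≤X+mesh m) 0≤r le le
    X+mesh≤r : ∀ m → K ℕ.≤ m → X m + mesh m ≤ r
    X+mesh≤r m K≤m = begin
      X m + mesh m               ≡⟨ cong (_+ mesh m) (solve 2 (λ a s → a := s :+ (a :- s)) refl (X m) s) ⟩
      s + (X m - s) + mesh m     ≤⟨ ℚ.+-mono-≤ (ℚ.+-monoʳ-≤ s (ℚ.≤-trans (p≤∣p∣ (X m - s))
                                      (ℚ.<⇒≤ (proj₂ X-cauchy m K (ℕ.≤-trans N₁≤K K≤m) N₁≤K))))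
                                      (proj₂ fine m (ℕ.≤-trans N₃≤K K≤m)) ⟩
      r                          ∎
    L≤ : ∀ m → K ℕ.≤ m → L ≤ seq ln2 m
    L≤ m K≤m = begin
      s + q + q + q              ≡⟨ solve 2 (λ s q → s :+ q :+ q :+ q := s :+ (q :+ q :+ q :+ q) :- q) refl s q ⟩
      s + (q + q + q + q) - q    ≡⟨ cong (λ d → s + d - q) (4*quarter δ) ⟩
      s + δ - q                  ≤⟨ ℚ.+-mono-≤ (ℚ.<⇒≤ (gap K N≤K)) (ℚ.neg-antimono-≤ (ℚ.≤-trans (p≤∣p∣ (seq ln2 K - seq ln2 m))
                                      (ℚ.<⇒≤ (proj₂ ln2-cauchy K m N₂≤K (ℕ.≤-trans N₂≤K K≤m))))) ⟩
      seq ln2 K - (seq ln2 K - seq ln2 m) ≡⟨ solve 2 (λ a b → a :- (a :- b) := b) refl (seq ln2 K) (seq ln2 m) ⟩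
      seq ln2 m                  ∎
    between : ∃[ R ] r < R × R < L
    between = ℚ.<-dense (<-+pos r 0<q)
    R : ℚ
    R = proj₁ between
    0≤R : 0ℚ ≤ R
    0≤R = ℚ.≤-trans 0≤r (ℚ.<⇒≤ (proj₁ (proj₂ between)))
    0≤L : 0ℚ ≤ L
    0≤L = ℚ.≤-trans 0≤R (ℚ.<⇒≤ (proj₂ (proj₂ between)))
    tR : ∃[ t ] 0ℚ ≤ t × t < 1ℚ × t * R ≡ r
    tR = ratio 0≤r (proj₁ (proj₂ between))
    ρL : ∃[ ρ ] 0ℚ ≤ ρ × ρ < 1ℚ × ρ * L ≡ R
    ρL = ratio 0≤R (proj₂ (proj₂ between))
    t ρ : ℚ
    t = proj₁ tR
    ρ = proj₁ ρL
    tR≡r : t * R ≡ r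
    tR≡r = proj₂ (proj₂ (proj₂ tR))
    ρL≡R : ρ * L ≡ R
    ρL≡R = proj₂ (proj₂ (proj₂ ρL))

  solution : ∀ ln2 → IsLn2 ln2 → ∀ x → Defs.∣ x ∣ Defs.< ln2 → ∃[ eˣ ] ∃[ w ]
    IsExp x eˣ × IsPrincipalSqrt (eˣ *ᶜ (ratᶜ (fromℕ 2) -ᶜ eˣ)) w × PowerSeries e x w
  solution ln2 isLn2 x ∣x∣<ln2 =
    let t , R , ρ , disk , ρ<1 , bound = convergence-disk isLn2 ∣x∣<ln2
    in  Solution.solution {x} {t} {R} disk {ρ} ρ<1 bound

open import Defs
open import Data.Nat.Base using (ℕ; suc; NonZero)
open import Data.Product.Base using (_×_; ∃-syntax)
open import Data.Rational.Base using (0ℚ; 1ℚ; ½; -½) renaming (_*_ to _*ℚ_)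
open import Relation.Binary.PropositionalEquality using (_≡_)
open import Data.Product.Base using (_,_)
open import Relation.Binary.PropositionalEquality using (refl)

theorem6p6 : (∀ (ln2 : ℝ) → IsLn2 ln2 → ∀ (x : ℂ) → ∣ x ∣ < ln2 →
    ∃[ eˣ ] ∃[ w ]
    IsExp x eˣ ×
    IsPrincipalSqrt (eˣ *ᶜ (ratᶜ (fromℕ 2) -ᶜ eˣ)) w ×
    PowerSeries e x w)
    ×
    (e 0 ≡ 1ℚ × e 1 ≡ 0ℚ × e 2 ≡ -½ × e 3 ≡ -½ ×
    d 1 ≡ 1ℚ × fromℕ 2 *ℚ d 2 ≡ 0ℚ × fromℕ 3 *ℚ d 3 ≡ ½ × fromℕ 4 *ℚ d 4 ≡ ½)
    ×
    (∀ (n : ℕ) → .{{NonZero n}} →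
    d (suc n) ≡ ((-1^ n) *ℚ 1/ℕ (suc n)) *ℚ det (E n) ×
    e n ≡ (-1^ n) *ℚ det (F n))
theorem6p6 = LogTwo.solution
  -- The listed initial values are closed rational expressions and hold by evaluation.
  , (refl , refl , refl , refl , refl , refl , refl , refl)
  , λ n → HessenbergDeterminants.d-det n , HessenbergDeterminants.e-det n
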